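{- There exists an absolute constant $c>0$ such that for all $k\ge 3$ and all $m=m(n)$ with $m/n\geq c\,2^k\ln^2 k/k$ the following holds with high probability (i.e. with probability $1-o(1)$ as $n\to\infty$) over the random formula $\Phi=\Phi_k(n,m)$: $$\mathrm{suc}\big(\Phi,\lceil \exp(n/k^2)\rceil\big)\leq \exp(-n/k^2).$$
   Context: For integers $k\ge 3$ and $n,m>0$, $\Phi=\Phi_k(n,m)=\Phi_1\wedge\cdots\wedge\Phi_m$ is a random $k$-CNF on the Boolean variables $x_1,\dots,x_n$ whose clauses $\Phi_i=\Phi_{i1}\vee\cdots\vee\Phi_{ik}$ consist of $k$ literals; it is chosen uniformly at random from all $(2n)^{km}$ such formulas. For an assignment $\sigma\in\{0,1\}^n$, $U_\Phi(\sigma)$ is the set of indices $i\in[m]$ such that $\Phi_i$ is unsatisfied under $\sigma$. The algorithm Walksat$(\Phi,\omega)$ (with $\omega$ a positive integer) works as follows: choose $\sigma^{[0]}\in\{0,1\}^n$ uniformly at random; for $i=0,\dots,\omega$: if $\sigma^{[i]}$ satisfies $\Phi$, output it and halt; otherwise choose $i'\in U_\Phi(\sigma^{[i]})$ and $j\in[k]$ uniformly at random (independently) and obtain $\sigma^{[i+1]}$ from $\sigma^{[i]}$ by flipping the value of the variable underlying the literal $\Phi_{i'j}$. If no satisfying assignment is found, output failure. $\mathrm{suc}(\Phi,\omega)$ denotes the probability, over the random choices of the algorithm only (for fixed $\Phi$), that Walksat$(\Phi,\omega)$ finds a satisfying assignment. -}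

module Defs where

open import Algebra.Bundles using (CommutativeRing)
open import Data.Bool.Base using (Bool; true; false; not; if_then_else_; T)
open import Data.Bool.ListAction using (any)
open import Data.Fin.Base using (Fin; zero)
open import Data.Fin.Properties using (*↔×; 2↔Bool)
open import Data.Integer.Base as ℤ using (+_; -[1+_])
import Data.Integer.Properties as ℤ
open import Data.List.Base as List using (List; []; _∷_; allFin; filterᵇ; length)
open import Data.Maybe.Base using (Maybe; just; nothing; is-just)
open import Data.Nat.Base as ℕ using (ℕ; zero; suc; NonZero; pred; _!; s≤s; z≤n)
import Data.Nat.Properties as ℕ
open import Data.Product.Base using (Σ; ∃; _×_; _,_; proj₁; proj₂)
open import Data.Product.Function.NonDependent.Propositional using (_×-↔_)
open import Data.Rational.Base as ℚ
  using (ℚ; mkℚ; 0ℚ; 1ℚ; ½; _/_; _+_; _-_; _*_; -_; ∣_∣; _≤_; _<_;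
         Positive; NonNegative; toℚᵘ; positive; nonNegative; 1/_)
open import Data.Rational.Properties as ℚ
  using (+-0-commutativeMonoid; +-*-commutativeRing)
open import Data.Rational.Solver using (module +-*-Solver)
import Data.Rational.Unnormalised.Base as ℚᵘ
import Data.Rational.Unnormalised.Properties as ℚᵘ
open import Data.Sum.Base using (inj₁; inj₂)
open import Data.Vec.Base as Vec using (Vec; []; _∷_; lookup; toList; updateAt)
open import Function.Base using (_∘_; case_of_)
open import Function.Bundles using (_↔_; mk↔ₛ′; module Inverse)
open import Function.Properties.Inverse using (↔-refl; ↔-trans)
open import Relation.Binary.PropositionalEquality
  using (_≡_; refl; sym; trans; cong; cong₂; subst)

open import Algebra.Properties.CommutativeMonoid.Sum +-0-commutativeMonoid using (sum)
open import Algebra.Properties.Semiring.Exp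
  (CommutativeRing.semiring +-*-commutativeRing) using (_^_)

fromℕ : ℕ → ℚ
fromℕ n = + n / 1

private
  /-* : ∀ a b c d .{{_ : NonZero b}} .{{_ : NonZero d}} .{{_ : NonZero (b ℕ.* d)}} →
        (+ a / b) * (+ c / d) ≡ + (a ℕ.* c) / (b ℕ.* d)
  /-* a b@(suc b₁) c d@(suc d₁) = ℚ.toℚᵘ-injective (begin
    toℚᵘ ((+ a / b) * (+ c / d))             ≈⟨ ℚ.toℚᵘ-homo-* (+ a / b) (+ c / d) ⟩
    toℚᵘ (+ a / b) ℚᵘ.* toℚᵘ (+ c / d)       ≈⟨ ℚᵘ.*-cong (ℚ.toℚᵘ-fromℚᵘ (ℚᵘ.mkℚᵘ (+ a) b₁))
                                                          (ℚ.toℚᵘ-fromℚᵘ (ℚᵘ.mkℚᵘ (+ c) d₁)) ⟩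
    ℚᵘ.mkℚᵘ (+ a) b₁ ℚᵘ.* ℚᵘ.mkℚᵘ (+ c) d₁   ≈⟨ ℚᵘ.*≡* (cong (ℤ._* + (b ℕ.* d)) (sym (ℤ.pos-* a c))) ⟩
    ℚᵘ.mkℚᵘ (+ (a ℕ.* c)) (pred (b ℕ.* d))   ≈⟨ ℚᵘ.≃-sym (ℚ.toℚᵘ-fromℚᵘ (ℚᵘ.mkℚᵘ (+ (a ℕ.* c)) (pred (b ℕ.* d)))) ⟩
    toℚᵘ (+ (a ℕ.* c) / (b ℕ.* d))           ∎)
    where open ℚᵘ.≃-Reasoning

  /-cross : ∀ a b c d .{{_ : NonZero b}} .{{_ : NonZero d}} →
            a ℕ.* d ≡ c ℕ.* b → + a / b ≡ + c / d
  /-cross a b@(suc b₁) c d@(suc d₁) eq =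
    ℚ.fromℚᵘ-cong {ℚᵘ.mkℚᵘ (+ a) b₁} {ℚᵘ.mkℚᵘ (+ c) d₁}
      (ℚᵘ.*≡* (trans (sym (ℤ.pos-* a d)) (trans (cong +_ eq) (ℤ.pos-* c b))))

  /-nonNeg : ∀ a b .{{_ : NonZero b}} → NonNegative (+ a / b)
  /-nonNeg a b = ℚ.normalize-nonNeg a b

  fromℕ-suc : ∀ n → fromℕ (suc n) ≡ 1ℚ + fromℕ n
  fromℕ-suc n = ℚ.toℚᵘ-injective (begin
    toℚᵘ (fromℕ (suc n))                    ≈⟨ ℚ.toℚᵘ-fromℚᵘ (ℚᵘ.mkℚᵘ (+ suc n) 0) ⟩
    ℚᵘ.mkℚᵘ (+ suc n) 0                     ≈⟨ ℚᵘ.*≡* (cong (λ i → (+ 1 ℤ.+ i) ℤ.* + 1) (sym (ℤ.*-identityʳ (+ n)))) ⟩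
    ℚᵘ.mkℚᵘ (+ 1) 0 ℚᵘ.+ ℚᵘ.mkℚᵘ (+ n) 0    ≈⟨ ℚᵘ.+-congʳ (ℚᵘ.mkℚᵘ (+ 1) 0) (ℚᵘ.≃-sym (ℚ.toℚᵘ-fromℚᵘ (ℚᵘ.mkℚᵘ (+ n) 0))) ⟩
    toℚᵘ 1ℚ ℚᵘ.+ toℚᵘ (fromℕ n)             ≈⟨ ℚᵘ.≃-sym (ℚ.toℚᵘ-homo-+ 1ℚ (fromℕ n)) ⟩
    toℚᵘ (1ℚ + fromℕ n)                     ∎)
    where open ℚᵘ.≃-Reasoning

  n*1/n : ∀ n .{{_ : NonZero n}} → fromℕ n * (+ 1 / n) ≡ 1ℚ
  n*1/n n@(suc n₁) = trans (/-* n 1 1 n)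
    (/-cross (n ℕ.* 1) (1 ℕ.* n) 1 1
      (trans (ℕ.*-identityʳ (n ℕ.* 1)) (trans (ℕ.*-comm n 1) (sym (ℕ.*-identityˡ (1 ℕ.* n))))))

  fromℕ-nonNeg : ∀ n → 0ℚ ≤ fromℕ n
  fromℕ-nonNeg n = ℚ.nonNegative⁻¹ (fromℕ n) {{/-nonNeg n 1}}

  0≤1 : 0ℚ ≤ 1ℚ
  0≤1 = fromℕ-nonNeg 1

  p≤1+p : ∀ p → p ≤ 1ℚ + p
  p≤1+p p = subst (_≤ 1ℚ + p) (ℚ.+-identityˡ p) (ℚ.+-monoˡ-≤ p 0≤1)

  fromℕ-mono : ∀ {m n} → m ℕ.≤ n → fromℕ m ≤ fromℕ n
  fromℕ-mono {n = n} z≤n = fromℕ-nonNeg n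
  fromℕ-mono {suc m} {suc n} (s≤s m≤n)
    rewrite fromℕ-suc m | fromℕ-suc n = ℚ.+-monoʳ-≤ 1ℚ (fromℕ-mono m≤n)

  archimedean : ∀ p → ∃ λ n → p ≤ fromℕ n
  archimedean p@(mkℚ i d c) = ℤ.∣ i ∣ , ℚ.toℚᵘ-cancel-≤
    (ℚᵘ.≤-respʳ-≃ (ℚᵘ.≃-sym (ℚ.toℚᵘ-fromℚᵘ (ℚᵘ.mkℚᵘ (+ ℤ.∣ i ∣) 0)))
      (ℚᵘ.*≤* (subst (ℤ._≤ + ℤ.∣ i ∣ ℤ.* + suc d) (sym (ℤ.*-identityʳ i)) (bound i))))
    where
    bound : ∀ i → i ℤ.≤ + ℤ.∣ i ∣ ℤ.* + suc d
    bound (+ n) = subst (+ n ℤ.≤_) (ℤ.pos-* n (suc d)) (ℤ.+≤+ (ℕ.m≤m*n n (suc d)))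
    bound -[1+ n ] = subst (-[1+ n ] ℤ.≤_) (ℤ.pos-* (suc n) (suc d)) ℤ.-≤+

  archimedean-* : ∀ p ε → 0ℚ < ε → ∃ λ j → p ≤ fromℕ (suc j) * ε
  archimedean-* p ε 0<ε = j , (begin
    p                                ≡⟨ sym (ℚ.*-identityʳ p) ⟩
    p * 1ℚ                           ≡⟨ cong (p *_) (sym (ℚ.*-inverseˡ ε)) ⟩
    p * (1/ ε * ε)                   ≡⟨ sym (ℚ.*-assoc p (1/ ε) ε) ⟩
    p * 1/ ε * ε                     ≤⟨ ℚ.*-monoʳ-≤-nonNeg ε p/ε≤j ⟩
    fromℕ j * ε                      ≤⟨ ℚ.*-monoʳ-≤-nonNeg ε (fromℕ-mono (ℕ.n≤1+n j)) ⟩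
    fromℕ (suc j) * ε                ∎)
    where
    open ℚ.≤-Reasoning
    instance
      ε⁺ : Positive ε
      ε⁺ = positive 0<ε
      ε≥0 : NonNegative ε
      ε≥0 = ℚ.pos⇒nonNeg ε
      ε≢0 : ℚ.NonZero ε
      ε≢0 = ℚ.pos⇒nonZero ε
    j = proj₁ (archimedean (p * 1/ ε))
    p/ε≤j = proj₂ (archimedean (p * 1/ ε))

  *-monoʳ-≤′ : ∀ {p q} r → 0ℚ ≤ r → p ≤ q → p * r ≤ q * r
  *-monoʳ-≤′ r 0≤r = ℚ.*-monoʳ-≤-nonNeg r {{nonNegative 0≤r}}

  *-monoˡ-≤′ : ∀ {p q} r → 0ℚ ≤ r → p ≤ q → r * p ≤ r * q
  *-monoˡ-≤′ r 0≤r = ℚ.*-monoˡ-≤-nonNeg r {{nonNegative 0≤r}}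

  *-mono-≤′ : ∀ {p q r s} → 0ℚ ≤ r → 0ℚ ≤ q → p ≤ q → r ≤ s → p * r ≤ q * s
  *-mono-≤′ {p} {q} {r} {s} 0≤r 0≤q p≤q r≤s =
    ℚ.≤-trans (*-monoʳ-≤′ r 0≤r p≤q) (*-monoˡ-≤′ q 0≤q r≤s)

  *-nonNeg : ∀ {p q} → 0ℚ ≤ p → 0ℚ ≤ q → 0ℚ ≤ p * q
  *-nonNeg {p} {q} 0≤p 0≤q = subst (_≤ p * q) (ℚ.*-zeroˡ q) (*-monoʳ-≤′ q 0≤q 0≤p)

  *-pos : ∀ {p q} → 0ℚ < p → 0ℚ < q → 0ℚ < p * q
  *-pos {p} {q} 0<p 0<q =
    ℚ.positive⁻¹ (p * q) {{ℚ.pos*pos⇒pos p {{positive 0<p}} q {{positive 0<q}}}}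

  ∣p-q∣≡∣q-p∣ : ∀ p q → ∣ p - q ∣ ≡ ∣ q - p ∣
  ∣p-q∣≡∣q-p∣ p q = trans (cong ∣_∣ eq) (ℚ.∣-p∣≡∣p∣ (q - p))
    where
    open +-*-Solver
    eq = solve 2 (λ p q → p :- q := :- (q :- p)) refl p q

IsCauchy : (ℕ → ℚ) → Set
IsCauchy s = ∀ ε → 0ℚ < ε → ∃ λ N → ∀ m n → N ℕ.≤ m → N ℕ.≤ n → ∣ s m - s n ∣ ≤ ε

record ℝ : Set where
  constructor _,_
  field
    seq    : ℕ → ℚ
    cauchy : IsCauchy seq

open ℝ public

infix 4 _≤ᵣ_ _<ᵣ_ _≥ᵣ_

_≤ᵣ_ _<ᵣ_ _≥ᵣ_ : ℝ → ℝ → Set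
x ≤ᵣ y = ∀ ε → 0ℚ < ε → ∃ λ N → ∀ n → N ℕ.≤ n → seq x n ≤ seq y n + ε
x <ᵣ y = ∃ λ ε → 0ℚ < ε × ∃ λ N → ∀ n → N ℕ.≤ n → seq x n + ε ≤ seq y n
x ≥ᵣ y = y ≤ᵣ x

fromℚ : ℚ → ℝ
fromℚ q = (λ _ → q) , λ ε 0<ε → 0 , λ _ _ _ _ →
  subst (_≤ ε) (sym (cong ∣_∣ (ℚ.+-inverseʳ q))) (ℚ.<⇒≤ 0<ε)

private
  bounded : ∀ {s} → IsCauchy s → ∃ λ B → 0ℚ < B × ∃ λ N → ∀ n → N ℕ.≤ n → ∣ s n ∣ ≤ B
  bounded {s} cs = 1ℚ + ∣ s N ∣ , 0<B , N , λ n N≤n → begin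
    ∣ s n ∣                  ≡⟨ cong ∣_∣ (eq (s n) (s N)) ⟩
    ∣ (s n - s N) + s N ∣    ≤⟨ ℚ.∣p+q∣≤∣p∣+∣q∣ (s n - s N) (s N) ⟩
    ∣ s n - s N ∣ + ∣ s N ∣  ≤⟨ ℚ.+-monoˡ-≤ ∣ s N ∣ (proj₂ c n N N≤n ℕ.≤-refl) ⟩
    1ℚ + ∣ s N ∣             ∎
    where
    open ℚ.≤-Reasoning
    0<1 : 0ℚ < 1ℚ
    0<1 = ℚ.positive⁻¹ 1ℚ
    c = cs 1ℚ 0<1
    N = proj₁ c
    0<B : 0ℚ < 1ℚ + ∣ s N ∣
    0<B = ℚ.<-≤-trans 0<1
      (subst (_≤ 1ℚ + ∣ s N ∣) (ℚ.+-identityʳ 1ℚ) (ℚ.+-monoʳ-≤ 1ℚ (ℚ.0≤∣p∣ (s N))))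
    eq : ∀ p q → p ≡ (p - q) + q
    eq = solve 2 (λ p q → p := (p :- q) :+ q) refl
      where open +-*-Solver

  quotient : ∀ p q → 0ℚ < p → 0ℚ < q → ∃ λ r → 0ℚ < r × r * q ≡ p
  quotient p q 0<p 0<q = p * 1/ q ,
    *-pos 0<p (ℚ.positive⁻¹ (1/ q) {{ℚ.1/pos⇒pos q}}) ,
    trans (ℚ.*-assoc p (1/ q) q) (trans (cong (p *_) (ℚ.*-inverseˡ q)) (ℚ.*-identityʳ p))
    where
    instance
      q⁺ : Positive q
      q⁺ = positive 0<q
      q≢0 : ℚ.NonZero q
      q≢0 = ℚ.pos⇒nonZero q

  halve : ∀ p → 0ℚ < p → ∃ λ h → 0ℚ < h × h + h ≡ p
  halve p 0<p = ½ * p , *-pos (ℚ.positive⁻¹ ½) 0<p ,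
    trans (sym (ℚ.*-distribʳ-+ p ½ ½)) (ℚ.*-identityˡ p)

  product-bound : ∀ {a b c d δ η B C h ε} → ∣ a - b ∣ ≤ δ → ∣ c ∣ ≤ C → ∣ c - d ∣ ≤ η → ∣ b ∣ ≤ B →
                  δ * C ≡ h → η * B ≡ h → h + h ≡ ε → ∣ a * c - b * d ∣ ≤ ε
  product-bound {a} {b} {c} {d} {δ} {η} {B} {C} {h} {ε} a-b c≤C c-d b≤B δC ηB hh = begin
    ∣ a * c - b * d ∣
      ≡⟨ cong ∣_∣ (split a b c d) ⟩
    ∣ (a - b) * c + (c - d) * b ∣
      ≤⟨ ℚ.∣p+q∣≤∣p∣+∣q∣ ((a - b) * c) ((c - d) * b) ⟩
    ∣ (a - b) * c ∣ + ∣ (c - d) * b ∣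
      ≡⟨ cong₂ _+_ (ℚ.∣p*q∣≡∣p∣*∣q∣ (a - b) c) (ℚ.∣p*q∣≡∣p∣*∣q∣ (c - d) b) ⟩
    ∣ a - b ∣ * ∣ c ∣ + ∣ c - d ∣ * ∣ b ∣
      ≤⟨ ℚ.+-mono-≤
           (*-mono-≤′ (ℚ.0≤∣p∣ c) (ℚ.≤-trans (ℚ.0≤∣p∣ (a - b)) a-b) a-b c≤C)
           (*-mono-≤′ (ℚ.0≤∣p∣ b) (ℚ.≤-trans (ℚ.0≤∣p∣ (c - d)) c-d) c-d b≤B) ⟩
    δ * C + η * B
      ≡⟨ cong₂ _+_ δC ηB ⟩
    h + h
      ≡⟨ hh ⟩
    ε ∎
    where
    open ℚ.≤-Reasoning
    split : ∀ a b c d → a * c - b * d ≡ (a - b) * c + (c - d) * b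
    split = solve 4 (λ a b c d → a :* c :- b :* d := (a :- b) :* c :+ (c :- d) :* b) refl
      where open +-*-Solver

  *-cauchy : ∀ {s t} → IsCauchy s → IsCauchy t → IsCauchy (λ n → s n * t n)
  *-cauchy {s} {t} cs ct ε 0<ε =
    let B , 0<B , N₁ , s≤B = bounded {s} cs
        C , 0<C , N₂ , t≤C = bounded {t} ct
        h , 0<h , hh       = halve ε 0<ε
        δ , 0<δ , δC       = quotient h C 0<h 0<C
        η , 0<η , ηB       = quotient h B 0<h 0<B
        N₃ , s-close       = cs δ 0<δ
        N₄ , t-close       = ct η 0<η
        N = N₁ ℕ.⊔ N₂ ℕ.⊔ (N₃ ℕ.⊔ N₄)
        N₁₂≤N = ℕ.m≤m⊔n (N₁ ℕ.⊔ N₂) (N₃ ℕ.⊔ N₄)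
        N₃₄≤N = ℕ.m≤n⊔m (N₁ ℕ.⊔ N₂) (N₃ ℕ.⊔ N₄)
        N₁≤N = ℕ.≤-trans (ℕ.m≤m⊔n N₁ N₂) N₁₂≤N
        N₂≤N = ℕ.≤-trans (ℕ.m≤n⊔m N₁ N₂) N₁₂≤N
        N₃≤N = ℕ.≤-trans (ℕ.m≤m⊔n N₃ N₄) N₃₄≤N
        N₄≤N = ℕ.≤-trans (ℕ.m≤n⊔m N₃ N₄) N₃₄≤N
    in N , λ m n N≤m N≤n → product-bound {s m} {s n} {t m} {t n}
      (s-close m n (ℕ.≤-trans N₃≤N N≤m) (ℕ.≤-trans N₃≤N N≤n))
      (t≤C m (ℕ.≤-trans N₂≤N N≤m))
      (t-close m n (ℕ.≤-trans N₄≤N N≤m) (ℕ.≤-trans N₄≤N N≤n))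
      (s≤B n (ℕ.≤-trans N₁≤N N≤n))
      δC ηB hh

infixl 7 _*ᵣ_

_*ᵣ_ : ℝ → ℝ → ℝ
(s , cs) *ᵣ (t , ct) = (λ n → s n * t n) , *-cauchy {s} {t} cs ct

partialSum : (ℕ → ℚ) → ℕ → ℚ
partialSum a zero    = 0ℚ
partialSum a (suc n) = partialSum a n + a n

private
  -- Ratio test with ratio d / (1 + d).
  module Ratio (a : ℕ → ℚ) (d : ℚ) (0≤d : 0ℚ ≤ d) (M : ℕ)
    (ratio : ∀ i → M ℕ.≤ i → (1ℚ + d) * ∣ a (suc i) ∣ ≤ d * ∣ a i ∣) where

    open ℚ.≤-Reasoning

    S : ℕ → ℚ
    S = partialSum a

    D : ℕ → ℚ
    D n = (1ℚ + d) * ∣ a n ∣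

    0≤1+d : 0ℚ ≤ 1ℚ + d
    0≤1+d = ℚ.≤-trans 0≤d (p≤1+p d)

    0<1+d : 0ℚ < 1ℚ + d
    0<1+d = ℚ.<-≤-trans (ℚ.positive⁻¹ 1ℚ)
      (subst (_≤ 1ℚ + d) (ℚ.+-identityʳ 1ℚ) (ℚ.+-monoʳ-≤ 1ℚ 0≤d))

    D-nonNeg : ∀ n → 0ℚ ≤ D n
    D-nonNeg n = *-nonNeg 0≤1+d (ℚ.0≤∣p∣ (a n))

    step : ∀ i → M ℕ.≤ i → ∣ a i ∣ + D (suc i) ≤ D i
    step i M≤i = begin
      ∣ a i ∣ + D (suc i)      ≤⟨ ℚ.+-monoʳ-≤ ∣ a i ∣ (ratio i M≤i) ⟩
      ∣ a i ∣ + d * ∣ a i ∣    ≡⟨ solve 2 (λ b d → b :+ d :* b := (con 1ℚ :+ d) :* b) refl ∣ a i ∣ d ⟩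
      D i                      ∎
      where open +-*-Solver

    tail : ∀ j n → M ℕ.≤ n → ∣ S (j ℕ.+ n) - S n ∣ + D (j ℕ.+ n) ≤ D n
    tail zero n M≤n = ℚ.≤-reflexive
      (trans (cong (λ q → ∣ q ∣ + D n) (ℚ.+-inverseʳ (S n))) (ℚ.+-identityˡ (D n)))
    tail (suc j) n M≤n = begin
      ∣ S i + a i - S n ∣ + D (suc i)            ≡⟨ cong (λ q → ∣ q ∣ + D (suc i)) (swap (S i) (a i) (S n)) ⟩
      ∣ (S i - S n) + a i ∣ + D (suc i)          ≤⟨ ℚ.+-monoˡ-≤ (D (suc i)) (ℚ.∣p+q∣≤∣p∣+∣q∣ (S i - S n) (a i)) ⟩
      ∣ S i - S n ∣ + ∣ a i ∣ + D (suc i)        ≡⟨ ℚ.+-assoc ∣ S i - S n ∣ ∣ a i ∣ (D (suc i)) ⟩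
      ∣ S i - S n ∣ + (∣ a i ∣ + D (suc i))      ≤⟨ ℚ.+-monoʳ-≤ ∣ S i - S n ∣ (step i (ℕ.≤-trans M≤n (ℕ.m≤n+m n j))) ⟩
      ∣ S i - S n ∣ + D i                        ≤⟨ tail j n M≤n ⟩
      D n                                        ∎
      where
      i = j ℕ.+ n
      swap : ∀ p q r → p + q - r ≡ (p - r) + q
      swap = solve 3 (λ p q r → p :+ q :- r := (p :- r) :+ q) refl
        where open +-*-Solver

    tail′ : ∀ n p → M ℕ.≤ n → n ℕ.≤ p → ∣ S p - S n ∣ ≤ D n
    tail′ n p M≤n n≤p = begin
      ∣ S p - S n ∣                ≡⟨ sym (ℚ.+-identityʳ ∣ S p - S n ∣) ⟩
      ∣ S p - S n ∣ + 0ℚ           ≤⟨ ℚ.+-monoʳ-≤ ∣ S p - S n ∣ (D-nonNeg p) ⟩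
      ∣ S p - S n ∣ + D p          ≤⟨ subst (λ q → ∣ S q - S n ∣ + D q ≤ D n) (ℕ.m∸n+n≡m n≤p)
                                        (tail (p ℕ.∸ n) n M≤n) ⟩
      D n                          ∎

    decr : ∀ i → M ℕ.≤ i → ∣ a (suc i) ∣ ≤ ∣ a i ∣
    decr i M≤i = ℚ.*-cancelˡ-≤-pos (1ℚ + d) {{positive 0<1+d}}
      (ℚ.≤-trans (ratio i M≤i) (*-monoʳ-≤′ ∣ a i ∣ (ℚ.0≤∣p∣ (a i)) (p≤1+p d)))

    weighted : ∀ j → fromℕ j * ∣ a (j ℕ.+ M) ∣ + D (j ℕ.+ M) ≤ D M
    weighted zero = ℚ.≤-reflexive
      (trans (cong (_+ D M) (ℚ.*-zeroˡ ∣ a M ∣)) (ℚ.+-identityˡ (D M)))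
    weighted (suc j) = begin
      fromℕ (suc j) * ∣ a (suc i) ∣ + D (suc i)         ≤⟨ ℚ.+-monoˡ-≤ (D (suc i)) (*-monoˡ-≤′ (fromℕ (suc j)) (fromℕ-nonNeg (suc j)) (decr i M≤i)) ⟩
      fromℕ (suc j) * ∣ a i ∣ + D (suc i)               ≡⟨ cong (λ q → q * ∣ a i ∣ + D (suc i)) (fromℕ-suc j) ⟩
      (1ℚ + fromℕ j) * ∣ a i ∣ + D (suc i)              ≡⟨ regroup (fromℕ j) ∣ a i ∣ (D (suc i)) ⟩
      fromℕ j * ∣ a i ∣ + (∣ a i ∣ + D (suc i))         ≤⟨ ℚ.+-monoʳ-≤ (fromℕ j * ∣ a i ∣) (step i M≤i) ⟩
      fromℕ j * ∣ a i ∣ + D i                           ≤⟨ weighted j ⟩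
      D M                                               ∎
      where
      i = j ℕ.+ M
      M≤i = ℕ.m≤n+m M j
      regroup : ∀ u b e → (1ℚ + u) * b + e ≡ u * b + (b + e)
      regroup = solve 3 (λ u b e → (con 1ℚ :+ u) :* b :+ e := u :* b :+ (b :+ e)) refl
        where open +-*-Solver

    null : ∀ ε → 0ℚ < ε → ∃ λ N → M ℕ.≤ N × D N ≤ ε
    null ε 0<ε = suc j ℕ.+ M , ℕ.m≤n+m M (suc j) ,
      ℚ.*-cancelˡ-≤-pos (fromℕ (suc j)) {{ℚ.normalize-pos (suc j) 1}} (begin
        fromℕ (suc j) * ((1ℚ + d) * b)      ≡⟨ swap (fromℕ (suc j)) (1ℚ + d) b ⟩
        (1ℚ + d) * (fromℕ (suc j) * b)      ≤⟨ *-monoˡ-≤′ (1ℚ + d) 0≤1+d jb≤DM ⟩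
        (1ℚ + d) * D M                      ≤⟨ proj₂ arch ⟩
        fromℕ (suc j) * ε                   ∎)
      where
      arch = archimedean-* ((1ℚ + d) * D M) ε 0<ε
      j = proj₁ arch
      b = ∣ a (suc j ℕ.+ M) ∣
      swap : ∀ p q r → p * (q * r) ≡ q * (p * r)
      swap = solve 3 (λ p q r → p :* (q :* r) := q :* (p :* r)) refl
        where open +-*-Solver
      jb≤DM : fromℕ (suc j) * b ≤ D M
      jb≤DM = begin
        fromℕ (suc j) * b                             ≡⟨ sym (ℚ.+-identityʳ (fromℕ (suc j) * b)) ⟩
        fromℕ (suc j) * b + 0ℚ                        ≤⟨ ℚ.+-monoʳ-≤ (fromℕ (suc j) * b) (D-nonNeg (suc j ℕ.+ M)) ⟩
        fromℕ (suc j) * b + D (suc j ℕ.+ M)           ≤⟨ weighted (suc j) ⟩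
        D M                                           ∎

    D-antitone : ∀ j n → M ℕ.≤ n → D (j ℕ.+ n) ≤ D n
    D-antitone zero    n M≤n = ℚ.≤-refl
    D-antitone (suc j) n M≤n = ℚ.≤-trans
      (*-monoˡ-≤′ (1ℚ + d) 0≤1+d (decr (j ℕ.+ n) (ℕ.≤-trans M≤n (ℕ.m≤n+m n j))))
      (D-antitone j n M≤n)

    partialSum-cauchy : IsCauchy S
    partialSum-cauchy ε 0<ε = N , λ m n N≤m N≤n → case ℕ.≤-total m n of λ where
        (inj₁ m≤n) → subst (_≤ ε) (∣p-q∣≡∣q-p∣ (S n) (S m)) (close N≤m m≤n)
        (inj₂ n≤m) → close N≤n n≤m
      where
      N = proj₁ (null ε 0<ε)
      M≤N = proj₁ (proj₂ (null ε 0<ε))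
      close : ∀ {n p} → N ℕ.≤ n → n ℕ.≤ p → ∣ S p - S n ∣ ≤ ε
      close {n} {p} N≤n n≤p = begin
        ∣ S p - S n ∣   ≤⟨ tail′ n p (ℕ.≤-trans M≤N N≤n) n≤p ⟩
        D n             ≤⟨ subst (λ q → D q ≤ D N) (ℕ.m∸n+n≡m N≤n) (D-antitone (n ℕ.∸ N) N M≤N) ⟩
        D N             ≤⟨ proj₂ (proj₂ (null ε 0<ε)) ⟩
        ε               ∎

expTerm : ℚ → ℕ → ℚ
expTerm x i = x ^ i * (+ 1 / (i !)) {{i ℕ.!≢0}}

private
  exp-ratio : ∀ x → ∃ λ M → ∀ i → M ℕ.≤ i →
              (1ℚ + 1ℚ) * ∣ expTerm x (suc i) ∣ ≤ 1ℚ * ∣ expTerm x i ∣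
  exp-ratio x = M , λ i M≤i → begin
    (1ℚ + 1ℚ) * ∣ expTerm x (suc i) ∣            ≡⟨ cong (λ q → (1ℚ + 1ℚ) * ∣ q ∣) (unfold i) ⟩
    (1ℚ + 1ℚ) * ∣ x * (u i * expTerm x i) ∣      ≡⟨ cong ((1ℚ + 1ℚ) *_) (abs i) ⟩
    (1ℚ + 1ℚ) * (∣ x ∣ * (u i * b i))            ≡⟨ sym (ℚ.*-assoc (1ℚ + 1ℚ) ∣ x ∣ (u i * b i)) ⟩
    (1ℚ + 1ℚ) * ∣ x ∣ * (u i * b i)              ≤⟨ *-monoʳ-≤′ (u i * b i) (*-nonNeg (0≤u i) (ℚ.0≤∣p∣ (expTerm x i)))
                                                     (ℚ.≤-trans (proj₂ arch) (fromℕ-mono (ℕ.≤-trans M≤i (ℕ.n≤1+n i)))) ⟩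
    fromℕ (suc i) * (u i * b i)                  ≡⟨ sym (ℚ.*-assoc (fromℕ (suc i)) (u i) (b i)) ⟩
    fromℕ (suc i) * u i * b i                    ≡⟨ cong (_* b i) (n*1/n (suc i)) ⟩
    1ℚ * b i                                     ∎
    where
    open ℚ.≤-Reasoning
    arch = archimedean ((1ℚ + 1ℚ) * ∣ x ∣)
    M = proj₁ arch
    u b : ℕ → ℚ
    u i = + 1 / suc i
    b i = ∣ expTerm x i ∣
    0≤u : ∀ i → 0ℚ ≤ u i
    0≤u i = ℚ.nonNegative⁻¹ (u i) {{/-nonNeg 1 (suc i)}}
    unfold : ∀ i → expTerm x (suc i) ≡ x * (u i * expTerm x i)
    unfold i = trans
      (cong (x ^ suc i *_) (sym (/-* 1 (suc i) 1 (i !) {{_}} {{i ℕ.!≢0}} {{suc i ℕ.!≢0}})))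
      (solve 4 (λ x p u v → (x :* p) :* (u :* v) := x :* (u :* (p :* v))) refl
        x (x ^ i) (u i) ((+ 1 / (i !)) {{i ℕ.!≢0}}))
      where open +-*-Solver
    abs : ∀ i → ∣ x * (u i * expTerm x i) ∣ ≡ ∣ x ∣ * (u i * b i)
    abs i = trans (ℚ.∣p*q∣≡∣p∣*∣q∣ x (u i * expTerm x i))
      (cong (∣ x ∣ *_) (trans (ℚ.∣p*q∣≡∣p∣*∣q∣ (u i) (expTerm x i))
        (cong (_* b i) (ℚ.0≤p⇒∣p∣≡p (0≤u i)))))

exp : ℚ → ℝ
exp x = partialSum (expTerm x) ,
  Ratio.partialSum-cauchy (expTerm x) 1ℚ 0≤1 (proj₁ (exp-ratio x)) (proj₂ (exp-ratio x))

-- The logarithm of a positive integer k is - ln (1 - z) = Σ_{i ≥ 1} zⁱ / i at z = 1 - 1/k.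

lnTerm : (k : ℕ) .{{_ : NonZero k}} → ℕ → ℚ
lnTerm k i = (+ pred k / k) ^ suc i * (+ 1 / suc i)

private
  ln-ratio : ∀ k .{{_ : NonZero k}} i → 0 ℕ.≤ i →
             (1ℚ + fromℕ (pred k)) * ∣ lnTerm k (suc i) ∣ ≤ fromℕ (pred k) * ∣ lnTerm k i ∣
  ln-ratio k@(suc k₁) i _ = begin
    (1ℚ + d) * ∣ z ^ suc (suc i) * v (suc i) ∣  ≡⟨ cong₂ _*_ (sym (fromℕ-suc k₁)) (ℚ.0≤p⇒∣p∣≡p (term≥0 (suc i))) ⟩
    fromℕ k * (z * p * v (suc i))               ≡⟨ regroup (fromℕ k) z p (v (suc i)) ⟩
    fromℕ k * z * (p * v (suc i))               ≡⟨ cong (_* (p * v (suc i))) kz≡d ⟩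
    d * (p * v (suc i))                         ≤⟨ *-monoˡ-≤′ d 0≤d (*-monoˡ-≤′ p (pow≥0 (suc i)) (v-decr i)) ⟩
    d * (p * v i)                               ≡⟨ cong (d *_) (sym (ℚ.0≤p⇒∣p∣≡p (term≥0 i))) ⟩
    d * ∣ p * v i ∣                             ∎
    where
    open ℚ.≤-Reasoning
    d z p : ℚ
    d = fromℕ k₁
    z = + k₁ / k
    p = z ^ suc i
    v : ℕ → ℚ
    v i = + 1 / suc i
    0≤d = fromℕ-nonNeg k₁
    0≤z : 0ℚ ≤ z
    0≤z = ℚ.nonNegative⁻¹ z {{/-nonNeg k₁ k}}
    v≥0 : ∀ i → 0ℚ ≤ v i
    v≥0 i = ℚ.nonNegative⁻¹ (v i) {{/-nonNeg 1 (suc i)}}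
    pow≥0 : ∀ j → 0ℚ ≤ z ^ j
    pow≥0 zero    = 0≤1
    pow≥0 (suc j) = *-nonNeg 0≤z (pow≥0 j)
    term≥0 : ∀ j → 0ℚ ≤ z ^ suc j * v j
    term≥0 j = *-nonNeg (pow≥0 (suc j)) (v≥0 j)
    regroup : ∀ a z p w → a * (z * p * w) ≡ a * z * (p * w)
    regroup = solve 4 (λ a z p w → a :* (z :* p :* w) := a :* z :* (p :* w)) refl
      where open +-*-Solver
    kz≡d : fromℕ k * z ≡ d
    kz≡d = trans (/-* k 1 k₁ k)
      (/-cross (k ℕ.* k₁) (1 ℕ.* k) k₁ 1
        (trans (ℕ.*-identityʳ (k ℕ.* k₁))
          (trans (ℕ.*-comm k k₁) (cong (k₁ ℕ.*_) (sym (ℕ.*-identityˡ k))))))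
    v-decr : ∀ i → v (suc i) ≤ v i
    v-decr i = begin
      v (suc i)                                ≡⟨ sym (ℚ.*-identityʳ (v (suc i))) ⟩
      v (suc i) * 1ℚ                           ≡⟨ cong (v (suc i) *_) (sym (n*1/n (suc i))) ⟩
      v (suc i) * (fromℕ (suc i) * v i)        ≤⟨ *-monoˡ-≤′ (v (suc i)) (v≥0 (suc i))
                                                   (*-monoʳ-≤′ (v i) (v≥0 i) (fromℕ-mono (ℕ.n≤1+n (suc i)))) ⟩
      v (suc i) * (fromℕ (suc (suc i)) * v i)  ≡⟨ comm (v (suc i)) (fromℕ (suc (suc i))) (v i) ⟩
      fromℕ (suc (suc i)) * v (suc i) * v i    ≡⟨ cong (_* v i) (n*1/n (suc (suc i))) ⟩
      1ℚ * v i                                 ≡⟨ ℚ.*-identityˡ (v i) ⟩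
      v i                                      ∎
      where
      comm : ∀ a b c → a * (b * c) ≡ b * a * c
      comm = solve 3 (λ a b c → a :* (b :* c) := b :* a :* c) refl
        where open +-*-Solver

ln : (k : ℕ) .{{_ : NonZero k}} → ℝ
ln k = partialSum (lnTerm k) ,
  Ratio.partialSum-cauchy (lnTerm k) (fromℕ (pred k)) (fromℕ-nonNeg (pred k)) 0 (ln-ratio k)

-- For x ≥ 0 this says that ω is the ceiling of x.  It is a relation because
-- there is no constructive ceiling function on the reals.
infix 4 _≡⌈_⌉

_≡⌈_⌉ : ℕ → ℝ → Set
ω ≡⌈ x ⌉ = x ≤ᵣ fromℚ (fromℕ ω) × (∀ j → x ≤ᵣ fromℚ (fromℕ j) → ω ℕ.≤ j)

-- draw N f draws i ∈ Fin N uniformly, independently of all earlier draws, and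
-- continues with f i.
data Rand (A : Set) : Set where
  return : A → Rand A
  draw   : (N : ℕ) .{{_ : NonZero N}} → (Fin N → Rand A) → Rand A

infixl 1 _>>=_

_>>=_ : {A B : Set} → Rand A → (A → Rand B) → Rand B
return a >>= g = g a
draw N f >>= g = draw N (λ i → f i >>= g)

uniform : {A : Set} {N : ℕ} .{{_ : NonZero N}} → Fin N ↔ A → Rand A
uniform {N = N} e = draw N (return ∘ Inverse.to e)

Pr : {A : Set} → Rand A → (A → Bool) → ℚ
Pr (return a) P = if P a then 1ℚ else 0ℚ
Pr (draw N f) P = (+ 1 / N) * sum (λ i → Pr (f i) P)

-- Pr μ E ≥ p for an event E with no decision procedure: p is a lower bound
-- for the probability of some decidable event contained in E.  Classically E
-- itself can serve as that event.
PrAtLeast : {A : Set} → Rand A → (A → Set) → ℚ → Set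
PrAtLeast {A} μ E p = Σ (A → Bool) λ S → (∀ a → T (S a) → E a) × p ≤ Pr μ S

WithHighProbability : {A : ℕ → Set} →
  (μ : ∀ n .{{_ : NonZero n}} → Rand (A n)) →
  (E : ∀ n .{{_ : NonZero n}} → A n → Set) → Set
WithHighProbability μ E =
  ∀ ε → 0ℚ < ε → ∃ λ N → ∀ n .{{_ : NonZero n}} → N ℕ.≤ n → PrAtLeast (μ n) (E n) (1ℚ - ε)

vec↔ : {A : Set} {N : ℕ} → Fin N ↔ A → ∀ m → Fin (N ℕ.^ m) ↔ Vec A m
vec↔ e zero    = mk↔ₛ′ (λ _ → []) (λ _ → zero) (λ { [] → refl }) (λ { zero → refl })
vec↔ e (suc m) = ↔-trans *↔× (↔-trans (e ×-↔ vec↔ e m)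
  (mk↔ₛ′ (λ { (x , xs) → x ∷ xs }) (λ { (x ∷ xs) → x , xs })
         (λ { (x ∷ xs) → refl }) (λ { (x , xs) → refl })))

-- (true , x) is the literal x and (false , x) is its negation.
Literal : ℕ → Set
Literal n = Bool × Fin n

Clause : (k n : ℕ) → Set
Clause k n = Vec (Literal n) k

Formula : (k n m : ℕ) → Set
Formula k n m = Vec (Clause k n) m

Assignment : ℕ → Set
Assignment n = Vec Bool n

literal↔ : ∀ n → Fin (2 ℕ.* n) ↔ Literal n
literal↔ n = ↔-trans *↔× (2↔Bool ×-↔ ↔-refl)

formula↔ : ∀ k n m → Fin (((2 ℕ.* n) ℕ.^ k) ℕ.^ m) ↔ Formula k n m
formula↔ k n m = vec↔ (vec↔ (literal↔ n) k) m

randomFormula : ∀ k n m .{{_ : NonZero n}} → Rand (Formula k n m)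
randomFormula k n m = uniform {{nz}} (formula↔ k n m)
  where
  .nz : NonZero (((2 ℕ.* n) ℕ.^ k) ℕ.^ m)
  nz = ℕ.m^n≢0 _ m {{ℕ.m^n≢0 _ k {{ℕ.m*n≢0 2 n}}}}

satisfiesLiteral : ∀ {n} → Assignment n → Literal n → Bool
satisfiesLiteral σ (sign , x) = if sign then lookup σ x else not (lookup σ x)

satisfiesClause : ∀ {k n} → Assignment n → Clause k n → Bool
satisfiesClause σ C = any (satisfiesLiteral σ) (toList C)

unsatisfied : ∀ {k n m} → Formula k n m → Assignment n → List (Fin m)
unsatisfied {m = m} Φ σ = filterᵇ (λ i → not (satisfiesClause σ (lookup Φ i))) (allFin m)

flip : ∀ {n} → Assignment n → Literal n → Assignment n
flip σ (_ , x) = updateAt σ x not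

-- The first argument is the number of assignments still to be examined.
walk : ∀ {k n m} .{{_ : NonZero k}} → ℕ → Formula k n m → Assignment n → Rand (Maybe (Assignment n))
walk zero    Φ σ = return nothing
walk {k} (suc r) Φ σ with unsatisfied Φ σ
... | []       = return (just σ)
... | U@(_ ∷ _) = draw (length U) λ i → draw k λ j →
                  walk r Φ (flip σ (lookup (lookup Φ (List.lookup U i)) j))

walksat : ∀ {k n m} .{{_ : NonZero k}} → Formula k n m → ℕ → Rand (Maybe (Assignment n))
walksat {n = n} Φ ω = uniform {{ℕ.m^n≢0 2 n}} (vec↔ 2↔Bool n) >>= walk (suc ω) Φ

successProbability : ∀ {k n m} .{{_ : NonZero k}} → Formula k n m → ℕ → ℚ
successProbability Φ ω = Pr (walksat Φ ω) is-just

n/k² : (n k : ℕ) .{{_ : NonZero k}} → ℚ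
n/k² n k = (+ n / (k ℕ.^ 2)) {{ℕ.m^n≢0 k 2}}

threshold : ℝ → (k : ℕ) .{{_ : NonZero k}} → ℝ
threshold c k = c *ᵣ fromℚ (+ (2 ℕ.^ k) / k) *ᵣ (ln k *ᵣ ln k)

{-# OPTIONS --safe #-}

-- Call an assignment misty if at most B clauses are unsatisfied; a satisfying
-- assignment is misty.  With s of order n / k, three properties hold with high
-- probability:
--
-- (1) no misty assignment lies within distance s of the initial assignment,
--     except with exponentially small probability (first moment);
-- (2) no assignment σ is the centre of a star of R misty assignments at distance
--     at most s from σ such that each of them differs from all the previous ones
--     in at least s / 2 variables (first moment over σ and the star: the factor
--     2ⁿ for σ is beaten because R is of order k);
-- (3) for every non-misty assignment and every set Δ of at most n / V variables,
--     only a tiny fraction of the literals in unsatisfied clauses involves Δ.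
--
-- By (1) the walk must spend s steps outside the mist, say from σ, before it
-- enters it.  Suppose that for some σ this is not exponentially unlikely.  By (3)
-- a walk outside the mist hardly ever flips a variable it has flipped before, or
-- one in which previously found misty assignments differ from σ.  So it can be
-- made to end at misty assignments that are far from all the previously found
-- ones, which builds the star excluded by (2).

module Submission where

open import Defs
import Data.Integer.Base as ℤ
import Data.Integer.Properties as ℤ
open import Data.Nat.Base as ℕ using (ℕ; zero; suc; NonZero; z≤n; s≤s)
import Data.Nat.Properties as ℕ
import Data.Nat.Solver as ℕSolver
import Data.Rational.Base as ℚ
import Data.Rational.Properties as ℚ
import Data.Rational.Unnormalised.Base as ℚᵘ
import Data.Rational.Unnormalised.Properties as ℚᵘ
open import Algebra.Bundles using (CommutativeRing)
open import Data.Bool.Base using (Bool; true; false; not; if_then_else_; T; _∨_)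
open import Data.Bool.ListAction using (any)
open import Data.Fin.Base using (Fin; zero; suc)
open import Data.List.Base as List using (List; []; _∷_; length; map)
open import Data.Product.Base using (∃; _×_; _,_; proj₁; proj₂)
open import Data.Sum.Base using (_⊎_; inj₁; inj₂)
open import Data.Vec.Base using (Vec; []; _∷_; lookup)
open import Function.Base using (_∘_)
open import Function.Bundles using (_↔_; module Inverse)
open import Relation.Binary.PropositionalEquality
open import Relation.Nullary using (¬_; yes; no; contradiction)

-- The obstacle is the choice of σ. When s steps remain before it enters the mist, the walk may
-- stand at any of the 2ⁿ assignments, whereas (1) controls only a typical one. So what is forbidden
-- around σ must have probability below 2⁻ⁿ; near the threshold and for large k, the first moment of
-- a single misty assignment close to σ does not reach this. A star does, because each member
-- differs from all earlier ones on a common set of z = s / 2 variables. A clause falsified by the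
-- new member avoids this set with probability at most 4 / 5, so at least nᵏ / 5 of the (2 n)ᵏ
-- clauses are newly falsified. The gain in the exponent is of order R m / 2ᵏ. It has to exceed R
-- times the price of one member, of order z log k, and also n, which is at most a constant times R
-- z once R is of order k. All first moments are computed in ℕ with the denominators multiplied out:
-- a product of clause weights, summed over all formulas, is a power of a sum over one clause.
-- Distances to σ enter through the weight k ^ (n - dist), whose total is (k + 1)ⁿ, instead of
-- through ball volumes.

-- Sums over enumerated finite sets and over vectors.

module FiniteSums where

  open import Data.Fin.Base using (combine; remQuot; _↑ˡ_; _↑ʳ_)
  open import Data.Fin.Properties using (2↔Bool; remQuot-combine)
  open import Data.Nat.Base
  open import Algebra.Properties.CommutativeMonoid.Sum ℕ.+-0-commutativeMonoid
    using (sum; sum-cong-≗; ∑-distrib-+; ∑-comm)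
  open import Algebra.Properties.Semiring.Sum ℕ.+-*-semiring using (*-distribˡ-sum; *-distribʳ-sum)

  private
    variable
      A B : Set
      m n N N′ : ℕ

  sum-mono : {f g : Fin n → ℕ} → (∀ i → f i ≤ g i) → sum f ≤ sum g
  sum-mono {zero}  f≤g = z≤n
  sum-mono {suc n} f≤g = ℕ.+-mono-≤ (f≤g zero) (sum-mono (f≤g ∘ suc))

  sum-const : ∀ n c → sum {n} (λ _ → c) ≡ n * c
  sum-const zero    c = refl
  sum-const (suc n) c = cong (c +_) (sum-const n c)

  term≤sum : (f : Fin n → ℕ) → ∀ i → f i ≤ sum f
  term≤sum f zero    = ℕ.m≤m+n _ _
  term≤sum f (suc i) = ℕ.≤-trans (term≤sum (f ∘ suc) i) (ℕ.m≤n+m _ (f zero))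

  sum-++ : ∀ m {n} (f : Fin (m + n) → ℕ) → sum f ≡ sum (λ i → f (i ↑ˡ n)) + sum (λ j → f (m ↑ʳ j))
  sum-++ zero    f = refl
  sum-++ (suc m) f = trans (cong (f zero +_) (sum-++ m (f ∘ suc))) (sym (ℕ.+-assoc (f zero) _ _))

  sum-combine : ∀ m {n} (f : Fin (m * n) → ℕ) → sum f ≡ sum (λ i → sum (λ j → f (combine {m} i j)))
  sum-combine zero        f = refl
  sum-combine (suc m) {n} f = trans (sum-++ n f) (cong (sum (λ i → f (i ↑ˡ m * n)) +_) (sum-combine m _))

  sum-remQuot : ∀ m {n} (g : Fin m × Fin n → ℕ) →
                sum (λ i → g (remQuot {m} n i)) ≡ sum (λ i → sum (λ j → g (i , j)))
  sum-remQuot m g = trans (sum-combine m _)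
    (sum-cong-≗ λ i → sum-cong-≗ λ j → cong g (remQuot-combine {m} i j))

  -- The enumerations are those from which `uniform` samples, so dividing by N gives exactly the
  -- means that occur in `Pr`.
  total : Fin N ↔ A → (A → ℕ) → ℕ
  total e f = sum (f ∘ Inverse.to e)

  module _ (e : Fin N ↔ A) where

    total-mono : {f g : A → ℕ} → (∀ a → f a ≤ g a) → total e f ≤ total e g
    total-mono f≤g = sum-mono (f≤g ∘ Inverse.to e)

    total-cong : {f g : A → ℕ} → (∀ a → f a ≡ g a) → total e f ≡ total e g
    total-cong f≡g = sum-cong-≗ (f≡g ∘ Inverse.to e)

    total-+ : (f g : A → ℕ) → total e (λ a → f a + g a) ≡ total e f + total e g
    total-+ f g = ∑-distrib-+ (f ∘ Inverse.to e) (g ∘ Inverse.to e)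

    total-*ˡ : ∀ c (f : A → ℕ) → total e (λ a → c * f a) ≡ c * total e f
    total-*ˡ c f = sym (*-distribˡ-sum c (f ∘ Inverse.to e))

    total-*ʳ : ∀ c (f : A → ℕ) → total e (λ a → f a * c) ≡ total e f * c
    total-*ʳ c f = sym (*-distribʳ-sum c (f ∘ Inverse.to e))

    total-const : ∀ c → total e (λ _ → c) ≡ N * c
    total-const = sum-const N

    term≤total : (f : A → ℕ) → ∀ a → f a ≤ total e f
    term≤total f a = subst (λ b → f b ≤ total e f) (Inverse.strictlyInverseˡ e a)
      (term≤sum (f ∘ Inverse.to e) (Inverse.from e a))

    total-bound : ∀ {f : A → ℕ} {c} → (∀ a → f a ≤ c) → total e f ≤ N * c
    total-bound {c = c} f≤c = ℕ.≤-trans (total-mono f≤c) (ℕ.≤-reflexive (total-const c))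

    total-swap : (e′ : Fin N′ ↔ B) (f : A → B → ℕ) →
                 total e (λ a → total e′ (f a)) ≡ total e′ (λ b → total e (λ a → f a b))
    total-swap e′ f = ∑-comm (λ i j → f (Inverse.to e i) (Inverse.to e′ j))

    total-vec-suc : ∀ m (f : Vec A (suc m) → ℕ) →
      total (vec↔ e (suc m)) f ≡ total e (λ a → total (vec↔ e m) (λ v → f (a ∷ v)))
    total-vec-suc m f = sum-remQuot N (λ (i , j) → f (Inverse.to e i ∷ Inverse.to (vec↔ e m) j))

  prodBy sumBy : (A → ℕ) → Vec A m → ℕ
  prodBy f []       = 1
  prodBy f (a ∷ as) = f a * prodBy f as
  sumBy f []       = 0
  sumBy f (a ∷ as) = f a + sumBy f as

  -- Independence of the coordinates in unnormalised form. It reduces a moment over formulas to one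
  -- clause, and a moment over clauses to one literal.
  total-prodBy : (e : Fin N ↔ A) (f : A → ℕ) → ∀ m → total (vec↔ e m) (prodBy f) ≡ total e f ^ m
  total-prodBy e f zero    = refl
  total-prodBy e f (suc m) = begin
    total (vec↔ e (suc m)) (prodBy f)                       ≡⟨ total-vec-suc e m (prodBy f) ⟩
    total e (λ a → total (vec↔ e m) (λ v → f a * prodBy f v)) ≡⟨ total-cong e (λ a → total-*ˡ (vec↔ e m) (f a) (prodBy f)) ⟩
    total e (λ a → f a * total (vec↔ e m) (prodBy f))       ≡⟨ total-cong e (λ a → cong (f a *_) (total-prodBy e f m)) ⟩
    total e (λ a → f a * total e f ^ m)                     ≡⟨ total-*ʳ e (total e f ^ m) f ⟩
    total e f * total e f ^ m                               ∎
    where open ≡-Reasoning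

  sumBy-const : ∀ c (v : Vec A m) → sumBy (λ _ → c) v ≡ m * c
  sumBy-const c []      = refl
  sumBy-const c (_ ∷ v) = cong (c +_) (sumBy-const c v)

  total-bool : (f : Bool → ℕ) → total 2↔Bool f ≡ f false + f true
  total-bool f = cong (f false +_) (ℕ.+-identityʳ (f true))

  total-literal : (f : Literal n → ℕ) →
                  total (literal↔ n) f ≡ sum (λ x → f (false , x) + f (true , x))
  total-literal {n} f = begin
    total (literal↔ n) f  ≡⟨ sum-remQuot 2 (λ (i , x) → f (Inverse.to 2↔Bool i , x)) ⟩
    sum (λ x → f (false , x)) + (sum (λ x → f (true , x)) + 0)  ≡⟨ cong (sum (λ x → f (false , x)) +_) (ℕ.+-identityʳ _) ⟩
    sum (λ x → f (false , x)) + sum (λ x → f (true , x))  ≡⟨ sym (∑-distrib-+ (λ x → f (false , x)) (λ x → f (true , x))) ⟩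
    sum (λ x → f (false , x) + f (true , x)) ∎
    where open ≡-Reasoning

-- Hamming distance, falsified clauses, and clauses falsified by several assignments.

module Assignments where

  open FiniteSums
  open import Data.Fin.Properties using (2↔Bool)
  open import Data.List.Base using (filterᵇ)
  open import Data.Nat.Base
  open import Data.Nat.Solver using (module +-*-Solver)
  open import Data.Vec.Properties using (lookup∘updateAt; lookup∘updateAt′)
  open import Algebra.Properties.CommutativeMonoid.Sum ℕ.+-0-commutativeMonoid
    using (sum; sum-cong-≗; ∑-distrib-+)

  private
    variable
      A B : Set
      k m n : ℕ

  𝟙 : Bool → ℕ
  𝟙 b = if b then 1 else 0

  𝟙≤1 : ∀ b → 𝟙 b ≤ 1
  𝟙≤1 false = z≤n
  𝟙≤1 true  = s≤s z≤n

  count : (Fin n → Bool) → ℕ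
  count P = sum (𝟙 ∘ P)

  prodBy-mono : {f g : A → ℕ} → (∀ a → f a ≤ g a) → (v : Vec A m) → prodBy f v ≤ prodBy g v
  prodBy-mono f≤g []      = ℕ.≤-refl
  prodBy-mono f≤g (a ∷ v) = ℕ.*-mono-≤ (f≤g a) (prodBy-mono f≤g v)

  prodBy-* : (f g : A → ℕ) (v : Vec A m) → prodBy (λ a → f a * g a) v ≡ prodBy f v * prodBy g v
  prodBy-* f g []      = refl
  prodBy-* f g (a ∷ v) = trans (cong (f a * g a *_) (prodBy-* f g v))
    (solve 4 (λ a b p q → a :* b :* (p :* q) := a :* p :* (b :* q)) refl (f a) (g a) (prodBy f v) (prodBy g v))
    where open +-*-Solver

  prodBy-cong : {f g : A → ℕ} → (∀ a → f a ≡ g a) → (v : Vec A m) → prodBy f v ≡ prodBy g v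
  prodBy-cong f≡g []      = refl
  prodBy-cong f≡g (a ∷ v) = cong₂ _*_ (f≡g a) (prodBy-cong f≡g v)

  same : Bool → Bool → Bool
  same a b = if a then b else not b

  dist : Assignment n → Assignment n → ℕ
  dist σ τ = count (λ x → not (same (lookup σ x) (lookup τ x)))

  dist-refl : (σ : Assignment n) → dist σ σ ≡ 0
  dist-refl []          = refl
  dist-refl (false ∷ σ) = dist-refl σ
  dist-refl (true ∷ σ)  = dist-refl σ

  dist-triangle : (σ τ υ : Assignment n) → dist σ υ ≤ dist σ τ + dist τ υ
  dist-triangle {n} σ τ υ = ℕ.≤-trans
    (sum-mono λ x → pointwise (lookup σ x) (lookup τ x) (lookup υ x))
    (ℕ.≤-reflexive (∑-distrib-+ (d σ τ) (d τ υ)))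
    where
    d : Assignment n → Assignment n → Fin n → ℕ
    d σ τ x = 𝟙 (not (same (lookup σ x) (lookup τ x)))
    pointwise : ∀ a b c → 𝟙 (not (same a c)) ≤ 𝟙 (not (same a b)) + 𝟙 (not (same b c))
    pointwise false false false = z≤n
    pointwise false false true  = s≤s z≤n
    pointwise false true  false = z≤n
    pointwise false true  true  = s≤s z≤n
    pointwise true  false false = s≤s z≤n
    pointwise true  false true  = z≤n
    pointwise true  true  false = s≤s z≤n
    pointwise true  true  true  = z≤n

  dist-sym : (σ τ : Assignment n) → dist σ τ ≡ dist τ σ
  dist-sym σ τ = sum-cong-≗ λ x → pointwise (lookup σ x) (lookup τ x)
    where
    pointwise : ∀ a b → 𝟙 (not (same a b)) ≡ 𝟙 (not (same b a))
    pointwise false false = refl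
    pointwise false true  = refl
    pointwise true  false = refl
    pointwise true  true  = refl

  count-change : (P Q : Fin n → Bool) (x : Fin n) → (∀ y → y ≢ x → P y ≡ Q y) →
                 count P + 𝟙 (Q x) ≡ count Q + 𝟙 (P x)
  count-change P Q zero eq = trans
    (cong (λ s → 𝟙 (P zero) + s + 𝟙 (Q zero)) (sum-cong-≗ λ y → cong 𝟙 (eq (suc y) λ ())))
    (solve 3 (λ a s b → a :+ s :+ b := b :+ s :+ a) refl (𝟙 (P zero)) (count (Q ∘ suc)) (𝟙 (Q zero)))
    where open +-*-Solver
  count-change P Q (suc x) eq = begin
    𝟙 (P zero) + count (P ∘ suc) + 𝟙 (Q (suc x))    ≡⟨ ℕ.+-assoc (𝟙 (P zero)) _ _ ⟩
    𝟙 (P zero) + (count (P ∘ suc) + 𝟙 (Q (suc x)))  ≡⟨ cong₂ _+_ (cong 𝟙 (eq zero λ ()))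
      (count-change (P ∘ suc) (Q ∘ suc) x λ y y≢x → eq (suc y) λ { refl → y≢x refl }) ⟩
    𝟙 (Q zero) + (count (Q ∘ suc) + 𝟙 (P (suc x)))  ≡⟨ sym (ℕ.+-assoc (𝟙 (Q zero)) _ _) ⟩
    𝟙 (Q zero) + count (Q ∘ suc) + 𝟙 (P (suc x))    ∎
    where open ≡-Reasoning

  count-change-≤ : (P Q : Fin n → Bool) (x : Fin n) → (∀ y → y ≢ x → P y ≡ Q y) → count P ≤ suc (count Q)
  count-change-≤ P Q x eq = begin
    count P               ≤⟨ ℕ.m≤m+n _ _ ⟩
    count P + 𝟙 (Q x)     ≡⟨ count-change P Q x eq ⟩
    count Q + 𝟙 (P x)     ≤⟨ ℕ.+-monoʳ-≤ (count Q) (𝟙≤1 (P x)) ⟩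
    count Q + 1           ≡⟨ ℕ.+-comm (count Q) 1 ⟩
    suc (count Q)         ∎
    where open ℕ.≤-Reasoning

  flip-other : (σ : Assignment n) (ℓ : Literal n) → ∀ y → y ≢ proj₂ ℓ → lookup (flip σ ℓ) y ≡ lookup σ y
  flip-other σ (_ , x) y y≢x = lookup∘updateAt′ y x y≢x σ

  flip-self : (σ : Assignment n) (ℓ : Literal n) → lookup (flip σ ℓ) (proj₂ ℓ) ≡ not (lookup σ (proj₂ ℓ))
  flip-self σ (_ , x) = lookup∘updateAt x σ

  dist-flip : (σ τ : Assignment n) (ℓ : Literal n) → dist σ (flip τ ℓ) ≤ suc (dist σ τ)
  dist-flip σ τ ℓ = count-change-≤ _ _ (proj₂ ℓ)
    λ y y≢x → cong (λ b → not (same (lookup σ y) b)) (flip-other τ ℓ y y≢x)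

  -- This is k ^ (n - `dist σ τ`), in a form that factors over the variables and avoids subtraction.
  -- A factor k per difference suits balls of radius of order n / k.
  weight : ℕ → Assignment n → Assignment n → ℕ
  weight k []      []      = 1
  weight k (a ∷ σ) (b ∷ τ) = (if same a b then k else 1) * weight k σ τ

  weight-dist : ∀ k (σ τ : Assignment n) → k ^ dist σ τ * weight k σ τ ≡ k ^ n
  weight-dist k [] [] = refl
  weight-dist {suc n} k (a ∷ σ) (b ∷ τ) = trans (step (same a b)) (cong (k *_) (weight-dist k σ τ))
    where
    open +-*-Solver
    step : ∀ c → k ^ (𝟙 (not c) + dist σ τ) * ((if c then k else 1) * weight k σ τ) ≡ k * (k ^ dist σ τ * weight k σ τ)
    step true  = solve 3 (λ p k w → p :* (k :* w) := k :* (p :* w)) refl (k ^ dist σ τ) k (weight k σ τ)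
    step false = solve 3 (λ p k w → k :* p :* (con 1 :* w) := k :* (p :* w)) refl (k ^ dist σ τ) k (weight k σ τ)

  total-weight : ∀ k (σ : Assignment n) → total (vec↔ 2↔Bool n) (weight k σ) ≡ suc k ^ n
  total-weight k [] = refl
  total-weight {suc n} k (a ∷ σ) = begin
    total (vec↔ 2↔Bool (suc n)) (weight k (a ∷ σ))
      ≡⟨ total-vec-suc 2↔Bool n (weight k (a ∷ σ)) ⟩
    total 2↔Bool (λ b → total (vec↔ 2↔Bool n) (λ τ → (if same a b then k else 1) * weight k σ τ))
      ≡⟨ total-bool (λ b → total (vec↔ 2↔Bool n) (λ τ → (if same a b then k else 1) * weight k σ τ)) ⟩
    total (vec↔ 2↔Bool n) (λ τ → (if same a false then k else 1) * weight k σ τ) +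
    total (vec↔ 2↔Bool n) (λ τ → (if same a true then k else 1) * weight k σ τ)
      ≡⟨ cong₂ _+_ (total-*ˡ (vec↔ 2↔Bool n) (if same a false then k else 1) (weight k σ)) (total-*ˡ (vec↔ 2↔Bool n) (if same a true then k else 1) (weight k σ)) ⟩
    (if same a false then k else 1) * t + (if same a true then k else 1) * t
      ≡⟨ rearrange a ⟩
    suc k * t
      ≡⟨ cong (suc k *_) (total-weight k σ) ⟩
    suc k ^ suc n ∎
    where
    open ≡-Reasoning
    t = total (vec↔ 2↔Bool n) (weight k σ)
    rearrange : ∀ a → (if same a false then k else 1) * t + (if same a true then k else 1) * t ≡ suc k * t
    rearrange false = trans (ℕ.+-comm (k * t) (1 * t)) (cong (_+ k * t) (ℕ.*-identityˡ t))
    rearrange true  = cong (_+ k * t) (ℕ.*-identityˡ t)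

  falsified : Assignment n → Clause k n → Bool
  falsified σ C = not (satisfiesClause σ C)

  𝟙-falsified : (σ : Assignment n) (C : Clause k n) →
                𝟙 (falsified σ C) ≡ prodBy (λ ℓ → 𝟙 (not (satisfiesLiteral σ ℓ))) C
  𝟙-falsified σ [] = refl
  𝟙-falsified σ (ℓ ∷ C) with satisfiesLiteral σ ℓ
  ... | true  = refl
  ... | false = trans (𝟙-falsified σ C) (sym (ℕ.+-identityʳ _))

  -- Under σ exactly one of the two literals on each variable is false.
  total-false-literal : (σ : Assignment n) (g : Fin n → ℕ) →
    total (literal↔ n) (λ ℓ → 𝟙 (not (satisfiesLiteral σ ℓ)) * g (proj₂ ℓ)) ≡ sum g
  total-false-literal σ g = trans (total-literal (λ ℓ → 𝟙 (not (satisfiesLiteral σ ℓ)) * g (proj₂ ℓ)))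
    (sum-cong-≗ λ x → pointwise (lookup σ x) (g x))
    where
    pointwise : ∀ b w → 𝟙 (not (not b)) * w + 𝟙 (not b) * w ≡ w
    pointwise false w = ℕ.+-identityʳ w
    pointwise true  w = trans (ℕ.+-identityʳ _) (ℕ.+-identityʳ w)

  clause↔ : ∀ k n → Fin ((2 * n) ^ k) ↔ Clause k n
  clause↔ k n = vec↔ (literal↔ n) k

  total-false-clause : (σ : Assignment n) (g : Fin n → ℕ) → ∀ k →
    total (clause↔ k n) (prodBy (λ ℓ → 𝟙 (not (satisfiesLiteral σ ℓ)) * g (proj₂ ℓ))) ≡ sum g ^ k
  total-false-clause {n} σ g k = trans (total-prodBy (literal↔ n) _ k) (cong (_^ k) (total-false-literal σ g))

  total-falsified : (σ : Assignment n) → ∀ k → total (clause↔ k n) (λ C → 𝟙 (falsified σ C)) ≡ n ^ k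
  total-falsified {n} σ k = begin
    total (clause↔ k n) (λ C → 𝟙 (falsified σ C))
      ≡⟨ total-cong (clause↔ k n) (𝟙-falsified σ) ⟩
    total (clause↔ k n) (prodBy (λ ℓ → 𝟙 (not (satisfiesLiteral σ ℓ))))
      ≡⟨ total-cong (clause↔ k n) (λ C → prodBy-cong (λ ℓ → sym (ℕ.*-identityʳ _)) C) ⟩
    total (clause↔ k n) (prodBy (λ ℓ → 𝟙 (not (satisfiesLiteral σ ℓ)) * 1))
      ≡⟨ total-false-clause σ (λ _ → 1) k ⟩
    sum {n} (λ _ → 1) ^ k
      ≡⟨ cong (_^ k) (trans (sum-const n 1) (ℕ.*-identityʳ n)) ⟩
    n ^ k ∎
    where open ≡-Reasoning

  covered differing : List (Assignment n) → Assignment n → Fin n → Bool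
  covered   τs σ x = any (λ τ → same (lookup τ x) (lookup σ x)) τs
  differing τs σ x = any (λ τ → not (same (lookup τ x) (lookup σ x))) τs

  falsifiedBySome : List (Assignment n) → Clause k n → Bool
  falsifiedBySome τs C = any (λ τ → falsified τ C) τs

  -- A literal that is false under both assignments sits on a variable where they agree.
  both-falsified : (σ τ : Assignment n) (C : Clause k n) →
    𝟙 (falsified τ C) * 𝟙 (falsified σ C) ≤
    prodBy (λ ℓ → 𝟙 (not (satisfiesLiteral σ ℓ)) * 𝟙 (same (lookup τ (proj₂ ℓ)) (lookup σ (proj₂ ℓ)))) C
  both-falsified σ τ C = begin
    𝟙 (falsified τ C) * 𝟙 (falsified σ C)
      ≡⟨ cong₂ _*_ (𝟙-falsified τ C) (𝟙-falsified σ C) ⟩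
    prodBy (λ ℓ → 𝟙 (not (satisfiesLiteral τ ℓ))) C * prodBy (λ ℓ → 𝟙 (not (satisfiesLiteral σ ℓ))) C
      ≡⟨ sym (prodBy-* _ _ C) ⟩
    prodBy (λ ℓ → 𝟙 (not (satisfiesLiteral τ ℓ)) * 𝟙 (not (satisfiesLiteral σ ℓ))) C
      ≤⟨ prodBy-mono (λ (s , x) → pointwise s (lookup τ x) (lookup σ x)) C ⟩
    prodBy (λ ℓ → 𝟙 (not (satisfiesLiteral σ ℓ)) * 𝟙 (same (lookup τ (proj₂ ℓ)) (lookup σ (proj₂ ℓ)))) C ∎
    where
    open ℕ.≤-Reasoning
    pointwise : ∀ s a b → 𝟙 (not (if s then a else not a)) * 𝟙 (not (if s then b else not b)) ≤
                          𝟙 (not (if s then b else not b)) * 𝟙 (same a b)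
    pointwise false false false = ℕ.≤-refl
    pointwise false false true  = ℕ.≤-refl
    pointwise false true  false = ℕ.≤-refl
    pointwise false true  true  = ℕ.≤-refl
    pointwise true  false false = ℕ.≤-refl
    pointwise true  false true  = ℕ.≤-refl
    pointwise true  true  false = ℕ.≤-refl
    pointwise true  true  true  = ℕ.≤-refl

  private
    𝟙-∨ˡ : ∀ a b → 𝟙 a ≤ 𝟙 (a ∨ b)
    𝟙-∨ˡ false b = z≤n
    𝟙-∨ˡ true  b = ℕ.≤-refl

    𝟙-∨ʳ : ∀ a b → 𝟙 b ≤ 𝟙 (a ∨ b)
    𝟙-∨ʳ false b = ℕ.≤-refl
    𝟙-∨ʳ true  b = 𝟙≤1 b

  -- Which τ falsifies the clause is forgotten: every agreement set with σ lies in the covered set.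
  -- This avoids a sum over the τs.
  some-and-falsified : (τs : List (Assignment n)) (σ : Assignment n) (C : Clause k n) →
    𝟙 (falsifiedBySome τs C) * 𝟙 (falsified σ C) ≤
    prodBy (λ ℓ → 𝟙 (not (satisfiesLiteral σ ℓ)) * 𝟙 (covered τs σ (proj₂ ℓ))) C
  some-and-falsified [] σ C = z≤n
  some-and-falsified (τ ∷ τs) σ C with falsified τ C in eq
  ... | false = ℕ.≤-trans (some-and-falsified τs σ C) (prodBy-mono (λ ℓ →
    ℕ.*-monoʳ-≤ (𝟙 (not (satisfiesLiteral σ ℓ))) (𝟙-∨ʳ _ (covered τs σ (proj₂ ℓ)))) C)
  ... | true  = ℕ.≤-trans
    (subst (λ b → 𝟙 b * 𝟙 (falsified σ C) ≤ prodBy (λ ℓ → 𝟙 (not (satisfiesLiteral σ ℓ)) * 𝟙 (same (lookup τ (proj₂ ℓ)) (lookup σ (proj₂ ℓ)))) C)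
      eq (both-falsified σ τ C))
    (prodBy-mono (λ ℓ → ℕ.*-monoʳ-≤ (𝟙 (not (satisfiesLiteral σ ℓ))) (𝟙-∨ˡ _ (covered τs σ (proj₂ ℓ)))) C)

  -- Inclusion and exclusion: σ adds its own n ^ k falsified clauses, and those shared with the τs
  -- have all k variables in the covered set.
  total-falsifiedBySome : (τs : List (Assignment n)) (σ : Assignment n) → ∀ k →
    total (clause↔ k n) (λ C → 𝟙 (falsifiedBySome τs C)) + n ^ k ≤
    total (clause↔ k n) (λ C → 𝟙 (falsifiedBySome (σ ∷ τs) C)) + count (covered τs σ) ^ k
  total-falsifiedBySome {n} τs σ k = begin
    tot (λ C → 𝟙 (some C)) + n ^ k                               ≡⟨ cong (tot (λ C → 𝟙 (some C)) +_) (sym (total-falsified σ k)) ⟩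
    tot (λ C → 𝟙 (some C)) + tot (λ C → 𝟙 (falsified σ C))       ≡⟨ sym (total-+ (clause↔ k n) (λ C → 𝟙 (some C)) (λ C → 𝟙 (falsified σ C))) ⟩
    tot (λ C → 𝟙 (some C) + 𝟙 (falsified σ C))                   ≤⟨ total-mono (clause↔ k n) (λ C →
        ℕ.≤-trans (inclusion-exclusion (some C) (falsified σ C)) (ℕ.+-monoʳ-≤ (𝟙 (falsified σ C ∨ some C)) (some-and-falsified τs σ C))) ⟩
    tot (λ C → 𝟙 (falsified σ C ∨ some C) + prodBy g C)          ≡⟨ total-+ (clause↔ k n) (λ C → 𝟙 (falsified σ C ∨ some C)) (prodBy g) ⟩
    tot (λ C → 𝟙 (falsified σ C ∨ some C)) + tot (prodBy g)      ≡⟨ cong (tot (λ C → 𝟙 (falsified σ C ∨ some C)) +_)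
        (total-false-clause σ (𝟙 ∘ covered τs σ) k) ⟩
    tot (λ C → 𝟙 (falsified σ C ∨ some C)) + count (covered τs σ) ^ k ∎
    where
    open ℕ.≤-Reasoning
    tot  = total (clause↔ k n)
    some = falsifiedBySome τs
    g    = λ ℓ → 𝟙 (not (satisfiesLiteral σ ℓ)) * 𝟙 (covered τs σ (proj₂ ℓ))
    inclusion-exclusion : ∀ a b → 𝟙 a + 𝟙 b ≤ 𝟙 (b ∨ a) + 𝟙 a * 𝟙 b
    inclusion-exclusion false false = z≤n
    inclusion-exclusion false true  = ℕ.≤-refl
    inclusion-exclusion true  false = ℕ.≤-refl
    inclusion-exclusion true  true  = ℕ.≤-refl

  unsat : Formula k n m → Assignment n → ℕ
  unsat Φ σ = sumBy (λ C → 𝟙 (falsified σ C)) Φ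

  count-filter : (P : A → Bool) (f : Fin m → A) → length (filterᵇ P (List.tabulate f)) ≡ sum (λ i → 𝟙 (P (f i)))
  count-filter {m = zero}  P f = refl
  count-filter {m = suc m} P f with P (f zero)
  ... | true  = cong suc (count-filter P (f ∘ suc))
  ... | false = count-filter P (f ∘ suc)

  sumBy-lookup : (g : A → ℕ) (v : Vec A m) → sum (λ i → g (lookup v i)) ≡ sumBy g v
  sumBy-lookup g []      = refl
  sumBy-lookup g (a ∷ v) = cong (g a +_) (sumBy-lookup g v)

  length-unsatisfied : (Φ : Formula k n m) (σ : Assignment n) → length (unsatisfied Φ σ) ≡ unsat Φ σ
  length-unsatisfied Φ σ = trans (count-filter (λ i → falsified σ (lookup Φ i)) (λ i → i)) (sumBy-lookup (λ C → 𝟙 (falsified σ C)) Φ)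

  sum-filter : (P : A → Bool) (g : A → ℕ) (f : Fin m → A) →
    sum (λ i → g (List.lookup (filterᵇ P (List.tabulate f)) i)) ≡ sum (λ i → 𝟙 (P (f i)) * g (f i))
  sum-filter {m = zero}  P g f = refl
  sum-filter {m = suc m} P g f with P (f zero)
  ... | true  = cong₂ _+_ (sym (ℕ.+-identityʳ _)) (sum-filter P g (f ∘ suc))
  ... | false = sum-filter P g (f ∘ suc)

  sum-unsatisfied : (Φ : Formula k n m) (σ : Assignment n) (g : Clause k n → ℕ) →
    sum (λ i → g (lookup Φ (List.lookup (unsatisfied Φ σ) i))) ≡ sumBy (λ C → 𝟙 (falsified σ C) * g C) Φ
  sum-unsatisfied Φ σ g = trans (sum-filter (λ i → falsified σ (lookup Φ i)) (λ i → g (lookup Φ i)) (λ i → i))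
    (sumBy-lookup (λ C → 𝟙 (falsified σ C) * g C) Φ)

-- First moments of spread lists of assignments with few falsified clauses.

module UnionBound where

  open FiniteSums
  open Assignments
  open import Data.Fin.Properties using (2↔Bool)
  open import Data.Nat.Base
  open import Data.Nat.ListAction using () renaming (sum to sumList)
  open import Data.Nat.Solver using (module +-*-Solver)
  open import Algebra.Properties.CommutativeMonoid.Sum ℕ.+-0-commutativeMonoid using (sum)

  private
    variable
      A B : Set
      k m n N : ℕ

  -- With P = q + a this is (1 - a / P) ^ j ≤ 1 / (1 + j a / P), Bernoulli's inequality in the form
  -- that bounds a decaying power from above.
  bernoulli : ∀ q a j → q ^ j * (q + a + j * a) ≤ (q + a) ^ suc j
  bernoulli q a zero    = ℕ.≤-reflexive (solve 2 (λ q a → con 1 :* (q :+ a :+ con 0) := (q :+ a) :* con 1) refl q a)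
    where open +-*-Solver
  bernoulli q a (suc j) = begin
    q * q ^ j * (q + a + suc j * a)         ≤⟨ ℕ.m≤m+n _ (q ^ j * (suc j * (a * a))) ⟩
    q * q ^ j * (q + a + suc j * a) + q ^ j * (suc j * (a * a))
      ≡⟨ solve 4 (λ q a j p → q :* p :* (q :+ a :+ (con 1 :+ j) :* a) :+ p :* ((con 1 :+ j) :* (a :* a))
                  := (q :+ a) :* (p :* (q :+ a :+ j :* a))) refl q a j (q ^ j) ⟩
    (q + a) * (q ^ j * (q + a + j * a))     ≤⟨ ℕ.*-monoʳ-≤ (q + a) (bernoulli q a j) ⟩
    (q + a) * (q + a) ^ suc j               ∎
    where
    open +-*-Solver
    open ℕ.≤-Reasoning

  power-halves : ∀ q a j .{{_ : NonZero (q + a)}} → q + a ≤ j * a → 2 * q ^ j ≤ (q + a) ^ j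
  power-halves q a j P≤ja = ℕ.*-cancelˡ-≤ P (begin
    P * (2 * q ^ j)          ≡⟨ solve 2 (λ P p → P :* (con 2 :* p) := p :* (P :+ P)) refl P (q ^ j) ⟩
    q ^ j * (P + P)          ≤⟨ ℕ.*-monoʳ-≤ (q ^ j) (ℕ.+-monoʳ-≤ P P≤ja) ⟩
    q ^ j * (P + j * a)      ≤⟨ bernoulli q a j ⟩
    P * P ^ j                ∎)
    where
    open +-*-Solver
    open ℕ.≤-Reasoning
    P = q + a

  ^-distribʳ-* : ∀ a b n → (a * b) ^ n ≡ a ^ n * b ^ n
  ^-distribʳ-* a b zero    = refl
  ^-distribʳ-* a b (suc n) = trans (cong (a * b *_) (^-distribʳ-* a b n))
    (solve 4 (λ a b p q → a :* b :* (p :* q) := a :* p :* (b :* q)) refl a b (a ^ n) (b ^ n))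
    where open +-*-Solver

  -- Q blocks of j factors each yield a factor 1 / 2; the remaining factors are at most 1.
  power-decay : ∀ q a j Q m .{{_ : NonZero (q + a)}} → q + a ≤ j * a → j * Q ≤ m → 2 ^ Q * q ^ m ≤ (q + a) ^ m
  power-decay q a j Q m P≤ja jQ≤m = begin
    2 ^ Q * q ^ m                          ≡⟨ cong (λ e → 2 ^ Q * q ^ e) (sym (ℕ.m+[n∸m]≡n jQ≤m)) ⟩
    2 ^ Q * q ^ (j * Q + r)                ≡⟨ cong (2 ^ Q *_) (ℕ.^-distribˡ-+-* q (j * Q) r) ⟩
    2 ^ Q * (q ^ (j * Q) * q ^ r)          ≡⟨ sym (ℕ.*-assoc (2 ^ Q) _ _) ⟩
    2 ^ Q * q ^ (j * Q) * q ^ r            ≡⟨ cong (λ e → 2 ^ Q * e * q ^ r) (sym (ℕ.^-*-assoc q j Q)) ⟩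
    2 ^ Q * (q ^ j) ^ Q * q ^ r            ≡⟨ cong (_* q ^ r) (sym (^-distribʳ-* 2 (q ^ j) Q)) ⟩
    (2 * q ^ j) ^ Q * q ^ r                ≤⟨ ℕ.*-mono-≤ (ℕ.^-monoˡ-≤ Q (power-halves q a j P≤ja)) (ℕ.^-monoˡ-≤ r (ℕ.m≤m+n q a)) ⟩
    ((q + a) ^ j) ^ Q * (q + a) ^ r        ≡⟨ cong (_* (q + a) ^ r) (ℕ.^-*-assoc (q + a) j Q) ⟩
    (q + a) ^ (j * Q) * (q + a) ^ r        ≡⟨ sym (ℕ.^-distribˡ-+-* (q + a) (j * Q) r) ⟩
    (q + a) ^ (j * Q + r)                  ≡⟨ cong ((q + a) ^_) (ℕ.m+[n∸m]≡n jQ≤m) ⟩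
    (q + a) ^ m                            ∎
    where
    open ℕ.≤-Reasoning
    r = m ∸ j * Q

  markov : (e : Fin N ↔ A) (V : A → ℕ) → ∀ c → total e (λ a → 𝟙 (c ≤ᵇ V a)) * c ≤ total e V
  markov e V c = ℕ.≤-trans (ℕ.≤-reflexive (sym (total-*ʳ e c (λ a → 𝟙 (c ≤ᵇ V a))))) (total-mono e λ a → pointwise (V a))
    where
    pointwise : ∀ v → 𝟙 (c ≤ᵇ v) * c ≤ v
    pointwise v with c ≤ᵇ v in eq
    ... | false = z≤n
    ... | true  = ℕ.≤-trans (ℕ.≤-reflexive (ℕ.+-identityʳ c)) (ℕ.≤ᵇ⇒≤ c v (subst T (sym eq) _))

  ≤⇒≤ᵇ≡true : ∀ {a b} → a ≤ b → (a ≤ᵇ b) ≡ true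
  ≤⇒≤ᵇ≡true {a} {b} a≤b with a ≤ᵇ b | ℕ.≤⇒≤ᵇ a≤b
  ... | true | _ = refl

  assignment↔ : ∀ n → Fin (2 ^ n) ↔ Assignment n
  assignment↔ n = vec↔ 2↔Bool n

  sumBy-+ : (f g : A → ℕ) (v : Vec A m) → sumBy (λ a → f a + g a) v ≡ sumBy f v + sumBy g v
  sumBy-+ f g []      = refl
  sumBy-+ f g (a ∷ v) = trans (cong (f a + g a +_) (sumBy-+ f g v))
    (solve 4 (λ a b p q → a :+ b :+ (p :+ q) := a :+ p :+ (b :+ q)) refl (f a) (g a) (sumBy f v) (sumBy g v))
    where open +-*-Solver

  -- Exponential moment for the number of clauses falsified by one of the τs.
  clauseWeight : List (Assignment n) → Clause k n → ℕ
  clauseWeight τs C = if falsifiedBySome τs C then 1 else 2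

  total-clauseWeight : ∀ k (τs : List (Assignment n)) →
    total (clause↔ k n) (clauseWeight τs) + total (clause↔ k n) (λ C → 𝟙 (falsifiedBySome τs C)) ≡ (2 * n) ^ k * 2
  total-clauseWeight {n} k τs = begin
    total (clause↔ k n) (clauseWeight τs) + total (clause↔ k n) (λ C → 𝟙 (falsifiedBySome τs C))
      ≡⟨ sym (total-+ (clause↔ k n) (clauseWeight τs) (λ C → 𝟙 (falsifiedBySome τs C))) ⟩
    total (clause↔ k n) (λ C → clauseWeight τs C + 𝟙 (falsifiedBySome τs C))
      ≡⟨ total-cong (clause↔ k n) (λ C → pointwise (falsifiedBySome τs C)) ⟩
    total (clause↔ k n) (λ _ → 2)
      ≡⟨ total-const (clause↔ k n) 2 ⟩
    (2 * n) ^ k * 2 ∎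
    where
    open ≡-Reasoning
    pointwise : ∀ b → (if b then 1 else 2) + 𝟙 b ≡ 2
    pointwise false = refl
    pointwise true  = refl

  unsatAll : Formula k n m → List (Assignment n) → ℕ
  unsatAll Φ τs = sumList (map (unsat Φ) τs)

  -- The product is 2 to the number of clauses that no τ falsifies, and at most `unsatAll Φ τs`
  -- clauses are falsified by some τ. So a list of misty assignments forces a large product.
  prodBy-clauseWeight : (τs : List (Assignment n)) (Φ : Formula k n m) →
                        2 ^ m ≤ 2 ^ unsatAll Φ τs * prodBy (clauseWeight τs) Φ
  prodBy-clauseWeight {n} {k} {m} τs Φ = subst (λ u → 2 ^ m ≤ 2 ^ u * prodBy (clauseWeight τs) Φ)
    (sumBy-falsifications τs Φ) (go Φ)
    where
    falsifications : List (Assignment n) → Clause k n → ℕ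
    falsifications τs C = sumList (map (λ τ → 𝟙 (falsified τ C)) τs)

    sumBy-falsifications : (τs : List (Assignment n)) (Φ : Formula k n m) →
                           sumBy (falsifications τs) Φ ≡ unsatAll Φ τs
    sumBy-falsifications [] Φ       = trans (sumBy-const 0 Φ) (ℕ.*-zeroʳ m)
    sumBy-falsifications (τ ∷ τs) Φ = trans (sumBy-+ (λ C → 𝟙 (falsified τ C)) (falsifications τs) Φ)
      (cong (unsat Φ τ +_) (sumBy-falsifications τs Φ))

    clause : (τs : List (Assignment n)) (C : Clause k n) → 2 ≤ 2 ^ falsifications τs C * clauseWeight τs C
    clause [] C = ℕ.≤-refl
    clause (τ ∷ τs) C with falsified τ C
    ... | false = clause τs C
    ... | true  = ℕ.≤-trans (ℕ.*-monoʳ-≤ 2 (ℕ.m^n>0 2 (falsifications τs C))) (ℕ.≤-reflexive (sym (ℕ.*-identityʳ _)))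

    go : ∀ {m} (Φ : Formula k n m) → 2 ^ m ≤ 2 ^ sumBy (falsifications τs) Φ * prodBy (clauseWeight τs) Φ
    go [] = ℕ.≤-refl
    go {m = suc m} (C ∷ Φ) = begin
      2 * 2 ^ m                                  ≤⟨ ℕ.*-mono-≤ (clause τs C) (go Φ) ⟩
      2 ^ c * w * (2 ^ d * v)                    ≡⟨ solve 4 (λ a b c d → a :* b :* (c :* d) := a :* c :* (b :* d)) refl (2 ^ c) w (2 ^ d) v ⟩
      2 ^ c * 2 ^ d * (w * v)                    ≡⟨ cong (_* (w * v)) (sym (ℕ.^-distribˡ-+-* 2 c d)) ⟩
      2 ^ (c + d) * (w * v)                      ∎
      where
      open ℕ.≤-Reasoning
      open +-*-Solver
      c = falsifications τs C
      d = sumBy (falsifications τs) Φ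
      w = clauseWeight τs C
      v = prodBy (clauseWeight τs) Φ

  module Spreading (k n z : ℕ) (escape : ∀ M → M + z ≤ n → 5 * M ^ k ≤ 4 * n ^ k) where

    -- The head differs from all assignments behind it simultaneously on at least z variables, which
    -- is more than being far from each of them. By `escape`, a random clause among those falsified
    -- by the head avoids these variables with probability at most 4 / 5.
    data Spread : List (Assignment n) → Set where
      []  : Spread []
      _∷_ : ∀ {τ τs} → count (covered τs τ) + z ≤ n → Spread τs → Spread (τ ∷ τs)

    -- Each new head contributes at least n ^ k / 5 clauses that no earlier member falsifies. The
    -- summand 4 n ^ k on both sides replaces a subtraction.
    spread-falsified : ∀ {τs} → Spread τs →
      length τs * n ^ k ≤ 5 * total (clause↔ k n) (λ C → 𝟙 (falsifiedBySome τs C))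
    spread-falsified [] = z≤n
    spread-falsified {τ ∷ τs} (fresh ∷ spread) = ℕ.+-cancelʳ-≤ (4 * nᵏ) _ _ (begin
      nᵏ + length τs * nᵏ + 4 * nᵏ            ≡⟨ solve 2 (λ a L → a :+ L :+ con 4 :* a := L :+ con 5 :* a) refl nᵏ (length τs * nᵏ) ⟩
      length τs * nᵏ + 5 * nᵏ                ≤⟨ ℕ.+-monoˡ-≤ (5 * nᵏ) (spread-falsified spread) ⟩
      5 * some τs + 5 * nᵏ                  ≡⟨ sym (ℕ.*-distribˡ-+ 5 (some τs) nᵏ) ⟩
      5 * (some τs + nᵏ)                    ≤⟨ ℕ.*-monoʳ-≤ 5 (total-falsifiedBySome τs τ k) ⟩
      5 * (some (τ ∷ τs) + M ^ k)          ≡⟨ ℕ.*-distribˡ-+ 5 (some (τ ∷ τs)) (M ^ k) ⟩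
      5 * some (τ ∷ τs) + 5 * M ^ k        ≤⟨ ℕ.+-monoʳ-≤ (5 * some (τ ∷ τs)) (escape M fresh) ⟩
      5 * some (τ ∷ τs) + 4 * nᵏ            ∎)
      where
      open ℕ.≤-Reasoning
      open +-*-Solver
      nᵏ = n ^ k
      M = count (covered τs τ)
      some = λ τs → total (clause↔ k n) (λ C → 𝟙 (falsifiedBySome τs C))

    -- For a list of length L, at least a fraction L / (5 · 2 ^ k) of the clauses has weight 1
    -- instead of 2. So the mean weight is at most 2 (1 - L / (10 · 2 ^ k)), and every j clauses
    -- bring a further factor 1 / 2 beyond the 2 per clause.
    total-spread-weight : .{{_ : NonZero n}} → ∀ {τs} → Spread τs → ∀ j Q m → 10 * 2 ^ k ≤ j * length τs → j * Q ≤ m →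
      2 ^ Q * total (formula↔ k n m) (prodBy (clauseWeight τs)) ≤ 2 ^ m * ((2 * n) ^ k) ^ m
    total-spread-weight {τs} spread j Q m 10·2ᵏ≤jR jQ≤m = ℕ.*-cancelˡ-≤ (5 ^ m) {{ℕ.m^n≢0 5 m}} (begin
      5 ^ m * (2 ^ Q * total (formula↔ k n m) (prodBy (clauseWeight τs)))
        ≡⟨ cong (λ t → 5 ^ m * (2 ^ Q * t)) (total-prodBy (clause↔ k n) (clauseWeight τs) m) ⟩
      5 ^ m * (2 ^ Q * S ^ m)      ≡⟨ solve 3 (λ a b c → a :* (b :* c) := b :* (a :* c)) refl (5 ^ m) (2 ^ Q) (S ^ m) ⟩
      2 ^ Q * (5 ^ m * S ^ m)      ≡⟨ cong (2 ^ Q *_) (sym (^-distribʳ-* 5 S m)) ⟩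
      2 ^ Q * (5 * S) ^ m          ≤⟨ ℕ.*-monoʳ-≤ (2 ^ Q) (ℕ.^-monoˡ-≤ m 5S≤q) ⟩
      2 ^ Q * q ^ m                ≤⟨ power-decay q a j Q m {{≢0}} (subst (_≤ j * a) (sym q+a≡P) P≤ja) jQ≤m ⟩
      (q + a) ^ m                  ≡⟨ cong (_^ m) q+a≡P ⟩
      (5 * (2 * N₁)) ^ m           ≡⟨ ^-distribʳ-* 5 (2 * N₁) m ⟩
      5 ^ m * (2 * N₁) ^ m         ≡⟨ cong (5 ^ m *_) (^-distribʳ-* 2 N₁ m) ⟩
      5 ^ m * (2 ^ m * N₁ ^ m)     ∎)
      where
      open ℕ.≤-Reasoning
      open +-*-Solver
      N₁ = (2 * n) ^ k
      S = total (clause↔ k n) (clauseWeight τs)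
      some = total (clause↔ k n) (λ C → 𝟙 (falsifiedBySome τs C))
      a = length τs * n ^ k
      P = 5 * (2 * N₁)
      5S+a≤P : 5 * S + a ≤ P
      5S+a≤P = begin
        5 * S + a          ≤⟨ ℕ.+-monoʳ-≤ (5 * S) (spread-falsified spread) ⟩
        5 * S + 5 * some   ≡⟨ sym (ℕ.*-distribˡ-+ 5 S some) ⟩
        5 * (S + some)     ≡⟨ cong (5 *_) (trans (total-clauseWeight k τs) (ℕ.*-comm N₁ 2)) ⟩
        P                  ∎
      q = P ∸ a
      q+a≡P : q + a ≡ P
      q+a≡P = ℕ.m∸n+n≡m (ℕ.≤-trans (ℕ.m≤n+m a (5 * S)) 5S+a≤P)
      5S≤q : 5 * S ≤ q
      5S≤q = ℕ.m+n≤o⇒m≤o∸n (5 * S) 5S+a≤P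
      ≢0 : NonZero (q + a)
      ≢0 = subst NonZero (sym q+a≡P) (ℕ.m*n≢0 5 (2 * N₁) {{_}} {{ℕ.m*n≢0 2 N₁ {{_}} {{ℕ.m^n≢0 (2 * n) k {{ℕ.m*n≢0 2 n}}}}}})
      P≤ja : P ≤ j * a
      P≤ja = begin
        5 * (2 * (2 * n) ^ k)          ≡⟨ cong (λ p → 5 * (2 * p)) (^-distribʳ-* 2 n k) ⟩
        5 * (2 * (2 ^ k * n ^ k))      ≡⟨ solve 2 (λ a b → con 5 :* (con 2 :* (a :* b)) := con 10 :* a :* b) refl (2 ^ k) (n ^ k) ⟩
        10 * 2 ^ k * n ^ k             ≤⟨ ℕ.*-monoˡ-≤ (n ^ k) 10·2ᵏ≤jR ⟩
        j * length τs * n ^ k          ≡⟨ ℕ.*-assoc j (length τs) (n ^ k) ⟩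
        j * a                          ∎

    -- The weights sum to (k + 1)ⁿ over all τ, and those of the τ within distance s of σ are at least kⁿ / kˢ.
    extensions : ∀ {m} → ℕ → Assignment n → List (Assignment n) → Formula k n m → ℕ
    extensions zero    σ τs Φ = prodBy (clauseWeight τs) Φ
    extensions (suc r) σ τs Φ = total (assignment↔ n)
      (λ τ → 𝟙 (count (covered τs τ) + z ≤ᵇ n) * (weight k σ τ * extensions r σ (τ ∷ τs) Φ))

    extensions-suc : ∀ {m} r σ τs τ (Φ : Formula k n m) → count (covered τs τ) + z ≤ n →
      weight k σ τ * extensions r σ (τ ∷ τs) Φ ≤ extensions (suc r) σ τs Φ
    extensions-suc r σ τs τ Φ fresh = ℕ.≤-trans
      (ℕ.≤-reflexive (sym (trans (cong (λ b → 𝟙 b * (weight k σ τ * extensions r σ (τ ∷ τs) Φ)) (≤⇒≤ᵇ≡true fresh)) (ℕ.*-identityˡ _))))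
      (term≤total (assignment↔ n) (λ τ → 𝟙 (count (covered τs τ) + z ≤ᵇ n) * (weight k σ τ * extensions r σ (τ ∷ τs) Φ)) τ)

    -- After the sums over Φ and τ are exchanged, `weight k σ τ` leaves the inner sum and adds up to
    -- (k + 1) ^ n at each of the r levels. The indicator in `extensions` supplies the next
    -- `Spread`, so a bound for complete lists is enough.
    total-extensions : ∀ m D E R → (∀ {τs} → Spread τs → length τs ≡ R →
        D * total (formula↔ k n m) (prodBy (clauseWeight τs)) ≤ E) →
      ∀ r σ {τs} → Spread τs → r + length τs ≡ R →
      D * total (formula↔ k n m) (extensions r σ τs) ≤ (suc k ^ n) ^ r * E
    total-extensions m D E R bound zero σ spread eq = ℕ.≤-trans (bound spread eq) (ℕ.≤-reflexive (sym (ℕ.*-identityˡ E)))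
    total-extensions m D E R bound (suc r) σ {τs} spread eq = begin
      D * total F (extensions (suc r) σ τs)
        ≡⟨ cong (D *_) (total-swap F (assignment↔ n) (λ Φ τ → 𝟙 (ok τ) * (weight k σ τ * extensions r σ (τ ∷ τs) Φ))) ⟩
      D * total (assignment↔ n) (λ τ → total F (λ Φ → 𝟙 (ok τ) * (weight k σ τ * extensions r σ (τ ∷ τs) Φ)))
        ≡⟨ sym (total-*ˡ (assignment↔ n) D (λ τ → total F (λ Φ → 𝟙 (ok τ) * (weight k σ τ * extensions r σ (τ ∷ τs) Φ)))) ⟩
      total (assignment↔ n) (λ τ → D * total F (λ Φ → 𝟙 (ok τ) * (weight k σ τ * extensions r σ (τ ∷ τs) Φ)))
        ≤⟨ total-mono (assignment↔ n) pointwise ⟩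
      total (assignment↔ n) (λ τ → weight k σ τ * ((suc k ^ n) ^ r * E))
        ≡⟨ total-*ʳ (assignment↔ n) ((suc k ^ n) ^ r * E) (weight k σ) ⟩
      total (assignment↔ n) (weight k σ) * ((suc k ^ n) ^ r * E)
        ≡⟨ cong (_* ((suc k ^ n) ^ r * E)) (total-weight k σ) ⟩
      suc k ^ n * ((suc k ^ n) ^ r * E)
        ≡⟨ sym (ℕ.*-assoc (suc k ^ n) _ E) ⟩
      (suc k ^ n) ^ suc r * E ∎
      where
      open ℕ.≤-Reasoning
      open +-*-Solver
      F = formula↔ k n m
      ok = λ τ → count (covered τs τ) + z ≤ᵇ n
      pointwise : ∀ τ → D * total F (λ Φ → 𝟙 (ok τ) * (weight k σ τ * extensions r σ (τ ∷ τs) Φ)) ≤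
                        weight k σ τ * ((suc k ^ n) ^ r * E)
      pointwise τ with ok τ in eq′
      ... | false = ℕ.≤-trans (ℕ.≤-reflexive (trans (cong (D *_) (trans (total-const F 0) (ℕ.*-zeroʳ (((2 * n) ^ k) ^ m)))) (ℕ.*-zeroʳ D))) z≤n
      ... | true  = begin
        D * total F (λ Φ → weight k σ τ * X Φ + 0)   ≡⟨ cong (D *_) (total-cong F (λ Φ → ℕ.+-identityʳ (weight k σ τ * X Φ))) ⟩
        D * total F (λ Φ → weight k σ τ * X Φ)       ≡⟨ cong (D *_) (total-*ˡ F (weight k σ τ) X) ⟩
        D * (weight k σ τ * total F X)               ≡⟨ solve 3 (λ a b c → a :* (b :* c) := b :* (a :* c)) refl D (weight k σ τ) (total F X) ⟩
        weight k σ τ * (D * total F X)               ≤⟨ ℕ.*-monoʳ-≤ (weight k σ τ) (total-extensions m D E R bound r σ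
                                                          (ℕ.≤ᵇ⇒≤ _ n (subst T (sym eq′) _) ∷ spread) (trans (ℕ.+-suc r _) eq)) ⟩
        weight k σ τ * ((suc k ^ n) ^ r * E)         ∎
        where X = extensions r σ (τ ∷ τs)

-- Concentration of the literals in falsified clauses on small sets of variables.

module VariableCounts where

  open FiniteSums
  open Assignments
  open UnionBound
  open import Data.Nat.Base
  open import Data.Nat.Solver using (module +-*-Solver)
  open import Algebra.Properties.CommutativeMonoid.Sum ℕ.+-0-commutativeMonoid using (sum; ∑-distrib-+)

  private
    variable
      A B : Set
      k m n N : ℕ

  varCount : Vec Bool n → Clause k n → ℕ
  varCount Δ C = sumBy (λ ℓ → 𝟙 (lookup Δ (proj₂ ℓ))) C

  unsatVarCount : Formula k n m → Assignment n → Vec Bool n → ℕ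
  unsatVarCount Φ σ Δ = sumBy (λ C → 𝟙 (falsified σ C) * varCount Δ C) Φ

  module Concentration (k n W : ℕ) where

    variableWeight : Vec Bool n → Fin n → ℕ
    variableWeight Δ x = if lookup Δ x then W else 1

    -- Exponential moment for the number of literals on Δ in falsified clauses.
    tilt : Assignment n → Vec Bool n → Clause k n → ℕ
    tilt σ Δ C = if falsified σ C then prodBy (λ ℓ → variableWeight Δ (proj₂ ℓ)) C else 2 ^ k

    sum-variableWeight : ∀ Δ → count (lookup Δ) * W ≤ n → sum (variableWeight Δ) ≤ 2 * n
    sum-variableWeight Δ small = begin
      sum (variableWeight Δ)                         ≤⟨ sum-mono (λ x → pointwise (lookup Δ x)) ⟩
      sum {n} (λ x → 1 + 𝟙 (lookup Δ x) * W)         ≡⟨ ∑-distrib-+ {n} (λ _ → 1) (λ x → 𝟙 (lookup Δ x) * W) ⟩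
      sum {n} (λ _ → 1) + sum (λ x → 𝟙 (lookup Δ x) * W)
        ≡⟨ cong₂ _+_ (trans (sum-const n 1) (ℕ.*-identityʳ n)) (sym (*-distribʳ-sum W (𝟙 ∘ lookup Δ))) ⟩
      n + count (lookup Δ) * W                       ≤⟨ ℕ.+-monoʳ-≤ n small ⟩
      n + n                                          ≡⟨ cong (n +_) (sym (ℕ.+-identityʳ n)) ⟩
      2 * n                                          ∎
      where
      open ℕ.≤-Reasoning
      open import Algebra.Properties.Semiring.Sum ℕ.+-*-semiring using (*-distribʳ-sum)
      pointwise : ∀ b → (if b then W else 1) ≤ 1 + 𝟙 b * W
      pointwise false = ℕ.≤-refl
      pointwise true  = ℕ.≤-trans (ℕ.m≤m+n W 0) (ℕ.n≤1+n _)

    -- The mean of `variableWeight` is at most 2, so the mean product over the falsified clauses is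
    -- at most 2 ^ k. With the value 2 ^ k on all other clauses the overall mean is at most 2 ^ k
    -- too, and the number of falsified clauses need not be known in advance.
    total-tilt : ∀ σ Δ → count (lookup Δ) * W ≤ n → total (clause↔ k n) (tilt σ Δ) ≤ 2 ^ k * (2 * n) ^ k
    total-tilt σ Δ small = ℕ.+-cancelʳ-≤ (2 ^ k * n ^ k) _ _ (begin
      tot (tilt σ Δ) + 2 ^ k * n ^ k
        ≡⟨ cong (tot (tilt σ Δ) +_) (trans (cong (2 ^ k *_) (sym (total-falsified σ k)))
             (sym (total-*ˡ (clause↔ k n) (2 ^ k) (λ C → 𝟙 (falsified σ C))))) ⟩
      tot (tilt σ Δ) + tot (λ C → 2 ^ k * 𝟙 (falsified σ C))
        ≡⟨ sym (total-+ (clause↔ k n) (tilt σ Δ) (λ C → 2 ^ k * 𝟙 (falsified σ C))) ⟩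
      tot (λ C → tilt σ Δ C + 2 ^ k * 𝟙 (falsified σ C))
        ≡⟨ total-cong (clause↔ k n) clausewise ⟩
      tot (λ C → 2 ^ k + prodBy g C)
        ≡⟨ total-+ (clause↔ k n) (λ _ → 2 ^ k) (prodBy g) ⟩
      tot (λ _ → 2 ^ k) + tot (prodBy g)
        ≡⟨ cong₂ _+_ (trans (total-const (clause↔ k n) (2 ^ k)) (ℕ.*-comm _ (2 ^ k))) (total-false-clause σ (variableWeight Δ) k) ⟩
      2 ^ k * (2 * n) ^ k + sum (variableWeight Δ) ^ k
        ≤⟨ ℕ.+-monoʳ-≤ (2 ^ k * (2 * n) ^ k) (ℕ.^-monoˡ-≤ k (sum-variableWeight Δ small)) ⟩
      2 ^ k * (2 * n) ^ k + (2 * n) ^ k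
        ≡⟨ cong (2 ^ k * (2 * n) ^ k +_) (^-distribʳ-* 2 n k) ⟩
      2 ^ k * (2 * n) ^ k + 2 ^ k * n ^ k ∎)
      where
      open ℕ.≤-Reasoning
      tot = total (clause↔ k n)
      g = λ ℓ → 𝟙 (not (satisfiesLiteral σ ℓ)) * variableWeight Δ (proj₂ ℓ)
      clausewise : ∀ C → tilt σ Δ C + 2 ^ k * 𝟙 (falsified σ C) ≡ 2 ^ k + prodBy g C
      clausewise C = trans (cases (falsified σ C)) (cong (2 ^ k +_) (sym (trans
        (prodBy-* (λ ℓ → 𝟙 (not (satisfiesLiteral σ ℓ))) (λ ℓ → variableWeight Δ (proj₂ ℓ)) C)
        (cong (_* prodBy (λ ℓ → variableWeight Δ (proj₂ ℓ)) C) (sym (𝟙-falsified σ C))))))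
        where
        p = prodBy (λ ℓ → variableWeight Δ (proj₂ ℓ)) C
        cases : ∀ b → (if b then p else 2 ^ k) + 2 ^ k * 𝟙 b ≡ 2 ^ k + 𝟙 b * p
        cases false = cong (2 ^ k +_) (ℕ.*-zeroʳ (2 ^ k))
        cases true  = trans (ℕ.+-comm p _) (cong₂ _+_ (ℕ.*-identityʳ (2 ^ k)) (sym (ℕ.*-identityˡ p)))

    prodBy-variableWeight : ∀ Δ {j} (C : Clause j n) → prodBy (λ ℓ → variableWeight Δ (proj₂ ℓ)) C ≡ W ^ varCount Δ C
    prodBy-variableWeight Δ [] = refl
    prodBy-variableWeight Δ ((_ , x) ∷ C) with lookup Δ x
    ... | false = trans (ℕ.+-identityʳ _) (prodBy-variableWeight Δ C)
    ... | true  = cong (W *_) (prodBy-variableWeight Δ C)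

    -- Solved for the product this is 2 ^ (k (m - U)) W ^ H, where U clauses are falsified and
    -- contain H literals on Δ.
    prodBy-tilt : ∀ {m} σ Δ (Φ : Formula k n m) →
      prodBy (tilt σ Δ) Φ * (2 ^ k) ^ unsat Φ σ ≡ (2 ^ k) ^ m * W ^ unsatVarCount Φ σ Δ
    prodBy-tilt σ Δ [] = refl
    prodBy-tilt {suc m} σ Δ (C ∷ Φ) with falsified σ C
    ... | false = trans (ℕ.*-assoc (2 ^ k) _ _)
      (trans (cong (2 ^ k *_) (prodBy-tilt σ Δ Φ)) (sym (ℕ.*-assoc (2 ^ k) _ _)))
    ... | true  = begin
      p * prodBy (tilt σ Δ) Φ * (2 ^ k * (2 ^ k) ^ unsat Φ σ)
        ≡⟨ solve 4 (λ a b c d → a :* b :* (c :* d) := a :* c :* (b :* d)) refl p (prodBy (tilt σ Δ) Φ) (2 ^ k) _ ⟩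
      p * 2 ^ k * (prodBy (tilt σ Δ) Φ * (2 ^ k) ^ unsat Φ σ)
        ≡⟨ cong₂ (λ a b → a * 2 ^ k * b) (prodBy-variableWeight Δ C) (prodBy-tilt σ Δ Φ) ⟩
      W ^ h * 2 ^ k * ((2 ^ k) ^ m * W ^ H)
        ≡⟨ solve 4 (λ a b c d → a :* b :* (c :* d) := b :* c :* (a :* d)) refl (W ^ h) (2 ^ k) ((2 ^ k) ^ m) (W ^ H) ⟩
      2 ^ k * (2 ^ k) ^ m * (W ^ h * W ^ H)
        ≡⟨ cong (2 ^ k * (2 ^ k) ^ m *_) (sym (ℕ.^-distribˡ-+-* W h H)) ⟩
      2 ^ k * (2 ^ k) ^ m * W ^ (h + H)
        ≡⟨ cong (λ h → 2 ^ k * (2 ^ k) ^ m * W ^ (h + H)) (sym (ℕ.+-identityʳ h)) ⟩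
      2 ^ k * (2 ^ k) ^ m * W ^ (h + 0 + H) ∎
      where
      open ≡-Reasoning
      open +-*-Solver
      p = prodBy (λ ℓ → variableWeight Δ (proj₂ ℓ)) C
      h = varCount Δ C
      H = unsatVarCount Φ σ Δ

    -- One sum over all pairs serves as the union bound. A set Δ is a Boolean vector, so
    -- `assignment↔` enumerates both σ and Δ.
    tilted : ∀ {m} → Formula k n m → ℕ
    tilted Φ = total (assignment↔ n) λ σ → total (assignment↔ n) λ Δ →
      𝟙 (count (lookup Δ) * W ≤ᵇ n) * prodBy (tilt σ Δ) Φ

    total-tilted : ∀ m → total (formula↔ k n m) tilted ≤ 2 ^ n * (2 ^ n * (2 ^ k * (2 * n) ^ k) ^ m)
    total-tilted m = begin
      total F tilted
        ≡⟨ total-swap F (assignment↔ n) (λ Φ σ → total (assignment↔ n) λ Δ → term σ Δ Φ) ⟩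
      total (assignment↔ n) (λ σ → total F λ Φ → total (assignment↔ n) λ Δ → term σ Δ Φ)
        ≤⟨ total-bound (assignment↔ n) (λ σ → begin
          total F (λ Φ → total (assignment↔ n) λ Δ → term σ Δ Φ)
            ≡⟨ total-swap F (assignment↔ n) (λ Φ Δ → term σ Δ Φ) ⟩
          total (assignment↔ n) (λ Δ → total F (term σ Δ))
            ≤⟨ total-bound (assignment↔ n) (pointwise σ) ⟩
          2 ^ n * (2 ^ k * (2 * n) ^ k) ^ m ∎) ⟩
      2 ^ n * (2 ^ n * (2 ^ k * (2 * n) ^ k) ^ m) ∎
      where
      open ℕ.≤-Reasoning
      F = formula↔ k n m
      term = λ σ Δ Φ → 𝟙 (count (lookup Δ) * W ≤ᵇ n) * prodBy (tilt σ Δ) Φ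
      pointwise : ∀ σ Δ → total F (term σ Δ) ≤ (2 ^ k * (2 * n) ^ k) ^ m
      pointwise σ Δ with count (lookup Δ) * W ≤ᵇ n in eq
      ... | false = ℕ.≤-trans (ℕ.≤-reflexive (trans (total-const F 0) (ℕ.*-zeroʳ (((2 * n) ^ k) ^ m)))) z≤n
      ... | true  = begin
        total F (λ Φ → prodBy (tilt σ Δ) Φ + 0)   ≡⟨ total-cong F (λ Φ → ℕ.+-identityʳ (prodBy (tilt σ Δ) Φ)) ⟩
        total F (prodBy (tilt σ Δ))               ≡⟨ total-prodBy (clause↔ k n) (tilt σ Δ) m ⟩
        total (clause↔ k n) (tilt σ Δ) ^ m        ≤⟨ ℕ.^-monoˡ-≤ m (total-tilt σ Δ (ℕ.≤ᵇ⇒≤ _ n (subst T (sym eq) _))) ⟩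
        (2 ^ k * (2 * n) ^ k) ^ m                 ∎

  -- If H K exceeded U k, then 4 ^ (H K) would be at least 2 ^ (k U) · 2 ^ (k U). One factor cancels
  -- the loss of 2 ^ k per falsified clause; the other is at least 2 ^ (k B) as U ≥ B, which reaches
  -- the excluded value. The base 4 of the weight provides both factors.
  few-variables : ∀ {k n m} K B (Φ : Formula k n m) → Concentration.tilted k n (4 ^ K) Φ < (2 ^ k) ^ m * (2 ^ k) ^ B →
    ∀ σ Δ → count (lookup Δ) * 4 ^ K ≤ n → B ≤ unsat Φ σ → unsatVarCount Φ σ Δ * K ≤ unsat Φ σ * k
  few-variables {k} {n} {m} K B Φ untilted σ Δ small B≤U = ℕ.≮⇒≥ λ kU<KH → ℕ.<⇒≱ untilted (begin
    (2 ^ k) ^ m * (2 ^ k) ^ B       ≤⟨ ℕ.*-monoʳ-≤ ((2 ^ k) ^ m) (ℕ.^-monoʳ-≤ (2 ^ k) {{ℕ.m^n≢0 2 k}} B≤U) ⟩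
    (2 ^ k) ^ m * (2 ^ k) ^ U       ≤⟨ ℕ.*-cancelʳ-≤ _ _ ((2 ^ k) ^ U) {{ℕ.m^n≢0 (2 ^ k) U {{ℕ.m^n≢0 2 k}}}} (lower (ℕ.<⇒≤ kU<KH)) ⟩
    prodBy (tilt σ Δ) Φ             ≡⟨ sym (trans (cong (λ b → 𝟙 b * prodBy (tilt σ Δ) Φ) (≤⇒≤ᵇ≡true small)) (ℕ.*-identityˡ _)) ⟩
    term σ Δ                        ≤⟨ term≤total (assignment↔ n) (term σ) Δ ⟩
    total (assignment↔ n) (term σ)  ≤⟨ term≤total (assignment↔ n) (λ σ → total (assignment↔ n) (term σ)) σ ⟩
    tilted Φ                        ∎)
    where
    open Concentration k n (4 ^ K)
    open ℕ.≤-Reasoning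
    U = unsat Φ σ
    H = unsatVarCount Φ σ Δ
    term = λ σ Δ → 𝟙 (count (lookup Δ) * 4 ^ K ≤ᵇ n) * prodBy (tilt σ Δ) Φ
    lower : U * k ≤ H * K → (2 ^ k) ^ m * (2 ^ k) ^ U * (2 ^ k) ^ U ≤ prodBy (tilt σ Δ) Φ * (2 ^ k) ^ U
    lower kU≤KH = begin
      (2 ^ k) ^ m * (2 ^ k) ^ U * (2 ^ k) ^ U     ≡⟨ ℕ.*-assoc ((2 ^ k) ^ m) _ _ ⟩
      (2 ^ k) ^ m * ((2 ^ k) ^ U * (2 ^ k) ^ U)   ≡⟨ cong ((2 ^ k) ^ m *_) (sym (^-distribʳ-* (2 ^ k) (2 ^ k) U)) ⟩
      (2 ^ k) ^ m * (2 ^ k * 2 ^ k) ^ U           ≡⟨ cong (λ p → (2 ^ k) ^ m * p ^ U) (sym (^-distribʳ-* 2 2 k)) ⟩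
      (2 ^ k) ^ m * (4 ^ k) ^ U                   ≡⟨ cong ((2 ^ k) ^ m *_) (trans (ℕ.^-*-assoc 4 k U) (cong (4 ^_) (ℕ.*-comm k U))) ⟩
      (2 ^ k) ^ m * 4 ^ (U * k)                   ≤⟨ ℕ.*-monoʳ-≤ ((2 ^ k) ^ m) (ℕ.^-monoʳ-≤ 4 kU≤KH) ⟩
      (2 ^ k) ^ m * 4 ^ (H * K)                   ≡⟨ cong ((2 ^ k) ^ m *_) (trans (cong (4 ^_) (ℕ.*-comm H K)) (sym (ℕ.^-*-assoc 4 K H))) ⟩
      (2 ^ k) ^ m * (4 ^ K) ^ H                   ≡⟨ sym (prodBy-tilt σ Δ Φ) ⟩
      prodBy (tilt σ Δ) Φ * (2 ^ k) ^ U           ∎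

-- Rational means and probabilities.

module RationalMeans where

  open import Data.Rational.Base using (ℚ; 0ℚ; 1ℚ; _/_; _+_; _*_; _≤_; _<_; toℚᵘ; Positive; NonNegative)
  open import Algebra.Properties.CommutativeMonoid.Sum ℕ.+-0-commutativeMonoid using () renaming (sum to sumℕ)
  open import Algebra.Properties.CommutativeMonoid.Sum ℚ.+-0-commutativeMonoid using (sum; ∑-distrib-+)

  private
    variable
      A B : Set
      k m n N : ℕ

  fromℕ-+ : ∀ a b → fromℕ (a ℕ.+ b) ≡ fromℕ a + fromℕ b
  fromℕ-+ a b = ℚ.toℚᵘ-injective (begin
    toℚᵘ (fromℕ (a ℕ.+ b))                 ≈⟨ ℚ.toℚᵘ-fromℚᵘ (ℚᵘ.mkℚᵘ (ℤ.+ (a ℕ.+ b)) 0) ⟩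
    ℚᵘ.mkℚᵘ (ℤ.+ (a ℕ.+ b)) 0                ≈⟨ ℚᵘ.*≡* (cong (ℤ._* ℤ.+ 1) (cong₂ ℤ._+_ (sym (ℤ.*-identityʳ (ℤ.+ a))) (sym (ℤ.*-identityʳ (ℤ.+ b))))) ⟩
    ℚᵘ.mkℚᵘ (ℤ.+ a) 0 ℚᵘ.+ ℚᵘ.mkℚᵘ (ℤ.+ b) 0   ≈⟨ ℚᵘ.+-cong (ℚᵘ.≃-sym (ℚ.toℚᵘ-fromℚᵘ (ℚᵘ.mkℚᵘ (ℤ.+ a) 0)))
                                                        (ℚᵘ.≃-sym (ℚ.toℚᵘ-fromℚᵘ (ℚᵘ.mkℚᵘ (ℤ.+ b) 0))) ⟩
    toℚᵘ (fromℕ a) ℚᵘ.+ toℚᵘ (fromℕ b)     ≈⟨ ℚᵘ.≃-sym (ℚ.toℚᵘ-homo-+ (fromℕ a) (fromℕ b)) ⟩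
    toℚᵘ (fromℕ a + fromℕ b)               ∎)
    where open ℚᵘ.≃-Reasoning

  fromℕ-* : ∀ a b → fromℕ (a ℕ.* b) ≡ fromℕ a * fromℕ b
  fromℕ-* a b = ℚ.toℚᵘ-injective (begin
    toℚᵘ (fromℕ (a ℕ.* b))                 ≈⟨ ℚ.toℚᵘ-fromℚᵘ (ℚᵘ.mkℚᵘ (ℤ.+ (a ℕ.* b)) 0) ⟩
    ℚᵘ.mkℚᵘ (ℤ.+ (a ℕ.* b)) 0                ≈⟨ ℚᵘ.*≡* (cong (ℤ._* ℤ.+ 1) (ℤ.pos-* a b)) ⟩
    ℚᵘ.mkℚᵘ (ℤ.+ a) 0 ℚᵘ.* ℚᵘ.mkℚᵘ (ℤ.+ b) 0   ≈⟨ ℚᵘ.*-cong (ℚᵘ.≃-sym (ℚ.toℚᵘ-fromℚᵘ (ℚᵘ.mkℚᵘ (ℤ.+ a) 0)))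
                                                        (ℚᵘ.≃-sym (ℚ.toℚᵘ-fromℚᵘ (ℚᵘ.mkℚᵘ (ℤ.+ b) 0))) ⟩
    toℚᵘ (fromℕ a) ℚᵘ.* toℚᵘ (fromℕ b)     ≈⟨ ℚᵘ.≃-sym (ℚ.toℚᵘ-homo-* (fromℕ a) (fromℕ b)) ⟩
    toℚᵘ (fromℕ a * fromℕ b)               ∎)
    where open ℚᵘ.≃-Reasoning

  fromℕ-nonNeg : ∀ n → NonNegative (fromℕ n)
  fromℕ-nonNeg n = ℚ.normalize-nonNeg n 1

  0≤fromℕ : ∀ n → 0ℚ ≤ fromℕ n
  0≤fromℕ n = ℚ.nonNegative⁻¹ (fromℕ n) {{fromℕ-nonNeg n}}

  fromℕ-pos : ∀ n .{{_ : NonZero n}} → Positive (fromℕ n)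
  fromℕ-pos n = ℚ.normalize-pos n 1

  fromℕ-mono : ∀ {a b} → a ℕ.≤ b → fromℕ a ≤ fromℕ b
  fromℕ-mono {a} {b} a≤b = begin
    fromℕ a                          ≡⟨ sym (ℚ.+-identityʳ (fromℕ a)) ⟩
    fromℕ a + 0ℚ                     ≤⟨ ℚ.+-monoʳ-≤ (fromℕ a) (0≤fromℕ (b ℕ.∸ a)) ⟩
    fromℕ a + fromℕ (b ℕ.∸ a)        ≡⟨ sym (fromℕ-+ a (b ℕ.∸ a)) ⟩
    fromℕ (a ℕ.+ (b ℕ.∸ a))          ≡⟨ cong fromℕ (ℕ.m+[n∸m]≡n a≤b) ⟩
    fromℕ b                          ∎
    where open ℚ.≤-Reasoning

  fromℕ-cancel : ∀ {a b} → fromℕ a ≤ fromℕ b → a ℕ.≤ b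
  fromℕ-cancel {a} {b} a≤b = ℕ.≮⇒≥ λ b<a → ℚ.<-irrefl refl (ℚ.<-≤-trans (lt b<a) a≤b)
    where
    lt : b ℕ.< a → fromℕ b < fromℕ a
    lt b<a = ℚ.<-≤-trans
      (subst₂ _<_ (ℚ.+-identityʳ (fromℕ b)) (trans (sym (fromℕ-+ b 1)) (cong fromℕ (ℕ.+-comm b 1)))
        (ℚ.+-monoʳ-< (fromℕ b) (ℚ.positive⁻¹ 1ℚ)))
      (fromℕ-mono b<a)

  1/n*n : ∀ n .{{_ : NonZero n}} → (ℤ.+ 1 / n) * fromℕ n ≡ 1ℚ
  1/n*n n@(suc n₁) = ℚ.toℚᵘ-injective (begin
    toℚᵘ ((ℤ.+ 1 / n) * fromℕ n)               ≈⟨ ℚ.toℚᵘ-homo-* (ℤ.+ 1 / n) (fromℕ n) ⟩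
    toℚᵘ (ℤ.+ 1 / n) ℚᵘ.* toℚᵘ (fromℕ n)       ≈⟨ ℚᵘ.*-cong (ℚ.toℚᵘ-fromℚᵘ (ℚᵘ.mkℚᵘ (ℤ.+ 1) n₁)) (ℚ.toℚᵘ-fromℚᵘ (ℚᵘ.mkℚᵘ (ℤ.+ n) 0)) ⟩
    ℚᵘ.mkℚᵘ (ℤ.+ 1) n₁ ℚᵘ.* ℚᵘ.mkℚᵘ (ℤ.+ n) 0    ≈⟨ ℚᵘ.*≡* (trans (ℤ.*-identityʳ (ℤ.+ 1 ℤ.* ℤ.+ n)) (trans (ℤ.*-identityˡ (ℤ.+ n))
           (sym (trans (ℤ.*-identityˡ (ℤ.+ (n ℕ.* 1))) (cong ℤ.+_ (ℕ.*-identityʳ n)))))) ⟩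
    ℚᵘ.1ℚᵘ                                   ∎)
    where open ℚᵘ.≃-Reasoning

  1/n-nonNeg : ∀ n .{{_ : NonZero n}} → NonNegative (ℤ.+ 1 / n)
  1/n-nonNeg n = ℚ.normalize-nonNeg 1 n

  sum-mono-ℚ : {f g : Fin N → ℚ} → (∀ i → f i ≤ g i) → sum f ≤ sum g
  sum-mono-ℚ {zero}  f≤g = ℚ.≤-refl
  sum-mono-ℚ {suc N} f≤g = ℚ.+-mono-≤ (f≤g zero) (sum-mono-ℚ (f≤g ∘ suc))

  sum-const-ℚ : ∀ N c → sum {N} (λ _ → c) ≡ fromℕ N * c
  sum-const-ℚ zero    c = sym (ℚ.*-zeroˡ c)
  sum-const-ℚ (suc N) c = begin
    c + sum {N} (λ _ → c)      ≡⟨ cong (c +_) (sum-const-ℚ N c) ⟩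
    c + fromℕ N * c            ≡⟨ cong (_+ fromℕ N * c) (sym (ℚ.*-identityˡ c)) ⟩
    1ℚ * c + fromℕ N * c       ≡⟨ sym (ℚ.*-distribʳ-+ c 1ℚ (fromℕ N)) ⟩
    (1ℚ + fromℕ N) * c         ≡⟨ cong (_* c) (sym (fromℕ-+ 1 N)) ⟩
    fromℕ (suc N) * c          ∎
    where open ≡-Reasoning

  sum-fromℕ : (f : Fin N → ℕ) → sum (fromℕ ∘ f) ≡ fromℕ (sumℕ f)
  sum-fromℕ {zero}  f = refl
  sum-fromℕ {suc N} f = trans (cong ((fromℕ (f zero)) +_) (sum-fromℕ (f ∘ suc))) (sym (fromℕ-+ (f zero) _))

  sum-*ʳ-ℚ : (f : Fin N → ℚ) → ∀ c → sum (λ i → f i * c) ≡ sum f * c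
  sum-*ʳ-ℚ {zero}  f c = sym (ℚ.*-zeroˡ c)
  sum-*ʳ-ℚ {suc N} f c = trans (cong ((f zero * c) +_) (sum-*ʳ-ℚ (f ∘ suc) c)) (sym (ℚ.*-distribʳ-+ c (f zero) _))

  -- This is literally what `Pr` of a `draw` unfolds to, so success probabilities are nested means
  -- by computation.
  mean : ∀ N .{{_ : NonZero N}} → (Fin N → ℚ) → ℚ
  mean N f = (ℤ.+ 1 / N) * sum f

  module _ (N : ℕ) .{{_ : NonZero N}} where

    mean-mono : {f g : Fin N → ℚ} → (∀ i → f i ≤ g i) → mean N f ≤ mean N g
    mean-mono f≤g = ℚ.*-monoˡ-≤-nonNeg (ℤ.+ 1 / N) {{1/n-nonNeg N}} (sum-mono-ℚ f≤g)

    mean-const : ∀ c → mean N (λ _ → c) ≡ c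
    mean-const c = begin
      (ℤ.+ 1 / N) * sum {N} (λ _ → c)    ≡⟨ cong ((ℤ.+ 1 / N) *_) (sum-const-ℚ N c) ⟩
      (ℤ.+ 1 / N) * (fromℕ N * c)        ≡⟨ sym (ℚ.*-assoc (ℤ.+ 1 / N) (fromℕ N) c) ⟩
      (ℤ.+ 1 / N) * fromℕ N * c          ≡⟨ cong (_* c) (1/n*n N) ⟩
      1ℚ * c                           ≡⟨ ℚ.*-identityˡ c ⟩
      c                                ∎
      where open ≡-Reasoning

    mean-≤ : ∀ {f c} → (∀ i → f i ≤ c) → mean N f ≤ c
    mean-≤ {f} {c} f≤c = ℚ.≤-trans (mean-mono f≤c) (ℚ.≤-reflexive (mean-const c))

    mean-+ : (f g : Fin N → ℚ) → mean N (λ i → f i + g i) ≡ mean N f + mean N g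
    mean-+ f g = trans (cong ((ℤ.+ 1 / N) *_) (∑-distrib-+ f g)) (ℚ.*-distribˡ-+ (ℤ.+ 1 / N) (sum f) (sum g))

    mean-* : (f : Fin N → ℚ) → ∀ c → mean N f * c ≡ mean N (λ i → f i * c)
    mean-* f c = trans (ℚ.*-assoc (ℤ.+ 1 / N) (sum f) c) (cong ((ℤ.+ 1 / N) *_) (sym (sum-*ʳ-ℚ f c)))

    mean-fromℕ : (f : Fin N → ℕ) → mean N (fromℕ ∘ f) ≡ (ℤ.+ 1 / N) * fromℕ (sumℕ f)
    mean-fromℕ f = cong ((ℤ.+ 1 / N) *_) (sum-fromℕ f)

  1/n*[n*d] : ∀ n d .{{_ : NonZero n}} → (ℤ.+ 1 / n) * fromℕ (n ℕ.* d) ≡ fromℕ d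
  1/n*[n*d] n d = begin
    (ℤ.+ 1 / n) * fromℕ (n ℕ.* d)          ≡⟨ cong ((ℤ.+ 1 / n) *_) (fromℕ-* n d) ⟩
    (ℤ.+ 1 / n) * (fromℕ n * fromℕ d)      ≡⟨ sym (ℚ.*-assoc (ℤ.+ 1 / n) (fromℕ n) (fromℕ d)) ⟩
    (ℤ.+ 1 / n) * fromℕ n * fromℕ d        ≡⟨ cong (_* fromℕ d) (1/n*n n) ⟩
    1ℚ * fromℕ d                         ≡⟨ ℚ.*-identityˡ (fromℕ d) ⟩
    fromℕ d                              ∎
    where open ≡-Reasoning

  Pr≤1 : (μ : Rand A) (P : A → Bool) → Pr μ P ≤ 1ℚ
  Pr≤1 (return a) P with P a
  ... | false = 0≤fromℕ 1
  ... | true  = ℚ.≤-refl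
  Pr≤1 (draw N f) P = mean-≤ N λ i → Pr≤1 (f i) P

-- Elementary inequalities for powers, and the choice of parameters.

module Estimates where

  open UnionBound
  open import Data.Nat.Base
  open import Data.Nat.DivMod using (_/_; m/n*n≤m; m/n<m; m≡m%n+[m/n]*n; m%n<n)
  open import Data.Nat.Solver using (module +-*-Solver)

  open ℕ.≤-Reasoning
  open +-*-Solver

  -- With P = q + a this is (1 - a / P) ^ i ≥ 1 - i a / P, the counterpart of `bernoulli` from
  -- below.
  power-growth : ∀ q a i → (q + a) ^ i * (q + a) ≤ q ^ i * (q + a) + i * a * (q + a) ^ i
  power-growth q a zero    = ℕ.m≤m+n _ _
  power-growth q a (suc i) = begin
    P * P ^ i * P                                  ≡⟨ ℕ.*-assoc P _ P ⟩
    P * (P ^ i * P)                                ≤⟨ ℕ.*-monoʳ-≤ P (power-growth q a i) ⟩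
    P * (q ^ i * P + i * a * P ^ i)
      ≡⟨ solve 5 (λ q a i x y → (q :+ a) :* (x :* (q :+ a) :+ i :* a :* y) :=
                  q :* x :* (q :+ a) :+ (a :* (x :* (q :+ a)) :+ i :* a :* ((q :+ a) :* y))) refl q a i (q ^ i) (P ^ i) ⟩
    q * q ^ i * P + (a * (q ^ i * P) + i * a * (P * P ^ i))
      ≤⟨ ℕ.+-monoʳ-≤ (q * q ^ i * P) (ℕ.+-monoˡ-≤ (i * a * (P * P ^ i)) (ℕ.*-monoʳ-≤ a (ℕ.*-monoˡ-≤ P (ℕ.^-monoˡ-≤ i (ℕ.m≤m+n q a))))) ⟩
    q * q ^ i * P + (a * (P ^ i * P) + i * a * (P * P ^ i))
      ≡⟨ cong (q * q ^ i * P +_) (solve 4 (λ a i P y → a :* (y :* P) :+ i :* a :* (P :* y) := (con 1 :+ i) :* a :* (P :* y)) refl a i P (P ^ i)) ⟩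
    q * q ^ i * P + suc i * a * (P * P ^ i)        ∎
    where P = q + a

  power-doubles : ∀ k i → 2 * i ≤ suc k → suc k ^ i ≤ 2 * k ^ i
  power-doubles k i 2i≤ = ℕ.*-cancelʳ-≤ _ _ P (ℕ.+-cancelʳ-≤ (P ^ i * P) _ _ (begin
    P ^ i * P + P ^ i * P                        ≡⟨ solve 1 (λ x → x :+ x := con 2 :* x) refl (P ^ i * P) ⟩
    2 * (P ^ i * P)                              ≤⟨ ℕ.*-monoʳ-≤ 2 (subst (λ P → P ^ i * P ≤ k ^ i * P + i * 1 * P ^ i) (ℕ.+-comm k 1) (power-growth k 1 i)) ⟩
    2 * (k ^ i * P + i * 1 * P ^ i)              ≡⟨ solve 4 (λ x P i y → con 2 :* (x :* P :+ i :* con 1 :* y) := con 2 :* x :* P :+ y :* (con 2 :* i)) refl (k ^ i) P i (P ^ i) ⟩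
    2 * k ^ i * P + P ^ i * (2 * i)              ≤⟨ ℕ.+-monoʳ-≤ (2 * k ^ i * P) (ℕ.*-monoʳ-≤ (P ^ i) 2i≤) ⟩
    2 * k ^ i * P + P ^ i * P                    ∎))
    where P = suc k

  -- The exponent is split into two halves i, rounded up by d, and (1 + 1 / k) ^ i ≤ 2 for each.
  -- Thus (1 + 1 / k) ^ k ≤ 4 serves as a substitute for the bound e.
  suc-power-≤ : ∀ k i d → 2 * i ≡ k + d → 2 * i ≤ suc k → suc k ^ k ≤ 4 * k ^ k
  suc-power-≤ k i d eq 2i≤ = ℕ.*-cancelʳ-≤ _ _ (P ^ d) {{ℕ.m^n≢0 P d}} (begin
    P ^ k * P ^ d              ≡⟨ sym (ℕ.^-distribˡ-+-* P k d) ⟩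
    P ^ (k + d)                ≡⟨ cong (P ^_) (sym eq) ⟩
    P ^ (2 * i)                ≡⟨ trans (cong (P ^_) (ℕ.*-comm 2 i)) (sym (ℕ.^-*-assoc P i 2)) ⟩
    (P ^ i) ^ 2                ≤⟨ ℕ.^-monoˡ-≤ 2 (power-doubles k i 2i≤) ⟩
    (2 * k ^ i) ^ 2            ≡⟨ solve 1 (λ x → (con 2 :* x) :* (con 2 :* x :* con 1) := con 4 :* (x :* (x :* con 1))) refl (k ^ i) ⟩
    4 * (k ^ i) ^ 2            ≡⟨ cong (4 *_) (trans (ℕ.^-*-assoc k i 2) (cong (k ^_) (trans (ℕ.*-comm i 2) eq))) ⟩
    4 * k ^ (k + d)            ≡⟨ cong (4 *_) (ℕ.^-distribˡ-+-* k k d) ⟩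
    4 * (k ^ k * k ^ d)        ≤⟨ ℕ.*-monoʳ-≤ 4 (ℕ.*-monoʳ-≤ (k ^ k) (ℕ.^-monoˡ-≤ d (ℕ.n≤1+n k))) ⟩
    4 * (k ^ k * P ^ d)        ≡⟨ sym (ℕ.*-assoc 4 (k ^ k) _) ⟩
    4 * k ^ k * P ^ d          ∎)
    where P = suc k

  even-or-odd : ∀ k → ∃ λ i → 2 * i ≡ k + 0 ⊎ 2 * i ≡ k + 1
  even-or-odd zero    = 0 , inj₁ refl
  even-or-odd (suc k) with even-or-odd k
  ... | i , inj₁ eq = suc i , inj₂ (trans (ℕ.*-suc 2 i) (trans (cong (2 +_) eq) (solve 1 (λ k → con 2 :+ (k :+ con 0) := con 1 :+ k :+ con 1) refl k)))
  ... | i , inj₂ eq = i , inj₁ (trans eq (solve 1 (λ k → k :+ con 1 := con 1 :+ k :+ con 0) refl k))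

  [1+k]^k≤4k^k : ∀ k → suc k ^ k ≤ 4 * k ^ k
  [1+k]^k≤4k^k k with even-or-odd k
  ... | i , inj₁ eq = suc-power-≤ k i 0 eq (ℕ.≤-trans (ℕ.≤-reflexive (trans eq (ℕ.+-identityʳ k))) (ℕ.n≤1+n k))
  ... | i , inj₂ eq = suc-power-≤ k i 1 eq (ℕ.≤-reflexive (trans eq (ℕ.+-comm k 1)))

  n<2^n : ∀ n → n < 2 ^ n
  n<2^n zero    = s≤s z≤n
  n<2^n (suc n) = begin-strict
    1 + n              <⟨ ℕ.+-monoʳ-< 1 (n<2^n n) ⟩
    1 + 2 ^ n          ≤⟨ ℕ.+-monoˡ-≤ (2 ^ n) (ℕ.m^n>0 2 n) ⟩
    2 ^ n + 2 ^ n      ≡⟨ cong (2 ^ n +_) (sym (ℕ.+-identityʳ (2 ^ n))) ⟩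
    2 * 2 ^ n          ∎

  -- The binary logarithm rounded down; it takes the place of ln k in all counting arguments.
  dyadic : ∀ k .{{_ : NonZero k}} → ∃ λ e → 2 ^ e ≤ k × k < 2 ^ suc e
  dyadic (suc zero)      = 0 , s≤s z≤n , s≤s (s≤s z≤n)
  dyadic (suc k@(suc _)) with dyadic k
  ... | e , low , high with suc k ℕ.<? 2 ^ suc e
  ...   | yes k+1< = e , ℕ.m≤n⇒m≤1+n low , k+1<
  ...   | no  k+1≮ = suc e , ℕ.≮⇒≥ k+1≮ , (begin-strict
          suc k                  ≤⟨ high ⟩
          2 ^ suc e              <⟨ ℕ.m<m*n (2 ^ suc e) 2 {{ℕ.m^n≢0 2 (suc e)}} (s≤s (s≤s z≤n)) ⟩
          2 ^ suc e * 2          ≡⟨ ℕ.*-comm (2 ^ suc e) 2 ⟩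
          2 ^ suc (suc e)        ∎)

  module Parameters (k n z ℓ V : ℕ) .{{_ : NonZero k}} .{{_ : NonZero n}} .{{_ : NonZero z}} .{{_ : NonZero V}}
      (1<k : 1 < k) (2kz≤n : 2 * k * z ≤ n) (n≤4kz : n ≤ 4 * k * z)
      (1≤ℓ : 1 ≤ ℓ) (k<2^ℓ+1 : k < 2 ^ suc ℓ) where

    z≤n′ : z ≤ n
    z≤n′ = ℕ.≤-trans (ℕ.m≤n*m z (2 * k) {{ℕ.m*n≢0 2 k}}) 2kz≤n

    -- By `bernoulli`, (1 - z / n) ^ k ≤ 1 / (1 + k z / n), and k z ≥ n / 4.
    escape : ∀ M → M + z ≤ n → 5 * M ^ k ≤ 4 * n ^ k
    escape M M+z≤n = ℕ.*-cancelʳ-≤ _ _ n (begin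
      5 * M ^ k * n                ≤⟨ ℕ.*-monoˡ-≤ n (ℕ.*-monoʳ-≤ 5 (ℕ.^-monoˡ-≤ k (ℕ.m+n≤o⇒m≤o∸n M M+z≤n))) ⟩
      5 * q ^ k * n                ≡⟨ solve 2 (λ p n → con 5 :* p :* n := p :* (con 4 :* n :+ n)) refl (q ^ k) n ⟩
      q ^ k * (4 * n + n)          ≤⟨ ℕ.*-monoʳ-≤ (q ^ k) (ℕ.+-monoʳ-≤ (4 * n) n≤4kz) ⟩
      q ^ k * (4 * n + 4 * k * z)  ≡⟨ solve 4 (λ p n k z → p :* (con 4 :* n :+ con 4 :* k :* z) := con 4 :* (p :* (n :+ k :* z))) refl (q ^ k) n k z ⟩
      4 * (q ^ k * (n + k * z))    ≤⟨ ℕ.*-monoʳ-≤ 4 (subst (λ n → q ^ k * (n + k * z) ≤ n ^ suc k) (ℕ.m∸n+n≡m z≤n′) (bernoulli q z k)) ⟩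
      4 * (n * n ^ k)              ≡⟨ solve 2 (λ n p → con 4 :* (n :* p) := con 4 :* p :* n) refl n (n ^ k) ⟩
      4 * n ^ k * n                ∎)
      where q = n ∸ z

    -- The power (1 + 1 / k) ^ n is compared with exponent 4 k z ≥ n, a multiple of k, which gives 4
    -- ^ (4 z). The gap d between the exponents is added to both sides.
    [1+k]^n≤ : suc k ^ n ≤ k ^ n * 2 ^ (8 * z)
    [1+k]^n≤ = ℕ.*-cancelʳ-≤ _ _ (P ^ d) {{ℕ.m^n≢0 P d}} (begin
      P ^ n * P ^ d                        ≡⟨ sym (ℕ.^-distribˡ-+-* P n d) ⟩
      P ^ (n + d)                          ≡⟨ cong (P ^_) n+d ⟩
      P ^ (k * (4 * z))                    ≡⟨ sym (ℕ.^-*-assoc P k (4 * z)) ⟩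
      (P ^ k) ^ (4 * z)                    ≤⟨ ℕ.^-monoˡ-≤ (4 * z) ([1+k]^k≤4k^k k) ⟩
      (4 * k ^ k) ^ (4 * z)                ≡⟨ ^-distribʳ-* 4 (k ^ k) (4 * z) ⟩
      4 ^ (4 * z) * (k ^ k) ^ (4 * z)      ≡⟨ cong₂ _*_ (trans (ℕ.^-*-assoc 2 2 (4 * z)) (cong (2 ^_) (sym (ℕ.*-assoc 2 4 z))))
                                              (trans (ℕ.^-*-assoc k k (4 * z)) (cong (k ^_) (sym n+d))) ⟩
      2 ^ (8 * z) * k ^ (n + d)            ≡⟨ cong (2 ^ (8 * z) *_) (ℕ.^-distribˡ-+-* k n d) ⟩
      2 ^ (8 * z) * (k ^ n * k ^ d)        ≤⟨ ℕ.*-monoʳ-≤ (2 ^ (8 * z)) (ℕ.*-monoʳ-≤ (k ^ n) (ℕ.^-monoˡ-≤ d (ℕ.n≤1+n k))) ⟩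
      2 ^ (8 * z) * (k ^ n * P ^ d)        ≡⟨ solve 3 (λ a b c → a :* (b :* c) := b :* a :* c) refl (2 ^ (8 * z)) (k ^ n) (P ^ d) ⟩
      k ^ n * 2 ^ (8 * z) * P ^ d          ∎)
      where
      P = suc k
      d = 4 * k * z ∸ n
      n+d : n + d ≡ k * (4 * z)
      n+d = trans (ℕ.m+[n∸m]≡n n≤4kz) (solve 2 (λ k z → con 4 :* k :* z := k :* (con 4 :* z)) refl k z)

    g = z * (2 * ℓ + 19)

    -- The price of one member of a star: k ^ (2 z) (1 + 1 / k) ^ n for its position within distance
    -- s = 2 z, and 2 ^ (9 z) for the clauses it may falsify. The exponents per z are 2 (ℓ + 1), 9
    -- and 8, with sum 2 ℓ + 19.
    entropy : k ^ (z + z) * 2 ^ (9 * z) * suc k ^ n ≤ k ^ n * 2 ^ g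
    entropy = begin
      k ^ (z + z) * 2 ^ (9 * z) * suc k ^ n
        ≤⟨ ℕ.*-mono-≤ (ℕ.*-monoˡ-≤ (2 ^ (9 * z)) (ℕ.^-monoˡ-≤ (z + z) (ℕ.<⇒≤ k<2^ℓ+1))) [1+k]^n≤ ⟩
      (2 ^ suc ℓ) ^ (z + z) * 2 ^ (9 * z) * (k ^ n * 2 ^ (8 * z))
        ≡⟨ cong (λ p → p * 2 ^ (9 * z) * (k ^ n * 2 ^ (8 * z))) (ℕ.^-*-assoc 2 (suc ℓ) (z + z)) ⟩
      2 ^ (suc ℓ * (z + z)) * 2 ^ (9 * z) * (k ^ n * 2 ^ (8 * z))
        ≡⟨ solve 4 (λ a b c d → a :* b :* (c :* d) := c :* (a :* (b :* d))) refl (2 ^ (suc ℓ * (z + z))) (2 ^ (9 * z)) (k ^ n) (2 ^ (8 * z)) ⟩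
      k ^ n * (2 ^ (suc ℓ * (z + z)) * (2 ^ (9 * z) * 2 ^ (8 * z)))
        ≡⟨ cong (k ^ n *_) (trans (cong (2 ^ (suc ℓ * (z + z)) *_) (sym (ℕ.^-distribˡ-+-* 2 (9 * z) (8 * z)))) (sym (ℕ.^-distribˡ-+-* 2 (suc ℓ * (z + z)) _))) ⟩
      k ^ n * 2 ^ (suc ℓ * (z + z) + (9 * z + 8 * z))
        ≡⟨ cong (λ e → k ^ n * 2 ^ e) (solve 2 (λ l z → (con 1 :+ l) :* (z :+ z) :+ (con 9 :* z :+ con 8 :* z) := z :* (con 2 :* l :+ con 19)) refl ℓ z) ⟩
      k ^ n * 2 ^ g ∎

    instance
      2V≢0 : NonZero (2 * V)
      2V≢0 = ℕ.m*n≢0 2 V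

    -- A balance: fewer than R members leave the variables on which they may differ from the walk
    -- within n / V (`small`), while k ≤ 2 V R gives n ≤ 8 V R z, so R members can pay for the 2 ^ n
    -- possible centres.
    R R′ : ℕ
    R′ = k / (2 * V)
    R  = suc R′

    small : ∀ L → L < R → L * (z + z + (z + z)) * V ≤ n
    small L (s≤s L≤R′) = begin
      L * (z + z + (z + z)) * V        ≤⟨ ℕ.*-monoˡ-≤ V (ℕ.*-monoˡ-≤ (z + z + (z + z)) L≤R′) ⟩
      R′ * (z + z + (z + z)) * V       ≡⟨ solve 3 (λ r z v → r :* (z :+ z :+ (z :+ z)) :* v := con 2 :* (r :* (con 2 :* v)) :* z) refl R′ z V ⟩
      2 * (R′ * (2 * V)) * z           ≤⟨ ℕ.*-monoˡ-≤ z (ℕ.*-monoʳ-≤ 2 (m/n*n≤m k (2 * V))) ⟩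
      2 * k * z                        ≤⟨ 2kz≤n ⟩
      n                                ∎

    k≤R*2V : k ≤ R * (2 * V)
    k≤R*2V = begin
      k                                       ≡⟨ m≡m%n+[m/n]*n k (2 * V) ⟩
      k Data.Nat.DivMod.% (2 * V) + R′ * (2 * V)    ≤⟨ ℕ.+-monoˡ-≤ (R′ * (2 * V)) (ℕ.<⇒≤ (m%n<n k (2 * V))) ⟩
      R * (2 * V)                             ∎

    R≤2^k : R ≤ 2 ^ k
    R≤2^k = ℕ.≤-trans (m/n<m k (2 * V) (ℕ.≤-trans (s≤s (s≤s z≤n)) (ℕ.m≤m*n 2 V))) (ℕ.<⇒≤ (n<2^n k))

    -- The factor 11 is that of j R ≤ 11 · 2 ^ k. In Q, divided by R z, the centre costs at most 8
    -- V, the surplus z at most 1, and the members 2 ℓ + 19; together this is at most (8 V + 22) ℓ.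
    C = 11 * (8 * V + 22)

    module _ {m : ℕ} (m≥ : C * 2 ^ k * ℓ * z ≤ m) where

      instance
        R≢0 : NonZero R
        R≢0 = _

      -- In j clauses a spread list of length R loses a factor 2. Of the Q halvings, n pay for the
      -- centre and g for each member, and z remain as the exponent of the failure probability.
      j Q : ℕ
      j = suc (10 * 2 ^ k / R)
      Q = z + n + g * R

      10·2ᵏ≤jR : 10 * 2 ^ k ≤ j * R
      10·2ᵏ≤jR = begin
        10 * 2 ^ k                                               ≡⟨ m≡m%n+[m/n]*n (10 * 2 ^ k) R ⟩
        (10 * 2 ^ k) Data.Nat.DivMod.% R + (10 * 2 ^ k / R) * R  ≤⟨ ℕ.+-monoˡ-≤ _ (ℕ.<⇒≤ (m%n<n (10 * 2 ^ k) R)) ⟩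
        j * R                                                    ∎

      jR≤11·2ᵏ : j * R ≤ 11 * 2 ^ k
      jR≤11·2ᵏ = ℕ.+-mono-≤ R≤2^k (m/n*n≤m (10 * 2 ^ k) R)

      Q≤ : Q ≤ R * (z * ((8 * V + 22) * ℓ))
      Q≤ = begin
        z + n + g * R
          ≤⟨ ℕ.+-monoˡ-≤ (g * R) (ℕ.+-mono-≤ (ℕ.m≤n*m z R) (ℕ.≤-trans n≤4kz (ℕ.*-monoˡ-≤ z (ℕ.*-monoʳ-≤ 4 k≤R*2V)))) ⟩
        R * z + 4 * (R * (2 * V)) * z + z * (2 * ℓ + 19) * R
          ≡⟨ solve 4 (λ r z v l → r :* z :+ con 4 :* (r :* (con 2 :* v)) :* z :+ z :* (con 2 :* l :+ con 19) :* r :=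
               r :* (z :* ((con 8 :* v :+ con 20) :* con 1 :+ con 2 :* l))) refl R z V ℓ ⟩
        R * (z * ((8 * V + 20) * 1 + 2 * ℓ))
          ≤⟨ ℕ.*-monoʳ-≤ R (ℕ.*-monoʳ-≤ z (ℕ.+-monoˡ-≤ (2 * ℓ) (ℕ.*-monoʳ-≤ (8 * V + 20) 1≤ℓ))) ⟩
        R * (z * ((8 * V + 20) * ℓ + 2 * ℓ))
          ≡⟨ solve 4 (λ r z v l → r :* (z :* ((con 8 :* v :+ con 20) :* l :+ con 2 :* l)) := r :* (z :* ((con 8 :* v :+ con 22) :* l))) refl R z V ℓ ⟩
        R * (z * ((8 * V + 22) * ℓ)) ∎

      jQ≤m : j * Q ≤ m
      jQ≤m = begin
        j * Q                                        ≤⟨ ℕ.*-monoʳ-≤ j Q≤ ⟩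
        j * (R * (z * ((8 * V + 22) * ℓ)))           ≡⟨ sym (ℕ.*-assoc j R _) ⟩
        j * R * (z * ((8 * V + 22) * ℓ))             ≤⟨ ℕ.*-monoˡ-≤ (z * ((8 * V + 22) * ℓ)) jR≤11·2ᵏ ⟩
        11 * 2 ^ k * (z * ((8 * V + 22) * ℓ))        ≡⟨ solve 4 (λ p z v l → con 11 :* p :* (z :* ((con 8 :* v :+ con 22) :* l)) :=
                                                         con 11 :* (con 8 :* v :+ con 22) :* p :* l :* z) refl (2 ^ k) z V ℓ ⟩
        C * 2 ^ k * ℓ * z                            ≤⟨ m≥ ⟩
        m                                            ∎

      -- The analogue of Q for one misty assignment near a random start, where 2 ^ n centres are
      -- averaged and not paid for. Of the 6 z, 5 z cover the factor 2 · 16 ^ z in Markov's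
      -- inequality and z remain.
      Q₁ = 6 * z + g

      jQ₁≤m : 10 * 2 ^ k * Q₁ ≤ m
      jQ₁≤m = begin
        10 * 2 ^ k * (6 * z + z * (2 * ℓ + 19))
          ≡⟨ solve 3 (λ p z l → con 10 :* p :* (con 6 :* z :+ z :* (con 2 :* l :+ con 19)) := p :* z :* (con 250 :* con 1 :+ con 20 :* l)) refl (2 ^ k) z ℓ ⟩
        2 ^ k * z * (250 * 1 + 20 * ℓ)     ≤⟨ ℕ.*-monoʳ-≤ (2 ^ k * z) (ℕ.+-monoˡ-≤ (20 * ℓ) (ℕ.*-monoʳ-≤ 250 1≤ℓ)) ⟩
        2 ^ k * z * (250 * ℓ + 20 * ℓ)     ≡⟨ solve 3 (λ p z l → p :* z :* (con 250 :* l :+ con 20 :* l) := con 270 :* p :* l :* z) refl (2 ^ k) z ℓ ⟩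
        270 * 2 ^ k * ℓ * z                ≤⟨ ℕ.*-monoˡ-≤ z (ℕ.*-monoˡ-≤ ℓ (ℕ.*-monoˡ-≤ (2 ^ k) 270≤C)) ⟩
        C * 2 ^ k * ℓ * z                  ≤⟨ m≥ ⟩
        m                                  ∎
        where
        270≤C : 270 ≤ 11 * (8 * V + 22)
        270≤C = ℕ.≤-trans (ℕ.m≤m+n 270 60) (ℕ.*-monoʳ-≤ 11 (ℕ.+-monoˡ-≤ 22 (ℕ.*-monoʳ-≤ 8 (>-nonZero⁻¹ V))))

-- Rational bounds for the exponential function from its series.

module Exponential where

  open RationalMeans
  open import Data.Nat.Base using (_!)
  open import Data.Rational.Base
    using (ℚ; 0ℚ; 1ℚ; _/_; _+_; _*_; _-_; -_; ∣_∣; _≤_; toℚᵘ; nonNegative; positive; NonNegative)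
  open import Data.Rational.Solver using (module +-*-Solver)
  open import Algebra.Properties.Semiring.Exp (CommutativeRing.semiring ℚ.+-*-commutativeRing) using (_^_)

  a/b*b : ∀ a b .{{_ : NonZero b}} → (ℤ.+ a / b) * fromℕ b ≡ fromℕ a
  a/b*b a b@(suc b₁) = ℚ.toℚᵘ-injective (begin
    toℚᵘ ((ℤ.+ a / b) * fromℕ b)               ≈⟨ ℚ.toℚᵘ-homo-* (ℤ.+ a / b) (fromℕ b) ⟩
    toℚᵘ (ℤ.+ a / b) ℚᵘ.* toℚᵘ (fromℕ b)       ≈⟨ ℚᵘ.*-cong (ℚ.toℚᵘ-fromℚᵘ (ℚᵘ.mkℚᵘ (ℤ.+ a) b₁)) (ℚ.toℚᵘ-fromℚᵘ (ℚᵘ.mkℚᵘ (ℤ.+ b) 0)) ⟩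
    ℚᵘ.mkℚᵘ (ℤ.+ a) b₁ ℚᵘ.* ℚᵘ.mkℚᵘ (ℤ.+ b) 0  ≈⟨ ℚᵘ.*≡* (trans (ℤ.*-identityʳ (ℤ.+ a ℤ.* ℤ.+ b)) (cong (λ c → ℤ.+ a ℤ.* ℤ.+ c) (sym (ℕ.*-identityʳ b)))) ⟩
    ℚᵘ.mkℚᵘ (ℤ.+ a) 0                          ≈⟨ ℚᵘ.≃-sym (ℚ.toℚᵘ-fromℚᵘ (ℚᵘ.mkℚᵘ (ℤ.+ a) 0)) ⟩
    toℚᵘ (fromℕ a)                             ∎)
    where open ℚᵘ.≃-Reasoning

  cancel-≡ : ∀ n .{{_ : NonZero n}} {p q} → p * fromℕ n ≡ q * fromℕ n → p ≡ q
  cancel-≡ n eq = ℚ.≤-antisym (ℚ.*-cancelʳ-≤-pos (fromℕ n) {{fromℕ-pos n}} (ℚ.≤-reflexive eq))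
                              (ℚ.*-cancelʳ-≤-pos (fromℕ n) {{fromℕ-pos n}} (ℚ.≤-reflexive (sym eq)))

  *-mono-≤-nonNeg : ∀ {p q r s} → 0ℚ ≤ r → 0ℚ ≤ q → p ≤ q → r ≤ s → p * r ≤ q * s
  *-mono-≤-nonNeg {p} {q} {r} {s} 0≤r 0≤q p≤q r≤s = ℚ.≤-trans
    (ℚ.*-monoʳ-≤-nonNeg r {{nonNegative 0≤r}} p≤q) (ℚ.*-monoˡ-≤-nonNeg q {{nonNegative 0≤q}} r≤s)

  *-nonNeg : ∀ {p q} → 0ℚ ≤ p → 0ℚ ≤ q → 0ℚ ≤ p * q
  *-nonNeg {p} {q} 0≤p 0≤q = subst (_≤ p * q) (ℚ.*-zeroˡ q) (ℚ.*-monoʳ-≤-nonNeg q {{nonNegative 0≤q}} 0≤p)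

  ^-nonNeg : ∀ {x} → 0ℚ ≤ x → ∀ i → 0ℚ ≤ x ^ i
  ^-nonNeg 0≤x zero    = 0≤fromℕ 1
  ^-nonNeg 0≤x (suc i) = *-nonNeg 0≤x (^-nonNeg 0≤x i)

  partialSum-mono : ∀ {f g} → (∀ i → f i ≤ g i) → ∀ N → partialSum f N ≤ partialSum g N
  partialSum-mono f≤g zero    = ℚ.≤-refl
  partialSum-mono f≤g (suc N) = ℚ.+-mono-≤ (partialSum-mono f≤g N) (f≤g N)

  partialSum-cong : ∀ {f g} → (∀ i → f i ≡ g i) → ∀ N → partialSum f N ≡ partialSum g N
  partialSum-cong f≡g zero    = refl
  partialSum-cong f≡g (suc N) = cong₂ _+_ (partialSum-cong f≡g N) (f≡g N)

  partialSum-suc : ∀ f N → partialSum f (suc N) ≡ f 0 + partialSum (f ∘ suc) N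
  partialSum-suc f zero    = trans (ℚ.+-identityˡ (f 0)) (sym (ℚ.+-identityʳ (f 0)))
  partialSum-suc f (suc N) = trans (cong (_+ f (suc N)) (partialSum-suc f N)) (ℚ.+-assoc (f 0) _ _)

  partialSum-nonNeg : ∀ {f} → (∀ i → 0ℚ ≤ f i) → ∀ N → 0ℚ ≤ partialSum f N
  partialSum-nonNeg f≥0 zero    = ℚ.≤-refl
  partialSum-nonNeg f≥0 (suc N) = ℚ.≤-trans (ℚ.≤-reflexive (sym (ℚ.+-identityʳ 0ℚ))) (ℚ.+-mono-≤ (partialSum-nonNeg f≥0 N) (f≥0 N))

  partialSum-tail : ∀ {f g} → (∀ i → ∣ f i ∣ ≤ g i) → ∀ N j →
    ∣ partialSum f (j ℕ.+ N) - partialSum f N ∣ ≤ partialSum g (j ℕ.+ N) - partialSum g N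
  partialSum-tail {f} {g} f≤g N zero = ℚ.≤-reflexive
    (trans (cong ∣_∣ (ℚ.+-inverseʳ (partialSum f N))) (sym (ℚ.+-inverseʳ (partialSum g N))))
  partialSum-tail {f} {g} f≤g N (suc j) = begin
    ∣ F + f i - F₀ ∣          ≡⟨ cong ∣_∣ (swap F (f i) F₀) ⟩
    ∣ (F - F₀) + f i ∣        ≤⟨ ℚ.∣p+q∣≤∣p∣+∣q∣ (F - F₀) (f i) ⟩
    ∣ F - F₀ ∣ + ∣ f i ∣      ≤⟨ ℚ.+-mono-≤ (partialSum-tail f≤g N j) (f≤g i) ⟩
    (G - G₀) + g i            ≡⟨ sym (swap G (g i) G₀) ⟩
    G + g i - G₀              ∎
    where
    open ℚ.≤-Reasoning
    i = j ℕ.+ N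
    F = partialSum f i
    F₀ = partialSum f N
    G = partialSum g i
    G₀ = partialSum g N
    swap : ∀ p q r → p + q - r ≡ (p - r) + q
    swap = solve 3 (λ p q r → p :+ q :- r := (p :- r) :+ q) refl
      where open +-*-Solver

  -- Coefficient l of the Cauchy product, with recursion on f in place of the index l - i.
  conv : (ℕ → ℚ) → (ℕ → ℚ) → ℕ → ℚ
  conv f g zero    = f 0 * g 0
  conv f g (suc l) = f 0 * g (suc l) + conv (f ∘ suc) g l

  conv-cong : ∀ {f f′ g g′} → (∀ i → f i ≡ f′ i) → (∀ i → g i ≡ g′ i) → ∀ l → conv f g l ≡ conv f′ g′ l
  conv-cong f≡ g≡ zero    = cong₂ _*_ (f≡ 0) (g≡ 0)
  conv-cong f≡ g≡ (suc l) = cong₂ _+_ (cong₂ _*_ (f≡ 0) (g≡ (suc l))) (conv-cong (f≡ ∘ suc) g≡ l)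

  conv-*ˡ : ∀ c f g l → conv (λ i → c * f i) g l ≡ c * conv f g l
  conv-*ˡ c f g zero    = ℚ.*-assoc c (f 0) (g 0)
  conv-*ˡ c f g (suc l) = trans (cong₂ _+_ (ℚ.*-assoc c (f 0) (g (suc l))) (conv-*ˡ c (f ∘ suc) g l)) (sym (ℚ.*-distribˡ-+ c _ _))

  conv-*ʳ : ∀ c f g l → conv f (λ i → c * g i) l ≡ c * conv f g l
  conv-*ʳ c f g zero    = solve 3 (λ c x y → x :* (c :* y) := c :* (x :* y)) refl c (f 0) (g 0)
    where open +-*-Solver
  conv-*ʳ c f g (suc l) = trans (cong (f 0 * (c * g (suc l)) +_) (conv-*ʳ c (f ∘ suc) g l))
    (solve 4 (λ c x y r → x :* (c :* y) :+ c :* r := c :* (x :* y :+ r)) refl c (f 0) (g (suc l)) (conv (f ∘ suc) g l))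
    where open +-*-Solver

  conv-shiftʳ : ∀ f g → g 0 ≡ 0ℚ → ∀ l → conv f g (suc l) ≡ conv f (g ∘ suc) l
  conv-shiftʳ f g g₀ zero    = trans (cong (λ y → f 0 * g 1 + f 1 * y) g₀)
    (trans (cong (f 0 * g 1 +_) (ℚ.*-zeroʳ (f 1))) (ℚ.+-identityʳ (f 0 * g 1)))
  conv-shiftʳ f g g₀ (suc l) = cong (f 0 * g (suc (suc l)) +_) (conv-shiftʳ (f ∘ suc) g g₀ l)

  -- The Leibniz rule for the operator that multiplies coefficient i by i. The offset c keeps track
  -- of the initial terms that f loses in the induction.
  conv-weight : ∀ f g c l →
    conv (λ i → fromℕ (c ℕ.+ i) * f i) g l + conv f (λ j → fromℕ j * g j) l ≡ fromℕ (c ℕ.+ l) * conv f g l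
  conv-weight f g c zero = trans (cong (fromℕ (c ℕ.+ 0) * f 0 * g 0 +_) (cong (f 0 *_) (ℚ.*-zeroˡ (g 0))))
    (solve 3 (λ w x y → w :* x :* y :+ x :* con 0ℚ := w :* (x :* y)) refl (fromℕ (c ℕ.+ 0)) (f 0) (g 0))
    where open +-*-Solver
  conv-weight f g c (suc l) = begin
    fromℕ (c ℕ.+ 0) * f 0 * y + conv (λ i → fromℕ (c ℕ.+ suc i) * f (suc i)) g l + (f 0 * (fromℕ (suc l) * y) + conv (f ∘ suc) (λ j → fromℕ j * g j) l)
      ≡⟨ cong (λ r → fromℕ (c ℕ.+ 0) * f 0 * y + r + (f 0 * (fromℕ (suc l) * y) + conv (f ∘ suc) (λ j → fromℕ j * g j) l))
           (conv-cong (λ i → cong (λ w → fromℕ w * f (suc i)) (ℕ.+-suc c i)) (λ _ → refl) l) ⟩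
    fromℕ (c ℕ.+ 0) * f 0 * y + r₁ + (f 0 * (fromℕ (suc l) * y) + r₂)
      ≡⟨ solve 6 (λ a x y r₁ b r₂ → a :* x :* y :+ r₁ :+ (x :* (b :* y) :+ r₂) := (a :+ b) :* (x :* y) :+ (r₁ :+ r₂)) refl
           (fromℕ (c ℕ.+ 0)) (f 0) y r₁ (fromℕ (suc l)) r₂ ⟩
    (fromℕ (c ℕ.+ 0) + fromℕ (suc l)) * (f 0 * y) + (r₁ + r₂)
      ≡⟨ cong₂ _+_ (cong (_* (f 0 * y)) (trans (sym (fromℕ-+ (c ℕ.+ 0) (suc l))) (cong (λ c → fromℕ (c ℕ.+ suc l)) (ℕ.+-identityʳ c))))
           (trans (conv-weight (f ∘ suc) g (suc c) l) (cong (λ w → fromℕ w * conv (f ∘ suc) g l) (sym (ℕ.+-suc c l)))) ⟩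
    fromℕ (c ℕ.+ suc l) * (f 0 * y) + fromℕ (c ℕ.+ suc l) * conv (f ∘ suc) g l
      ≡⟨ sym (ℚ.*-distribˡ-+ (fromℕ (c ℕ.+ suc l)) _ _) ⟩
    fromℕ (c ℕ.+ suc l) * (f 0 * y + conv (f ∘ suc) g l) ∎
    where
    open ≡-Reasoning
    open +-*-Solver
    y = g (suc l)
    r₁ = conv (λ i → fromℕ (suc c ℕ.+ i) * f (suc i)) g l
    r₂ = conv (f ∘ suc) (λ j → fromℕ j * g j) l

  expTerm-suc : ∀ x i → fromℕ (suc i) * expTerm x (suc i) ≡ x * expTerm x i
  expTerm-suc x i = begin
    fromℕ (suc i) * (x * x ^ i * u (suc i))
      ≡⟨ solve 4 (λ s x p v → s :* (x :* p :* v) := x :* (p :* (s :* v))) refl (fromℕ (suc i)) x (x ^ i) (u (suc i)) ⟩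
    x * (x ^ i * (fromℕ (suc i) * u (suc i)))
      ≡⟨ cong (λ v → x * (x ^ i * v)) factorial ⟩
    x * (x ^ i * u i) ∎
    where
    open ≡-Reasoning
    open +-*-Solver
    u : ℕ → ℚ
    u i = (ℤ.+ 1 / (i !)) {{i ℕ.!≢0}}
    factorial : fromℕ (suc i) * u (suc i) ≡ u i
    factorial = cancel-≡ (i !) {{i ℕ.!≢0}}
      (trans (solve 3 (λ a b c → a :* b :* c := b :* (a :* c)) refl (fromℕ (suc i)) (u (suc i)) (fromℕ (i !)))
        (trans (cong (u (suc i) *_) (sym (fromℕ-* (suc i) (i !))))
          (trans (1/n*n (suc i !) {{suc i ℕ.!≢0}}) (sym (1/n*n (i !) {{i ℕ.!≢0}})))))

  -- The binomial theorem without binomial coefficients: by the Leibniz rule and `expTerm-suc`, both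
  -- sides satisfy (l + 1) a (l + 1) = (x + y) a l.
  expTerm-+ : ∀ x y l → conv (expTerm x) (expTerm y) l ≡ expTerm (x + y) l
  expTerm-+ x y zero    = refl
  expTerm-+ x y (suc l) = cancel-≡ (suc l) (begin
    conv f g (suc l) * fromℕ (suc l)
      ≡⟨ ℚ.*-comm _ (fromℕ (suc l)) ⟩
    fromℕ (suc l) * conv f g (suc l)
      ≡⟨ sym (conv-weight f g 0 (suc l)) ⟩
    0ℚ * f 0 * g (suc l) + conv (λ i → fromℕ (suc i) * f (suc i)) g l + conv f (λ j → fromℕ j * g j) (suc l)
      ≡⟨ cong₂ _+_ (trans (cong (_+ conv (λ i → fromℕ (suc i) * f (suc i)) g l) (trans (cong (_* g (suc l)) (ℚ.*-zeroˡ (f 0))) (ℚ.*-zeroˡ (g (suc l)))))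
            (trans (ℚ.+-identityˡ _) (trans (conv-cong (expTerm-suc x) (λ _ → refl) l) (conv-*ˡ x f g l))))
          (trans (conv-shiftʳ f (λ j → fromℕ j * g j) (ℚ.*-zeroˡ (g 0)) l)
            (trans (conv-cong (λ _ → refl) (expTerm-suc y) l) (conv-*ʳ y f g l))) ⟩
    x * conv f g l + y * conv f g l
      ≡⟨ sym (ℚ.*-distribʳ-+ (conv f g l) x y) ⟩
    (x + y) * conv f g l
      ≡⟨ cong ((x + y) *_) (expTerm-+ x y l) ⟩
    (x + y) * expTerm (x + y) l
      ≡⟨ sym (expTerm-suc (x + y) l) ⟩
    fromℕ (suc l) * expTerm (x + y) (suc l)
      ≡⟨ ℚ.*-comm (fromℕ (suc l)) _ ⟩
    expTerm (x + y) (suc l) * fromℕ (suc l) ∎)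
    where
    open ≡-Reasoning
    f = expTerm x
    g = expTerm y

  partialSum-conv-suc : ∀ f g N → partialSum (conv f g) (suc N) ≡ f 0 * partialSum g (suc N) + partialSum (conv (f ∘ suc) g) N
  partialSum-conv-suc f g zero    = solve 2 (λ x y → con 0ℚ :+ x :* y := x :* (con 0ℚ :+ y) :+ con 0ℚ) refl (f 0) (g 0)
    where open +-*-Solver
  partialSum-conv-suc f g (suc N) = trans (cong (_+ conv f g (suc N)) (partialSum-conv-suc f g N))
    (solve 5 (λ x s c y r → x :* s :+ c :+ (x :* y :+ r) := x :* (s :+ y) :+ (c :+ r)) refl
      (f 0) (partialSum g (suc N)) (partialSum (conv (f ∘ suc) g) N) (g (suc N)) (conv (f ∘ suc) g N))
    where open +-*-Solver

  -- The difference consists of the products f i · g i′ with i < N, i′ < j + N and i + i′ ≥ N, each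
  -- majorised on the right. Splitting off f 0 shortens only the first range, hence the general j.
  product-error : ∀ {f g F G} → (∀ i → ∣ f i ∣ ≤ F i) → (∀ i → ∣ g i ∣ ≤ G i) → ∀ N j →
    ∣ partialSum f N * partialSum g (j ℕ.+ N) - partialSum (conv f g) N ∣ ≤
    partialSum F N * partialSum G (j ℕ.+ N) - partialSum (conv F G) N
  product-error {f} {g} {F} {G} f≤F g≤G zero j = ℚ.≤-reflexive (trans
    (cong ∣_∣ (solve 1 (λ s → con 0ℚ :* s :- con 0ℚ := con 0ℚ) refl (partialSum g (j ℕ.+ 0))))
    (sym (solve 1 (λ s → con 0ℚ :* s :- con 0ℚ := con 0ℚ) refl (partialSum G (j ℕ.+ 0)))))
    where open +-*-Solver
  product-error {f} {g} {F} {G} f≤F g≤G (suc N) j = begin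
    ∣ partialSum f (suc N) * partialSum g M - partialSum (conv f g) (suc N) ∣
      ≡⟨ cong ∣_∣ (split f g) ⟩
    ∣ f 0 * (partialSum g M - partialSum g (suc N)) + D f g ∣
      ≤⟨ ℚ.∣p+q∣≤∣p∣+∣q∣ (f 0 * (partialSum g M - partialSum g (suc N))) (D f g) ⟩
    ∣ f 0 * (partialSum g M - partialSum g (suc N)) ∣ + ∣ D f g ∣
      ≡⟨ cong (_+ ∣ D f g ∣) (ℚ.∣p*q∣≡∣p∣*∣q∣ (f 0) _) ⟩
    ∣ f 0 ∣ * ∣ partialSum g M - partialSum g (suc N) ∣ + ∣ D f g ∣
      ≤⟨ ℚ.+-mono-≤ (*-mono-≤-nonNeg (ℚ.0≤∣p∣ (partialSum g M - partialSum g (suc N))) (ℚ.≤-trans (ℚ.0≤∣p∣ (f 0)) (f≤F 0)) (f≤F 0) (partialSum-tail g≤G (suc N) j))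
          (subst (λ M → ∣ partialSum (f ∘ suc) N * partialSum g M - partialSum (conv (f ∘ suc) g) N ∣ ≤
                        partialSum (F ∘ suc) N * partialSum G M - partialSum (conv (F ∘ suc) G) N)
            (sym (ℕ.+-suc j N)) (product-error (f≤F ∘ suc) g≤G N (suc j))) ⟩
    F 0 * (partialSum G M - partialSum G (suc N)) + D F G
      ≡⟨ sym (split F G) ⟩
    partialSum F (suc N) * partialSum G M - partialSum (conv F G) (suc N) ∎
    where
    open ℚ.≤-Reasoning
    M = j ℕ.+ suc N
    D : (ℕ → ℚ) → (ℕ → ℚ) → ℚ
    D f g = partialSum (f ∘ suc) N * partialSum g M - partialSum (conv (f ∘ suc) g) N
    split : ∀ f g → partialSum f (suc N) * partialSum g M - partialSum (conv f g) (suc N) ≡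
                    f 0 * (partialSum g M - partialSum g (suc N)) + D f g
    split f g = trans (cong₂ (λ a b → a * partialSum g M - b) (partialSum-suc f N) (partialSum-conv-suc f g N))
      (solve 5 (λ x s m t c → (x :+ s) :* m :- (x :* t :+ c) := x :* (m :- t) :+ (s :* m :- c)) refl
        (f 0) (partialSum (f ∘ suc) N) (partialSum g M) (partialSum g (suc N)) (partialSum (conv (f ∘ suc) g) N))
      where open +-*-Solver

  partialSum-≤ : ∀ {f} → (∀ i → 0ℚ ≤ f i) → ∀ N j → partialSum f N ≤ partialSum f (j ℕ.+ N)
  partialSum-≤ f≥0 N zero    = ℚ.≤-refl
  partialSum-≤ {f} f≥0 N (suc j) = ℚ.≤-trans (partialSum-≤ f≥0 N j)
    (ℚ.≤-trans (ℚ.≤-reflexive (sym (ℚ.+-identityʳ _))) (ℚ.+-monoʳ-≤ (partialSum f (j ℕ.+ N)) (f≥0 (j ℕ.+ N))))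

  conv-nonNeg : ∀ {f g} → (∀ i → 0ℚ ≤ f i) → (∀ i → 0ℚ ≤ g i) → ∀ l → 0ℚ ≤ conv f g l
  conv-nonNeg f≥0 g≥0 zero    = *-nonNeg (f≥0 0) (g≥0 0)
  conv-nonNeg f≥0 g≥0 (suc l) = ℚ.≤-trans (ℚ.≤-reflexive (sym (ℚ.+-identityʳ 0ℚ)))
    (ℚ.+-mono-≤ (*-nonNeg (f≥0 0) (g≥0 (suc l))) (conv-nonNeg (f≥0 ∘ suc) g≥0 l))

  product≤conv : ∀ {f g} → (∀ i → 0ℚ ≤ f i) → (∀ i → 0ℚ ≤ g i) → ∀ N M →
    partialSum f N * partialSum g M ≤ partialSum (conv f g) (N ℕ.+ M)
  product≤conv {f} {g} f≥0 g≥0 zero M = ℚ.≤-trans (ℚ.≤-reflexive (ℚ.*-zeroˡ (partialSum g M))) (partialSum-nonNeg (conv-nonNeg f≥0 g≥0) M)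
  product≤conv {f} {g} f≥0 g≥0 (suc N) M = begin
    partialSum f (suc N) * partialSum g M
      ≡⟨ trans (cong (_* partialSum g M) (partialSum-suc f N)) (ℚ.*-distribʳ-+ (partialSum g M) (f 0) _) ⟩
    f 0 * partialSum g M + partialSum (f ∘ suc) N * partialSum g M
      ≤⟨ ℚ.+-mono-≤ (ℚ.*-monoˡ-≤-nonNeg (f 0) {{nonNegative (f≥0 0)}} (partialSum-≤ g≥0 M (suc N))) (product≤conv (f≥0 ∘ suc) g≥0 N M) ⟩
    f 0 * partialSum g (suc (N ℕ.+ M)) + partialSum (conv (f ∘ suc) g) (N ℕ.+ M)
      ≡⟨ sym (partialSum-conv-suc f g (N ℕ.+ M)) ⟩
    partialSum (conv f g) (suc (N ℕ.+ M)) ∎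
    where open ℚ.≤-Reasoning

  expSum : ℚ → ℕ → ℚ
  expSum x = partialSum (expTerm x)

  private
    1/i!-nonNeg : ∀ i → NonNegative ((ℤ.+ 1 / (i !)) {{i ℕ.!≢0}})
    1/i!-nonNeg i = 1/n-nonNeg (i !) {{i ℕ.!≢0}}

  expTerm-nonNeg : ∀ {x} → 0ℚ ≤ x → ∀ i → 0ℚ ≤ expTerm x i
  expTerm-nonNeg 0≤x i = *-nonNeg (^-nonNeg 0≤x i) (ℚ.nonNegative⁻¹ _ {{1/i!-nonNeg i}})

  ∣^∣ : ∀ x i → ∣ x ^ i ∣ ≡ ∣ x ∣ ^ i
  ∣^∣ x zero    = refl
  ∣^∣ x (suc i) = trans (ℚ.∣p*q∣≡∣p∣*∣q∣ x (x ^ i)) (cong (∣ x ∣ *_) (∣^∣ x i))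

  ∣expTerm∣ : ∀ x i → ∣ expTerm x i ∣ ≡ expTerm ∣ x ∣ i
  ∣expTerm∣ x i = trans (ℚ.∣p*q∣≡∣p∣*∣q∣ (x ^ i) _) (cong₂ _*_ (∣^∣ x i) (ℚ.0≤p⇒∣p∣≡p (ℚ.nonNegative⁻¹ _ {{1/i!-nonNeg i}})))

  expTerm-mono : ∀ {x y} → 0ℚ ≤ x → x ≤ y → ∀ i → expTerm x i ≤ expTerm y i
  expTerm-mono {x} {y} 0≤x x≤y i = ℚ.*-monoʳ-≤-nonNeg _ {{1/i!-nonNeg i}} (pow i)
    where
    pow : ∀ i → x ^ i ≤ y ^ i
    pow zero    = ℚ.≤-refl
    pow (suc i) = *-mono-≤-nonNeg (^-nonNeg 0≤x i) (ℚ.≤-trans 0≤x x≤y) x≤y (pow i)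

  0≤p-q⇒q≤p : ∀ {p q} → 0ℚ ≤ p - q → q ≤ p
  0≤p-q⇒q≤p {p} {q} 0≤ = begin
    q              ≡⟨ sym (ℚ.+-identityˡ q) ⟩
    0ℚ + q         ≤⟨ ℚ.+-monoˡ-≤ q 0≤ ⟩
    (p - q) + q    ≡⟨ solve 2 (λ p q → p :- q :+ q := p) refl p q ⟩
    p              ∎
    where
    open ℚ.≤-Reasoning
    open +-*-Solver

  -- Terms that are not negative majorise themselves, and then `product-error` says that the
  -- difference is at least an absolute value.
  expSum-+-≤ : ∀ {x y} → 0ℚ ≤ x → 0ℚ ≤ y → ∀ N → expSum (x + y) N ≤ expSum x N * expSum y N
  expSum-+-≤ {x} {y} 0≤x 0≤y N = ℚ.≤-trans (ℚ.≤-reflexive (sym (partialSum-cong (expTerm-+ x y) N)))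
    (0≤p-q⇒q≤p (ℚ.≤-trans (ℚ.0≤∣p∣ _) (product-error (abs 0≤x) (abs 0≤y) N 0)))
    where
    abs : ∀ {x} → 0ℚ ≤ x → ∀ i → ∣ expTerm x i ∣ ≤ expTerm x i
    abs 0≤x i = ℚ.≤-reflexive (ℚ.0≤p⇒∣p∣≡p (expTerm-nonNeg 0≤x i))

  expSum-0 : ∀ N → expSum 0ℚ (suc N) ≡ 1ℚ
  expSum-0 zero    = refl
  expSum-0 (suc N) = trans (cong₂ _+_ (expSum-0 N) (trans (cong (_* (ℤ.+ 1 / (suc N !)) {{suc N ℕ.!≢0}}) (ℚ.*-zeroˡ (0ℚ ^ N))) (ℚ.*-zeroˡ ((ℤ.+ 1 / (suc N !)) {{suc N ℕ.!≢0}})))) refl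

  -- The terms of exp (- x) are majorised by those of exp x. The products of total degree above N
  -- are therefore bounded by a section of the series of exp (2 x), which is small because that
  -- series is Cauchy.
  expSum-inverse : ∀ {x} → 0ℚ ≤ x → ∀ N →
    ∣ expSum x (suc N) * expSum (- x) (suc N) - 1ℚ ∣ ≤ expSum (x + x) (suc N ℕ.+ suc N) - expSum (x + x) (suc N)
  expSum-inverse {x} 0≤x N = begin
    ∣ expSum x (suc N) * expSum (- x) (suc N) - 1ℚ ∣
      ≡⟨ cong (λ p → ∣ expSum x (suc N) * expSum (- x) (suc N) - p ∣)
           (sym (trans (partialSum-cong (expTerm-+ x (- x)) (suc N)) (trans (cong (λ y → expSum y (suc N)) (ℚ.+-inverseʳ x)) (expSum-0 N)))) ⟩
    ∣ expSum x (suc N) * expSum (- x) (suc N) - partialSum (conv (expTerm x) (expTerm (- x))) (suc N) ∣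
      ≤⟨ product-error {g = expTerm (- x)} (λ i → ℚ.≤-reflexive (trans (∣expTerm∣ x i) (cong (λ y → expTerm y i) (ℚ.0≤p⇒∣p∣≡p 0≤x))))
           (λ i → ℚ.≤-reflexive (trans (∣expTerm∣ (- x) i) (cong (λ y → expTerm y i) (trans (ℚ.∣-p∣≡∣p∣ x) (ℚ.0≤p⇒∣p∣≡p 0≤x))))) (suc N) 0 ⟩
    expSum x (suc N) * expSum x (suc N) - partialSum (conv (expTerm x) (expTerm x)) (suc N)
      ≤⟨ ℚ.+-mono-≤ (ℚ.≤-trans (product≤conv (expTerm-nonNeg 0≤x) (expTerm-nonNeg 0≤x) (suc N) (suc N))
                      (ℚ.≤-reflexive (partialSum-cong (expTerm-+ x x) (suc N ℕ.+ suc N))))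
                    (ℚ.≤-reflexive (cong -_ (partialSum-cong (expTerm-+ x x) (suc N)))) ⟩
    expSum (x + x) (suc N ℕ.+ suc N) - expSum (x + x) (suc N) ∎
    where open ℚ.≤-Reasoning

  expSum-1≤4 : ∀ N → expSum 1ℚ N ≤ fromℕ 4
  expSum-1≤4 zero    = 0≤fromℕ 4
  expSum-1≤4 (suc N) = ℚ.≤-trans (ℚ.≤-trans (ℚ.≤-reflexive (sym (ℚ.+-identityʳ (expSum 1ℚ (suc N)))))
    (ℚ.+-monoʳ-≤ (expSum 1ℚ (suc N)) (*-nonNeg (0≤fromℕ 2) (expTerm-nonNeg (0≤fromℕ 1) (suc N))))) (ℚ.≤-trans (go N) (fromℕ-mono {3} {4} (ℕ.n≤1+n 3)))
    where
    open ℚ.≤-Reasoning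
    -- Twice the first omitted term is kept in reserve; every later term is at most half its
    -- predecessor.
    go : ∀ N → expSum 1ℚ (suc N) + fromℕ 2 * expTerm 1ℚ (suc N) ≤ fromℕ 3
    go zero    = ℚ.≤-reflexive refl
    go (suc N) = begin
      expSum 1ℚ (suc N) + a + fromℕ 2 * expTerm 1ℚ (suc (suc N))
        ≤⟨ ℚ.+-monoʳ-≤ (expSum 1ℚ (suc N) + a) (ℚ.*-monoʳ-≤-nonNeg (expTerm 1ℚ (suc (suc N))) {{nonNegative (expTerm-nonNeg (0≤fromℕ 1) (suc (suc N)))}} (fromℕ-mono {2} {suc (suc N)} (s≤s (s≤s z≤n)))) ⟩
      expSum 1ℚ (suc N) + a + fromℕ (suc (suc N)) * expTerm 1ℚ (suc (suc N))
        ≡⟨ cong (expSum 1ℚ (suc N) + a +_) (trans (expTerm-suc 1ℚ (suc N)) (ℚ.*-identityˡ a)) ⟩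
      expSum 1ℚ (suc N) + a + a
        ≡⟨ solve 2 (λ s a → s :+ a :+ a := s :+ con (fromℕ 2) :* a) refl (expSum 1ℚ (suc N)) a ⟩
      expSum 1ℚ (suc N) + fromℕ 2 * a
        ≤⟨ go N ⟩
      fromℕ 3 ∎
      where
      open +-*-Solver
      a = expTerm 1ℚ (suc N)

  expSum-fromℕ : ∀ w N → expSum (fromℕ w) N ≤ fromℕ (4 ℕ.^ w)
  expSum-fromℕ zero    zero    = 0≤fromℕ 1
  expSum-fromℕ zero    (suc N) = ℚ.≤-reflexive (expSum-0 N)
  expSum-fromℕ (suc w) N = begin
    expSum (fromℕ (suc w)) N               ≡⟨ cong (λ x → expSum x N) (fromℕ-+ 1 w) ⟩
    expSum (1ℚ + fromℕ w) N                ≤⟨ expSum-+-≤ (0≤fromℕ 1) (0≤fromℕ w) N ⟩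
    expSum 1ℚ N * expSum (fromℕ w) N       ≤⟨ *-mono-≤-nonNeg (partialSum-nonNeg (expTerm-nonNeg (0≤fromℕ w)) N) (0≤fromℕ 4) (expSum-1≤4 N) (expSum-fromℕ w N) ⟩
    fromℕ 4 * fromℕ (4 ℕ.^ w)              ≡⟨ sym (fromℕ-* 4 (4 ℕ.^ w)) ⟩
    fromℕ (4 ℕ.^ suc w)                    ∎
    where open ℚ.≤-Reasoning

  expSum-≤ : ∀ {x} w → 0ℚ ≤ x → x ≤ fromℕ w → ∀ N → expSum x N ≤ fromℕ (4 ℕ.^ w)
  expSum-≤ w 0≤x x≤w N = ℚ.≤-trans (partialSum-mono (expTerm-mono 0≤x x≤w) N) (expSum-fromℕ w N)

  1≤expSum : ∀ {x} → 0ℚ ≤ x → ∀ N → 1ℚ ≤ expSum x (suc N)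
  1≤expSum {x} 0≤x N = subst (λ M → 1ℚ ≤ expSum x M) (ℕ.+-comm N 1) (partialSum-≤ (expTerm-nonNeg 0≤x) 1 N)

  exp-≤ : ∀ {x} w → 0ℚ ≤ x → x ≤ fromℕ w → exp x ≤ᵣ fromℚ (fromℕ (4 ℕ.^ w))
  exp-≤ w 0≤x x≤w ε 0<ε = 0 , λ N _ → ℚ.≤-trans (expSum-≤ w 0≤x x≤w N)
    (ℚ.≤-trans (ℚ.≤-reflexive (sym (ℚ.+-identityʳ _))) (ℚ.+-monoʳ-≤ (fromℕ (4 ℕ.^ w)) (ℚ.<⇒≤ 0<ε)))

  -- Both sides are multiplied by the partial sum S of exp x. Then q S ≤ q · 4 ^ w ≤ 1, and 1 is
  -- within ε of the product of S with the partial sum of exp (- x); as S ≥ 1, the error stays at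
  -- most ε after the division.
  ≤exp- : ∀ {x q} w → 0ℚ ≤ x → x ≤ fromℕ w → 0ℚ ≤ q → q * fromℕ (4 ℕ.^ w) ≤ 1ℚ → fromℚ q ≤ᵣ exp (- x)
  ≤exp- {x} {q} w 0≤x x≤w 0≤q q4ʷ≤1 ε 0<ε = suc N₀ , λ where
      (suc N) (s≤s N₀≤N) → ℚ.*-cancelˡ-≤-pos (expSum x (suc N)) {{positive (ℚ.<-≤-trans (ℚ.positive⁻¹ 1ℚ) (1≤expSum 0≤x N))}} (begin
        S N * q
          ≡⟨ ℚ.*-comm (S N) q ⟩
        q * S N
          ≤⟨ ℚ.*-monoˡ-≤-nonNeg q {{nonNegative 0≤q}} (expSum-≤ w 0≤x x≤w (suc N)) ⟩
        q * fromℕ (4 ℕ.^ w)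
          ≤⟨ q4ʷ≤1 ⟩
        1ℚ
          ≡⟨ solve 1 (λ p → con 1ℚ := p :+ (con 1ℚ :- p)) refl (S N * S⁻ N) ⟩
        S N * S⁻ N + (1ℚ - S N * S⁻ N)
          ≤⟨ ℚ.+-monoʳ-≤ (S N * S⁻ N) (ℚ.≤-trans (p≤∣p∣ (1ℚ - S N * S⁻ N)) (ℚ.≤-trans (ℚ.≤-reflexive (flip-abs 1ℚ (S N * S⁻ N)))
               (ℚ.≤-trans (expSum-inverse 0≤x N) (ℚ.≤-trans (p≤∣p∣ _)
                 (close (suc N ℕ.+ suc N) (suc N) (ℕ.≤-trans (ℕ.m≤n⇒m≤1+n N₀≤N) (ℕ.m≤m+n (suc N) (suc N))) (ℕ.m≤n⇒m≤1+n N₀≤N)))))) ⟩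
        S N * S⁻ N + ε
          ≡⟨ cong (S N * S⁻ N +_) (sym (ℚ.*-identityˡ ε)) ⟩
        S N * S⁻ N + 1ℚ * ε
          ≤⟨ ℚ.+-monoʳ-≤ (S N * S⁻ N) (ℚ.*-monoʳ-≤-nonNeg ε {{nonNegative (ℚ.<⇒≤ 0<ε)}} (1≤expSum 0≤x N)) ⟩
        S N * S⁻ N + S N * ε
          ≡⟨ sym (ℚ.*-distribˡ-+ (S N) (S⁻ N) ε) ⟩
        S N * (S⁻ N + ε) ∎)
    where
    open ℚ.≤-Reasoning
    open +-*-Solver
    c = cauchy (exp (x + x)) ε 0<ε
    N₀ = proj₁ c
    close = proj₂ c
    S S⁻ : ℕ → ℚ
    S  N = expSum x (suc N)
    S⁻ N = expSum (- x) (suc N)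
    p≤∣p∣ : ∀ p → p ≤ ∣ p ∣
    p≤∣p∣ p with ℚ.≤-total 0ℚ p
    ... | inj₁ 0≤p = ℚ.≤-reflexive (sym (ℚ.0≤p⇒∣p∣≡p 0≤p))
    ... | inj₂ p≤0 = ℚ.≤-trans p≤0 (ℚ.0≤∣p∣ p)
    flip-abs : ∀ p q → ∣ p - q ∣ ≡ ∣ q - p ∣
    flip-abs p q = trans (cong ∣_∣ (solve 2 (λ p q → p :- q := :- (q :- p)) refl p q)) (ℚ.∣-p∣≡∣p∣ (q - p))

-- A lower bound for the logarithm and the density condition in ℕ.

module Logarithm where

  open RationalMeans
  open Exponential
  open Estimates
  open import Data.Rational.Base using (ℚ; 0ℚ; 1ℚ; ½; _/_; _+_; _*_; _-_; -_; _≤_; _<_; nonNegative; positive)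
  open import Data.Rational.Solver using (module +-*-Solver)
  open import Algebra.Properties.Semiring.Exp (CommutativeRing.semiring ℚ.+-*-commutativeRing) using (_^_)

  module _ (k₁ : ℕ) where

    private
      k = suc k₁
      ζ = ℤ.+ k₁ / k
      v : ℕ → ℚ
      v i = ℤ.+ 1 / suc i

    1-1/k-power : ∀ i → ζ ^ i * fromℕ (k ℕ.^ i) ≡ fromℕ (k₁ ℕ.^ i)
    1-1/k-power zero    = refl
    1-1/k-power (suc i) = begin
      ζ * ζ ^ i * fromℕ (k ℕ.* k ℕ.^ i)              ≡⟨ cong (ζ * ζ ^ i *_) (fromℕ-* k (k ℕ.^ i)) ⟩
      ζ * ζ ^ i * (fromℕ k * fromℕ (k ℕ.^ i))        ≡⟨ solve 4 (λ a b c d → a :* b :* (c :* d) := a :* c :* (b :* d)) refl ζ (ζ ^ i) (fromℕ k) (fromℕ (k ℕ.^ i)) ⟩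
      ζ * fromℕ k * (ζ ^ i * fromℕ (k ℕ.^ i))        ≡⟨ cong₂ _*_ (a/b*b k₁ k) (1-1/k-power i) ⟩
      fromℕ k₁ * fromℕ (k₁ ℕ.^ i)                    ≡⟨ sym (fromℕ-* k₁ (k₁ ℕ.^ i)) ⟩
      fromℕ (k₁ ℕ.^ suc i)                           ∎
      where
      open ≡-Reasoning
      open +-*-Solver

    1-1/k-power-≥ : ∀ i → 2 ℕ.* i ℕ.≤ k → 1ℚ ≤ fromℕ 2 * ζ ^ i
    1-1/k-power-≥ i 2i≤k = ℚ.*-cancelʳ-≤-pos (fromℕ (k ℕ.^ i)) {{fromℕ-pos (k ℕ.^ i) {{ℕ.m^n≢0 k i}}}} (begin
      1ℚ * fromℕ (k ℕ.^ i)                    ≡⟨ ℚ.*-identityˡ (fromℕ (k ℕ.^ i)) ⟩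
      fromℕ (k ℕ.^ i)                         ≤⟨ fromℕ-mono (power-doubles k₁ i 2i≤k) ⟩
      fromℕ (2 ℕ.* k₁ ℕ.^ i)                  ≡⟨ fromℕ-* 2 (k₁ ℕ.^ i) ⟩
      fromℕ 2 * fromℕ (k₁ ℕ.^ i)              ≡⟨ cong (fromℕ 2 *_) (sym (1-1/k-power i)) ⟩
      fromℕ 2 * (ζ ^ i * fromℕ (k ℕ.^ i))     ≡⟨ sym (ℚ.*-assoc (fromℕ 2) (ζ ^ i) (fromℕ (k ℕ.^ i))) ⟩
      fromℕ 2 * ζ ^ i * fromℕ (k ℕ.^ i)       ∎)
      where open ℚ.≤-Reasoning

    v≥0 : ∀ i → 0ℚ ≤ v i
    v≥0 i = ℚ.nonNegative⁻¹ (v i) {{1/n-nonNeg (suc i)}}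

    lnTerm-nonNeg : ∀ i → 0ℚ ≤ lnTerm k i
    lnTerm-nonNeg i = *-nonNeg (^-nonNeg (ℚ.nonNegative⁻¹ ζ {{ℚ.normalize-nonNeg k₁ k}}) (suc i)) (v≥0 i)

    -- Up to index k / 2 the powers of 1 - 1 / k are at least 1 / 2, so the series of ln k there
    -- dominates half the harmonic series.
    lnTerm-≥ : ∀ D → 2 ℕ.* D ℕ.≤ k → ∀ i → i ℕ.< D → 1ℚ ≤ fromℕ (2 ℕ.* D) * lnTerm k i
    lnTerm-≥ D 2D≤k i i<D = begin
      1ℚ * 1ℚ                                       ≤⟨ *-mono-≤-nonNeg (0≤fromℕ 1) (ℚ.≤-trans (0≤fromℕ 1) half) half 1≤Dv ⟩
      fromℕ 2 * ζ ^ suc i * (fromℕ D * v i)         ≡⟨ solve 4 (λ a b c d → a :* b :* (c :* d) := a :* c :* (b :* d)) refl (fromℕ 2) (ζ ^ suc i) (fromℕ D) (v i) ⟩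
      fromℕ 2 * fromℕ D * (ζ ^ suc i * v i)         ≡⟨ cong (_* lnTerm k i) (sym (fromℕ-* 2 D)) ⟩
      fromℕ (2 ℕ.* D) * lnTerm k i                  ∎
      where
      open ℚ.≤-Reasoning
      open +-*-Solver
      half : 1ℚ ≤ fromℕ 2 * ζ ^ suc i
      half = 1-1/k-power-≥ (suc i) (ℕ.≤-trans (ℕ.*-monoʳ-≤ 2 i<D) 2D≤k)
      1≤Dv : 1ℚ ≤ fromℕ D * v i
      1≤Dv = ℚ.≤-trans (ℚ.≤-reflexive (sym (trans (ℚ.*-comm (fromℕ (suc i)) (v i)) (1/n*n (suc i)))))
        (ℚ.*-monoʳ-≤-nonNeg (v i) {{1/n-nonNeg (suc i)}} (fromℕ-mono i<D))

    lnSum : ℕ → ℚ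
    lnSum = partialSum (lnTerm k)

    block : ∀ d N M → (∀ i → i ℕ.< M → 1ℚ ≤ fromℕ d * lnTerm k i) → ∀ j → j ℕ.+ N ℕ.≤ M →
            fromℕ d * lnSum N + fromℕ j ≤ fromℕ d * lnSum (j ℕ.+ N)
    block d N M u≥ zero    _    = ℚ.≤-reflexive (ℚ.+-identityʳ (fromℕ d * lnSum N))
    block d N M u≥ (suc j) j+N< = begin
      fromℕ d * lnSum N + fromℕ (suc j)
        ≡⟨ cong (fromℕ d * lnSum N +_) (trans (cong fromℕ (ℕ.+-comm 1 j)) (fromℕ-+ j 1)) ⟩
      fromℕ d * lnSum N + (fromℕ j + 1ℚ)
        ≡⟨ sym (ℚ.+-assoc (fromℕ d * lnSum N) (fromℕ j) 1ℚ) ⟩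
      fromℕ d * lnSum N + fromℕ j + 1ℚ
        ≤⟨ ℚ.+-mono-≤ (block d N M u≥ j (ℕ.<⇒≤ j+N<)) (u≥ (j ℕ.+ N) j+N<) ⟩
      fromℕ d * lnSum (j ℕ.+ N) + fromℕ d * lnTerm k (j ℕ.+ N)
        ≡⟨ sym (ℚ.*-distribˡ-+ (fromℕ d) (lnSum (j ℕ.+ N)) (lnTerm k (j ℕ.+ N))) ⟩
      fromℕ d * lnSum (suc j ℕ.+ N) ∎
      where open ℚ.≤-Reasoning

    -- As in the divergence of the harmonic series, each dyadic block contributes at least 1/4.
    lnSum-dyadic : ∀ e → 2 ℕ.* 2 ℕ.^ e ℕ.≤ k → fromℕ (suc (suc e)) ≤ fromℕ 4 * lnSum (2 ℕ.^ e)
    lnSum-dyadic zero    2≤k = begin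
      fromℕ 2 * 1ℚ                          ≤⟨ ℚ.*-monoˡ-≤-nonNeg (fromℕ 2) (lnTerm-≥ 1 2≤k 0 (s≤s z≤n)) ⟩
      fromℕ 2 * (fromℕ 2 * lnTerm k 0)      ≡⟨ solve 1 (λ u → con (fromℕ 2) :* (con (fromℕ 2) :* u) := con (fromℕ 4) :* (con 0ℚ :+ u)) refl (lnTerm k 0) ⟩
      fromℕ 4 * (0ℚ + lnTerm k 0)           ∎
      where
      open ℚ.≤-Reasoning
      open +-*-Solver
    lnSum-dyadic (suc e) 4a≤k = ℚ.*-cancelˡ-≤-pos (fromℕ a) {{fromℕ-pos a {{ℕ.m^n≢0 2 e}}}} (begin
      fromℕ a * fromℕ (3 ℕ.+ e)
        ≡⟨ cong (fromℕ a *_) (trans (cong fromℕ (ℕ.+-comm 1 (2 ℕ.+ e))) (fromℕ-+ (2 ℕ.+ e) 1)) ⟩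
      fromℕ a * (fromℕ (2 ℕ.+ e) + 1ℚ)
        ≤⟨ ℚ.*-monoˡ-≤-nonNeg (fromℕ a) {{fromℕ-nonNeg a}} (ℚ.+-monoˡ-≤ 1ℚ (lnSum-dyadic e (ℕ.≤-trans (ℕ.m≤n*m (2 ℕ.* a) 2) 4a≤k))) ⟩
      fromℕ a * (fromℕ 4 * lnSum a + 1ℚ)
        ≡⟨ solve 2 (λ a s → a :* (con (fromℕ 4) :* s :+ con 1ℚ) := con (fromℕ 4) :* a :* s :+ a) refl (fromℕ a) (lnSum a) ⟩
      fromℕ 4 * fromℕ a * lnSum a + fromℕ a
        ≡⟨ cong (λ d → d * lnSum a + fromℕ a) (trans (sym (fromℕ-* 4 a)) (cong fromℕ (ℕ.*-assoc 2 2 a))) ⟩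
      fromℕ (2 ℕ.* (2 ℕ.* a)) * lnSum a + fromℕ a
        ≤⟨ block (2 ℕ.* (2 ℕ.* a)) a (2 ℕ.* a) (lnTerm-≥ (2 ℕ.* a) 4a≤k) a (ℕ.≤-reflexive (cong (a ℕ.+_) (sym (ℕ.+-identityʳ a)))) ⟩
      fromℕ (2 ℕ.* (2 ℕ.* a)) * lnSum (a ℕ.+ a)
        ≡⟨ cong₂ (λ d N → d * lnSum N) (trans (cong fromℕ (sym (ℕ.*-assoc 2 2 a))) (fromℕ-* 4 a)) (cong (a ℕ.+_) (sym (ℕ.+-identityʳ a))) ⟩
      fromℕ 4 * fromℕ a * lnSum (2 ℕ.* a)
        ≡⟨ solve 2 (λ a s → con (fromℕ 4) :* a :* s := a :* (con (fromℕ 4) :* s)) refl (fromℕ a) (lnSum (2 ℕ.* a)) ⟩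
      fromℕ a * (fromℕ 4 * lnSum (2 ℕ.* a)) ∎)
      where
      open ℚ.≤-Reasoning
      open +-*-Solver
      a = 2 ℕ.^ e

    lnSum-≥ : ∀ ℓ .{{_ : NonZero ℓ}} → 2 ℕ.^ ℓ ℕ.≤ k → ∀ N → k ℕ.≤ N → fromℕ ℓ ≤ fromℕ 4 * lnSum N
    lnSum-≥ (suc e) 2^ℓ≤k N k≤N = begin
      fromℕ (suc e)                  ≤⟨ fromℕ-mono (ℕ.n≤1+n (suc e)) ⟩
      fromℕ (suc (suc e))            ≤⟨ lnSum-dyadic e 2^ℓ≤k ⟩
      fromℕ 4 * lnSum (2 ℕ.^ e)      ≤⟨ ℚ.*-monoˡ-≤-nonNeg (fromℕ 4) (partialSum-≤ lnTerm-nonNeg (2 ℕ.^ e) (N ℕ.∸ 2 ℕ.^ e)) ⟩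
      fromℕ 4 * lnSum (N ℕ.∸ 2 ℕ.^ e ℕ.+ 2 ℕ.^ e)
                                     ≡⟨ cong (λ N → fromℕ 4 * lnSum N) (ℕ.m∸n+n≡m (ℕ.≤-trans (ℕ.m≤n*m (2 ℕ.^ e) 2) (ℕ.≤-trans 2^ℓ≤k k≤N))) ⟩
      fromℕ 4 * lnSum N              ∎
      where open ℚ.≤-Reasoning

  ≤-by-ε : ∀ {p q} → (∀ ε → 0ℚ < ε → p ≤ q + ε) → p ≤ q
  ≤-by-ε {p} {q} p≤q+ε with p ℚ.≤? q
  ... | yes p≤q = p≤q
  ... | no  p≰q = contradiction (begin-strict
      q + ½ * (p - q)     <⟨ ℚ.+-monoʳ-< q (subst (½ * (p - q) <_) (ℚ.*-identityˡ (p - q)) (ℚ.*-monoˡ-<-pos (p - q) {{positive 0<p-q}} {½} {1ℚ} (ℚ.*<* (ℤ.+<+ (s≤s (s≤s z≤n)))))) ⟩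
      q + (p - q)         ≡⟨ solve 2 (λ p q → q :+ (p :- q) := p) refl p q ⟩
      p                   ≤⟨ p≤q+ε (½ * (p - q)) (subst (_< ½ * (p - q)) (ℚ.*-zeroʳ ½) (ℚ.*-monoʳ-<-pos ½ 0<p-q)) ⟩
      q + ½ * (p - q)     ∎) (ℚ.<-irrefl refl)
    where
    open ℚ.≤-Reasoning
    open +-*-Solver
    0<p-q : 0ℚ < p - q
    0<p-q = subst (_< p - q) (ℚ.+-inverseʳ q) (ℚ.+-monoˡ-< (- q) (ℚ.≰⇒> p≰q))

  -- From ℓ ≤ 4 ln k follows ℓ² ≤ 16 ln² k, whence the factor 16. The comparison of reals is read
  -- off at one index N ≥ k for each ε, and `≤-by-ε` removes ε between the rationals.
  threshold-≥ : ∀ C k ℓ m n .{{_ : NonZero k}} .{{_ : NonZero ℓ}} .{{_ : NonZero n}} → 2 ℕ.^ ℓ ℕ.≤ k →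
    fromℚ (ℤ.+ m / n) ≥ᵣ threshold (fromℚ (fromℕ (16 ℕ.* C))) k → C ℕ.* 2 ℕ.^ k ℕ.* (ℓ ℕ.* ℓ) ℕ.* n ℕ.≤ m ℕ.* k
  threshold-≥ C k@(suc k₁) ℓ m n 2^ℓ≤k dense = fromℕ-cancel (begin
    fromℕ (C ℕ.* 2 ℕ.^ k ℕ.* (ℓ ℕ.* ℓ) ℕ.* n)
      ≡⟨ trans (fromℕ-* (C ℕ.* 2 ℕ.^ k ℕ.* (ℓ ℕ.* ℓ)) n) (cong (_* fromℕ n) (trans (fromℕ-* (C ℕ.* 2 ℕ.^ k) (ℓ ℕ.* ℓ)) (cong₂ _*_ (fromℕ-* C (2 ℕ.^ k)) (fromℕ-* ℓ ℓ)))) ⟩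
    fromℕ C * fromℕ (2 ℕ.^ k) * (fromℕ ℓ * fromℕ ℓ) * fromℕ n
      ≡⟨ cong (λ p → fromℕ C * p * (fromℕ ℓ * fromℕ ℓ) * fromℕ n) (sym (a/b*b (2 ℕ.^ k) k)) ⟩
    fromℕ C * (t * fromℕ k) * (fromℕ ℓ * fromℕ ℓ) * fromℕ n
      ≡⟨ solve 5 (λ c t k l n → c :* (t :* k) :* (l :* l) :* n := c :* t :* (l :* l) :* (k :* n)) refl (fromℕ C) t (fromℕ k) (fromℕ ℓ) (fromℕ n) ⟩
    fromℕ C * t * (fromℕ ℓ * fromℕ ℓ) * (fromℕ k * fromℕ n)
      ≤⟨ ℚ.*-monoʳ-≤-nonNeg (fromℕ k * fromℕ n) {{nonNegative (*-nonNeg (0≤fromℕ k) (0≤fromℕ n))}} (≤-by-ε {fromℕ C * t * (fromℕ ℓ * fromℕ ℓ)} {ℤ.+ m / n} bound) ⟩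
    (ℤ.+ m / n) * (fromℕ k * fromℕ n)
      ≡⟨ solve 3 (λ r k n → r :* (k :* n) := r :* n :* k) refl (ℤ.+ m / n) (fromℕ k) (fromℕ n) ⟩
    (ℤ.+ m / n) * fromℕ n * fromℕ k
      ≡⟨ trans (cong (_* fromℕ k) (a/b*b m n)) (sym (fromℕ-* m k)) ⟩
    fromℕ (m ℕ.* k) ∎)
    where
    open ℚ.≤-Reasoning
    open +-*-Solver
    t = ℤ.+ (2 ℕ.^ k) / k
    0≤t : 0ℚ ≤ t
    0≤t = ℚ.nonNegative⁻¹ t {{ℚ.normalize-nonNeg (2 ℕ.^ k) k}}
    bound : ∀ ε → 0ℚ < ε → fromℕ C * t * (fromℕ ℓ * fromℕ ℓ) ≤ (ℤ.+ m / n) + ε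
    bound ε 0<ε = begin
      fromℕ C * t * (fromℕ ℓ * fromℕ ℓ)
        ≤⟨ ℚ.*-monoˡ-≤-nonNeg (fromℕ C * t) {{nonNegative (*-nonNeg (0≤fromℕ C) 0≤t)}}
             (*-mono-≤-nonNeg (0≤fromℕ ℓ) (ℚ.≤-trans (0≤fromℕ ℓ) ℓ≤) ℓ≤ ℓ≤) ⟩
      fromℕ C * t * (fromℕ 4 * L * (fromℕ 4 * L))
        ≡⟨ solve 3 (λ c t l → c :* t :* (con (fromℕ 4) :* l :* (con (fromℕ 4) :* l)) := con (fromℕ 16) :* c :* t :* (l :* l)) refl (fromℕ C) t L ⟩
      fromℕ 16 * fromℕ C * t * (L * L)
        ≡⟨ cong (λ c → c * t * (L * L)) (sym (fromℕ-* 16 C)) ⟩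
      fromℕ (16 ℕ.* C) * t * (L * L)
        ≤⟨ proj₂ (dense ε 0<ε) N (ℕ.m≤m⊔n _ k) ⟩
      (ℤ.+ m / n) + ε ∎
      where
      N = proj₁ (dense ε 0<ε) ℕ.⊔ k
      L = lnSum k₁ N
      ℓ≤ : fromℕ ℓ ≤ fromℕ 4 * L
      ℓ≤ = lnSum-≥ k₁ ℓ 2^ℓ≤k N (ℕ.m≤n⊔m (proj₁ (dense ε 0<ε)) k)

  n/k²*k² : ∀ n k .{{_ : NonZero k}} → n/k² n k * fromℕ (k ℕ.^ 2) ≡ fromℕ n
  n/k²*k² n k = a/b*b n (k ℕ.^ 2) {{ℕ.m^n≢0 k 2}}

  n/k²-nonNeg : ∀ n k .{{_ : NonZero k}} → 0ℚ ≤ n/k² n k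
  n/k²-nonNeg n k = ℚ.nonNegative⁻¹ (n/k² n k) {{ℚ.normalize-nonNeg n (k ℕ.^ 2) {{ℕ.m^n≢0 k 2}}}}

  n/k²-≤ : ∀ n k w .{{_ : NonZero k}} → n ℕ.≤ w ℕ.* k ℕ.^ 2 → n/k² n k ≤ fromℕ w
  n/k²-≤ n k w n≤ = ℚ.*-cancelʳ-≤-pos (fromℕ (k ℕ.^ 2)) {{fromℕ-pos (k ℕ.^ 2) {{ℕ.m^n≢0 k 2}}}} (begin
    n/k² n k * fromℕ (k ℕ.^ 2)     ≡⟨ n/k²*k² n k ⟩
    fromℕ n                        ≤⟨ fromℕ-mono n≤ ⟩
    fromℕ (w ℕ.* k ℕ.^ 2)          ≡⟨ fromℕ-* w (k ℕ.^ 2) ⟩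
    fromℕ w * fromℕ (k ℕ.^ 2)      ∎)
    where open ℚ.≤-Reasoning

-- First entrance of the walk into the mist, and the drift away from known misty assignments.

module Walks where

  open FiniteSums
  open Assignments
  open UnionBound
  open VariableCounts
  open RationalMeans
  open import Data.List.Relation.Unary.All using (All; []; _∷_)
  open import Data.Maybe.Base using (is-just)
  open import Data.Rational.Base using (ℚ; 0ℚ; 1ℚ; _/_; _+_; _*_; _≤_)
  open import Data.Rational.Solver using (module +-*-Solver)
  open import Data.Vec.Base using (tabulate)
  open import Data.Vec.Properties using (lookup∘tabulate)
  open import Algebra.Properties.CommutativeMonoid.Sum ℕ.+-0-commutativeMonoid
    using () renaming (sum to sumℕ; sum-cong-≗ to sumℕ-cong; ∑-distrib-+ to sumℕ-+)
  open import Algebra.Properties.CommutativeMonoid.Sum ℚ.+-0-commutativeMonoid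
    using () renaming (sum-cong-≗ to sum-cong)

  ≤ᵇ-complement : ∀ {a b} → (a ℕ.≤ᵇ b) ≡ false → b ℕ.< a
  ≤ᵇ-complement {a} {b} eq = ℕ.≰⇒> λ a≤b → contradiction (trans (sym eq) (≤⇒≤ᵇ≡true a≤b)) λ ()

  module Walk {k n m} .{{_ : NonZero k}} (Φ : Formula k n m) (B : ℕ) where

    private
      literalOf : (U : List (Fin m)) → Fin (length U) → Fin k → Literal n
      literalOf U i j = lookup (lookup Φ (List.lookup U i)) j

      stepMeanOver : (Assignment n → ℚ) → Assignment n → List (Fin m) → ℚ
      -- No step is made from a satisfying assignment; the value 0 keeps the upper bounds on
      -- `stepMean` true there.
      stepMeanOver f σ []        = 0ℚ
      stepMeanOver f σ U@(_ ∷ _) = mean (length U) λ i → mean k λ j →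
        f (flip σ (literalOf U i j))

    stepMean : (Assignment n → ℚ) → Assignment n → ℚ
    stepMean f σ = stepMeanOver f σ (unsatisfied Φ σ)

    stepMean-mono : ∀ {f g} σ → (∀ ℓ → f (flip σ ℓ) ≤ g (flip σ ℓ)) → stepMean f σ ≤ stepMean g σ
    stepMean-mono σ f≤g with unsatisfied Φ σ
    ... | []        = ℚ.≤-refl
    ... | U@(_ ∷ _) = mean-mono (length U) λ i → mean-mono k λ j → f≤g (literalOf U i j)

    stepMean-+ : ∀ f g σ → stepMean (λ τ → f τ + g τ) σ ≡ stepMean f σ + stepMean g σ
    stepMean-+ f g σ with unsatisfied Φ σ
    ... | []        = refl
    ... | U@(_ ∷ _) = trans
      (cong ((ℤ.+ 1 / length U) *_) (sum-cong λ i → mean-+ k (λ j → f (flip σ (literalOf U i j))) (λ j → g (flip σ (literalOf U i j)))))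
      (mean-+ (length U) (λ i → mean k λ j → f (flip σ (literalOf U i j))) (λ i → mean k λ j → g (flip σ (literalOf U i j))))

    stepMean-≤ : ∀ {f c} σ → 0ℚ ≤ c → (∀ ℓ → f (flip σ ℓ) ≤ c) → stepMean f σ ≤ c
    stepMean-≤ σ 0≤c f≤c with unsatisfied Φ σ
    ... | []        = 0≤c
    ... | U@(_ ∷ _) = mean-≤ (length U) λ i → mean-≤ k λ j → f≤c (literalOf U i j)

    -- The flipped literal is uniform among the k · `unsat Φ σ` literal positions of the unsatisfied
    -- clauses. The common denominator c lets G take values in ℕ.
    stepMean-bound : ∀ {f} {c} (G : Literal n → ℕ) d σ → (∀ ℓ → f (flip σ ℓ) * c ≤ fromℕ (G ℓ)) →
      sumBy (λ C → 𝟙 (falsified σ C) ℕ.* sumBy G C) Φ ℕ.≤ unsat Φ σ ℕ.* (k ℕ.* d) →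
      stepMean f σ * c ≤ fromℕ d
    stepMean-bound {f} {c} G d σ f≤G ΣG≤ with unsatisfied Φ σ | length-unsatisfied Φ σ | sum-unsatisfied Φ σ (sumBy G)
    ... | []        | _      | _      = ℚ.≤-trans (ℚ.≤-reflexive (ℚ.*-zeroˡ c)) (0≤fromℕ d)
    ... | U@(_ ∷ _) | length≡ | sum≡ = begin
      mean (length U) (λ i → mean k λ j → f (flip σ (lit i j))) * c
        ≡⟨ mean-* (length U) (λ i → mean k λ j → f (flip σ (lit i j))) c ⟩
      mean (length U) (λ i → mean k (λ j → f (flip σ (lit i j))) * c)
        ≤⟨ mean-mono (length U) (λ i → ℚ.≤-trans (ℚ.≤-reflexive (mean-* k (λ j → f (flip σ (lit i j))) c)) (ℚ.≤-trans
             (mean-mono k (λ j → f≤G (lit i j)))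
             (ℚ.≤-reflexive (trans (mean-fromℕ k (λ j → G (lit i j)))
               (cong (λ s → (ℤ.+ 1 / k) * fromℕ s) (sumBy-lookup G (lookup Φ (List.lookup U i)))))))) ⟩
      mean (length U) (λ i → (ℤ.+ 1 / k) * fromℕ (sumBy G (lookup Φ (List.lookup U i))))
        ≡⟨ cong ((ℤ.+ 1 / length U) *_) (sum-cong λ i → ℚ.*-comm (ℤ.+ 1 / k) (fromℕ (sumBy G (lookup Φ (List.lookup U i))))) ⟩
      mean (length U) (λ i → fromℕ (sumBy G (lookup Φ (List.lookup U i))) * (ℤ.+ 1 / k))
        ≡⟨ sym (mean-* (length U) (λ i → fromℕ (sumBy G (lookup Φ (List.lookup U i)))) (ℤ.+ 1 / k)) ⟩
      mean (length U) (λ i → fromℕ (sumBy G (lookup Φ (List.lookup U i)))) * (ℤ.+ 1 / k)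
        ≤⟨ ℚ.*-monoʳ-≤-nonNeg (ℤ.+ 1 / k) {{1/n-nonNeg k}} (begin
          mean (length U) (λ i → fromℕ (sumBy G (lookup Φ (List.lookup U i))))
            ≡⟨ mean-fromℕ (length U) (λ i → sumBy G (lookup Φ (List.lookup U i))) ⟩
          (ℤ.+ 1 / length U) * fromℕ (sumℕ (λ i → sumBy G (lookup Φ (List.lookup U i))))
            ≤⟨ ℚ.*-monoˡ-≤-nonNeg (ℤ.+ 1 / length U) {{1/n-nonNeg (length U)}}
                 (fromℕ-mono (subst₂ ℕ._≤_ (sym sum≡) (cong (ℕ._* (k ℕ.* d)) (sym length≡)) ΣG≤)) ⟩
          (ℤ.+ 1 / length U) * fromℕ (length U ℕ.* (k ℕ.* d))
            ≡⟨ 1/n*[n*d] (length U) (k ℕ.* d) ⟩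
          fromℕ (k ℕ.* d) ∎) ⟩
      fromℕ (k ℕ.* d) * (ℤ.+ 1 / k)
        ≡⟨ trans (ℚ.*-comm (fromℕ (k ℕ.* d)) (ℤ.+ 1 / k)) (1/n*[n*d] k d) ⟩
      fromℕ d ∎
      where
      open ℚ.≤-Reasoning
      lit = literalOf U

    success : ℕ → Assignment n → ℚ
    success r σ = Pr (walk r Φ σ) is-just

    success-step : ∀ r σ → 0 ℕ.< unsat Φ σ → success (suc r) σ ≡ stepMean (success r) σ
    success-step r σ 0<U with unsatisfied Φ σ | length-unsatisfied Φ σ
    ... | []    | length≡ = contradiction (subst (0 ℕ.<_) (sym length≡) 0<U) λ ()
    ... | _ ∷ _ | _       = refl

    mist : Assignment n → Bool
    mist σ = unsat Φ σ ℕ.≤ᵇ B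

    -- First entrance at exactly the given step, whence the 0 in the mist for `suc j`. Fixing the
    -- exact time lets the last s steps before the entrance be examined alone.
    enter : ℕ → Assignment n → ℚ
    enter zero    σ = fromℕ (𝟙 (mist σ))
    enter (suc j) σ = if mist σ then 0ℚ else stepMean (enter j) σ

    enterBefore : ℕ → Assignment n → ℚ
    enterBefore zero    σ = 0ℚ
    enterBefore (suc r) σ = enterBefore r σ + enter r σ

    enterBefore-mist : ∀ r σ → mist σ ≡ true → enterBefore (suc r) σ ≡ 1ℚ
    enterBefore-mist zero    σ eq rewrite eq = refl
    enterBefore-mist (suc r) σ eq = trans (cong₂ _+_ (enterBefore-mist r σ eq) (later σ eq)) refl
      where
      later : ∀ σ → mist σ ≡ true → enter (suc r) σ ≡ 0ℚ
      later σ eq rewrite eq = refl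

    enterBefore-step : ∀ r σ → mist σ ≡ false → enterBefore (suc r) σ ≡ stepMean (enterBefore r) σ
    enterBefore-step zero σ eq = trans (cong (λ b → 0ℚ + fromℕ (𝟙 b)) eq) (sym zero-mean)
      where
      zero-mean : stepMean (λ _ → 0ℚ) σ ≡ 0ℚ
      zero-mean with unsatisfied Φ σ
      ... | []        = refl
      ... | U@(_ ∷ _) = trans (cong ((ℤ.+ 1 / length U) *_) (sum-cong {length U} λ i → mean-const k 0ℚ)) (mean-const (length U) 0ℚ)
    enterBefore-step (suc r) σ eq = trans (cong₂ _+_ (enterBefore-step r σ eq) (later σ eq))
      (sym (stepMean-+ (enterBefore r) (enter r) σ))
      where
      later : ∀ σ → mist σ ≡ false → enter (suc r) σ ≡ stepMean (enter r) σ
      later σ eq rewrite eq = refl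

    -- A satisfying assignment lies in the mist.
    success≤enterBefore : ∀ r σ → success r σ ≤ enterBefore r σ
    success≤enterBefore zero    σ = ℚ.≤-refl
    success≤enterBefore (suc r) σ with mist σ in eq
    ... | true  = ℚ.≤-trans (Pr≤1 (walk (suc r) Φ σ) is-just) (ℚ.≤-reflexive (sym (enterBefore-mist r σ eq)))
    ... | false = begin
      success (suc r) σ           ≡⟨ success-step r σ (ℕ.≤-<-trans z≤n (≤ᵇ-complement eq)) ⟩
      stepMean (success r) σ      ≤⟨ stepMean-mono σ (λ ℓ → success≤enterBefore r (flip σ ℓ)) ⟩
      stepMean (enterBefore r) σ  ≡⟨ sym (enterBefore-step r σ eq) ⟩
      enterBefore (suc r) σ       ∎
      where open ℚ.≤-Reasoning

    -- A first entrance after j + s steps is a first entrance after s steps from the assignment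
    -- reached after j steps. That assignment is arbitrary, so the bound is required for every σ.
    enter-later : ∀ {p} → 0ℚ ≤ p → ∀ s → (∀ σ → enter s σ ≤ p) → ∀ j σ → enter (j ℕ.+ s) σ ≤ p
    enter-later 0≤p s bound zero    σ = bound σ
    enter-later 0≤p s bound (suc j) σ with mist σ
    ... | true  = 0≤p
    ... | false = stepMean-≤ σ 0≤p λ ℓ → enter-later 0≤p s bound j (flip σ ℓ)

    enter-far : ∀ j σ → (∀ τ → dist σ τ ℕ.≤ j → mist τ ≡ false) → enter j σ ≤ 0ℚ
    enter-far zero    σ far rewrite far σ (ℕ.≤-reflexive (dist-refl σ)) = ℚ.≤-refl
    enter-far (suc j) σ far with mist σ
    ... | true  = ℚ.≤-refl
    ... | false = stepMean-≤ σ ℚ.≤-refl λ ℓ → enter-far j (flip σ ℓ) λ τ d → far τ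
      (ℕ.≤-trans (dist-triangle σ (flip σ ℓ) τ)
        (ℕ.+-mono-≤ (ℕ.≤-trans (dist-flip σ σ ℓ) (s≤s (ℕ.≤-reflexive (dist-refl σ)))) d))

    enterBefore-≤ : ∀ {p} r σ → (∀ j → enter j σ ≤ p) → enterBefore r σ ≤ fromℕ r * p
    enterBefore-≤ {p} zero    σ bound = ℚ.≤-reflexive (sym (ℚ.*-zeroˡ p))
    enterBefore-≤ {p} (suc r) σ bound = begin
      enterBefore r σ + enter r σ    ≤⟨ ℚ.+-mono-≤ (enterBefore-≤ r σ bound) (bound r) ⟩
      fromℕ r * p + p                ≡⟨ solve 2 (λ a p → a :* p :+ p := (a :+ con 1ℚ) :* p) refl (fromℕ r) p ⟩
      (fromℕ r + 1ℚ) * p             ≡⟨ cong (_* p) (trans (sym (fromℕ-+ r 1)) (cong fromℕ (ℕ.+-comm r 1))) ⟩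
      fromℕ (suc r) * p              ∎
      where
      open ℚ.≤-Reasoning
      open +-*-Solver

    module Drift (h W : ℕ) .{{_ : NonZero h}}
      (conc : ∀ σ Δ → count (lookup Δ) ℕ.* W ℕ.≤ n → B ℕ.≤ unsat Φ σ →
              unsatVarCount Φ σ Δ ℕ.* (h ℕ.* h) ℕ.≤ unsat Φ σ ℕ.* k)
      (s : ℕ) (σ τ₀ : Assignment n) (τs′ : List (Assignment n))
      (near : All (λ τ → dist τ σ ℕ.≤ s) (τ₀ ∷ τs′))
      (few : length (τ₀ ∷ τs′) ℕ.* (s ℕ.+ s) ℕ.* W ℕ.≤ n)
      (e : ℕ) (covered-mist : ∀ τ → dist σ τ ℕ.≤ s → mist τ ≡ true → e ℕ.≤ count (covered (τ₀ ∷ τs′) τ))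
      where

      τs = τ₀ ∷ τs′

      M : Assignment n → ℕ
      M υ = count (covered τs υ)

      covered-flip-≤ : ∀ υ ℓ → M (flip υ ℓ) ℕ.≤ suc (M υ)
      covered-flip-≤ υ ℓ = count-change-≤ _ _ (proj₂ ℓ) λ y y≢x → unchanged τs y y≢x
        where
        unchanged : ∀ τs y → y ≢ proj₂ ℓ → covered τs (flip υ ℓ) y ≡ covered τs υ y
        unchanged τs y y≢x = cong (λ b → any (λ τ → same (lookup τ y) b) τs) (flip-other υ ℓ y y≢x)

      -- If all τs agree with υ on the variable, the flip leaves none that does; it was covered
      -- before because the list contains τ₀.
      covered-flip : ∀ υ ℓ → differing τs υ (proj₂ ℓ) ≡ false → suc (M (flip υ ℓ)) ≡ M υ
      covered-flip υ ℓ same-x = begin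
        suc (M (flip υ ℓ))                                    ≡⟨ ℕ.+-comm 1 _ ⟩
        M (flip υ ℓ) ℕ.+ 1                                    ≡⟨ cong (λ b → M (flip υ ℓ) ℕ.+ 𝟙 b) (sym covered-before) ⟩
        M (flip υ ℓ) ℕ.+ 𝟙 (covered τs υ (proj₂ ℓ))           ≡⟨ count-change _ _ (proj₂ ℓ)
          (λ y y≢x → cong (λ b → any (λ τ → same (lookup τ y) b) τs) (flip-other υ ℓ y y≢x)) ⟩
        M υ ℕ.+ 𝟙 (covered τs (flip υ ℓ) (proj₂ ℓ))           ≡⟨ cong (λ b → M υ ℕ.+ 𝟙 b) covered-after ⟩
        M υ ℕ.+ 0                                             ≡⟨ ℕ.+-identityʳ _ ⟩
        M υ                                                   ∎
        where
        open ≡-Reasoning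
        agree : ∀ a b → not (same a b) ∨ any (λ τ → not (same (lookup τ (proj₂ ℓ)) b)) τs′ ≡ false → same a b ≡ true
        agree false false _ = refl
        agree true  true  _ = refl
        covered-before : covered τs υ (proj₂ ℓ) ≡ true
        covered-before rewrite agree (lookup τ₀ (proj₂ ℓ)) (lookup υ (proj₂ ℓ)) same-x = refl
        flipped : ∀ a b → same a (not b) ≡ not (same a b)
        flipped false b = refl
        flipped true  b = refl
        covered-flip-any : ∀ b τs → any (λ τ → same (lookup τ (proj₂ ℓ)) (not b)) τs ≡ any (λ τ → not (same (lookup τ (proj₂ ℓ)) b)) τs
        covered-flip-any b []       = refl
        covered-flip-any b (τ ∷ τs) = cong₂ _∨_ (flipped (lookup τ (proj₂ ℓ)) b) (covered-flip-any b τs)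
        covered-after : covered τs (flip υ ℓ) (proj₂ ℓ) ≡ false
        covered-after = trans (cong (λ b → any (λ τ → same (lookup τ (proj₂ ℓ)) b) τs) (flip-self υ ℓ))
          (trans (covered-flip-any (lookup υ (proj₂ ℓ)) τs) same-x)

      -- Each τ is within s of σ, as is υ. A variable flipped away from the τs is one on which they
      -- differ from υ, so this set also takes care of repeated flips.
      differing-few : ∀ υ → dist σ υ ℕ.≤ s → count (differing τs υ) ℕ.≤ length τs ℕ.* (s ℕ.+ s)
      differing-few υ d≤s = go τs near
        where
        go : ∀ τs → All (λ τ → dist τ σ ℕ.≤ s) τs → count (differing τs υ) ℕ.≤ length τs ℕ.* (s ℕ.+ s)
        go [] [] = ℕ.≤-trans (ℕ.≤-reflexive (sum-const n 0)) (ℕ.≤-reflexive (ℕ.*-zeroʳ n))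
        go (τ ∷ τs) (d ∷ near) = begin
          count (differing (τ ∷ τs) υ)
            ≤⟨ sum-mono (λ x → 𝟙-∨ (not (same (lookup τ x) (lookup υ x))) (differing τs υ x)) ⟩
          sumℕ (λ x → 𝟙 (not (same (lookup τ x) (lookup υ x))) ℕ.+ 𝟙 (differing τs υ x))
            ≡⟨ sumℕ-+ (λ x → 𝟙 (not (same (lookup τ x) (lookup υ x)))) (λ x → 𝟙 (differing τs υ x)) ⟩
          dist τ υ ℕ.+ count (differing τs υ)
            ≤⟨ ℕ.+-mono-≤ (ℕ.≤-trans (dist-triangle τ σ υ) (ℕ.+-mono-≤ d d≤s)) (go τs near) ⟩
          s ℕ.+ s ℕ.+ length τs ℕ.* (s ℕ.+ s) ∎
          where
          open ℕ.≤-Reasoning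
          𝟙-∨ : ∀ a b → 𝟙 (a ∨ b) ℕ.≤ 𝟙 a ℕ.+ 𝟙 b
          𝟙-∨ false b = ℕ.≤-refl
          𝟙-∨ true  b = ℕ.m≤m+n 1 (𝟙 b)

      flip-weight : ∀ υ ℓ → h ℕ.^ M (flip υ ℓ) ℕ.* h ℕ.≤
                    h ℕ.^ M υ ℕ.+ 𝟙 (differing τs υ (proj₂ ℓ)) ℕ.* (h ℕ.* h ℕ.* h ℕ.^ M υ)
      flip-weight υ ℓ with differing τs υ (proj₂ ℓ) in eq
      ... | false = ℕ.≤-trans (ℕ.≤-reflexive (trans (ℕ.*-comm _ h) (cong (h ℕ.^_) (covered-flip υ ℓ eq)))) (ℕ.m≤m+n _ 0)
      ... | true  = begin
        h ℕ.^ M (flip υ ℓ) ℕ.* h                            ≤⟨ ℕ.*-monoˡ-≤ h (ℕ.^-monoʳ-≤ h (covered-flip-≤ υ ℓ)) ⟩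
        h ℕ.* h ℕ.^ M υ ℕ.* h                               ≡⟨ solve 2 (λ h p → h :* p :* h := con 1 :* (h :* h :* p)) refl h (h ℕ.^ M υ) ⟩
        1 ℕ.* (h ℕ.* h ℕ.* h ℕ.^ M υ)                       ≤⟨ ℕ.m≤n+m _ (h ℕ.^ M υ) ⟩
        h ℕ.^ M υ ℕ.+ 1 ℕ.* (h ℕ.* h ℕ.* h ℕ.^ M υ)         ∎
        where
        open ℕ.≤-Reasoning
        open ℕSolver.+-*-Solver

      flips-weight : ∀ υ c → dist σ υ ℕ.≤ s → B ℕ.≤ unsat Φ υ →
        sumBy (λ C → 𝟙 (falsified υ C) ℕ.* sumBy (λ ℓ → c ℕ.* (h ℕ.^ M (flip υ ℓ) ℕ.* h)) C) Φ ℕ.≤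
        unsat Φ υ ℕ.* (k ℕ.* (2 ℕ.* c ℕ.* h ℕ.^ M υ))
      flips-weight υ c d≤s B≤U = begin
        sumBy (λ C → 𝟙 (falsified υ C) ℕ.* sumBy (λ ℓ → c ℕ.* (h ℕ.^ M (flip υ ℓ) ℕ.* h)) C) Φ
          ≤⟨ formula Φ ⟩
        c ℕ.* (unsat Φ υ ℕ.* k ℕ.* w ℕ.+ unsatVarCount Φ υ Δ ℕ.* (h ℕ.* h) ℕ.* w)
          ≤⟨ ℕ.*-monoʳ-≤ c (ℕ.+-monoʳ-≤ (unsat Φ υ ℕ.* k ℕ.* w) (ℕ.*-monoˡ-≤ w (conc υ Δ small B≤U))) ⟩
        c ℕ.* (unsat Φ υ ℕ.* k ℕ.* w ℕ.+ unsat Φ υ ℕ.* k ℕ.* w)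
          ≡⟨ solve 4 (λ c u k w → c :* (u :* k :* w :+ u :* k :* w) := u :* (k :* (con 2 :* c :* w))) refl c (unsat Φ υ) k w ⟩
        unsat Φ υ ℕ.* (k ℕ.* (2 ℕ.* c ℕ.* w)) ∎
        where
        open ℕ.≤-Reasoning
        open ℕSolver.+-*-Solver
        w = h ℕ.^ M υ
        Δ = tabulate (differing τs υ)
        small : count (lookup Δ) ℕ.* W ℕ.≤ n
        small = ℕ.≤-trans (ℕ.*-monoˡ-≤ W (ℕ.≤-trans
          (ℕ.≤-reflexive (sumℕ-cong λ x → cong 𝟙 (lookup∘tabulate (differing τs υ) x))) (differing-few υ d≤s))) few
        clause : ∀ {j} (C : Clause j n) → sumBy (λ ℓ → c ℕ.* (h ℕ.^ M (flip υ ℓ) ℕ.* h)) C ℕ.≤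
                 c ℕ.* (j ℕ.* w ℕ.+ varCount Δ C ℕ.* (h ℕ.* h) ℕ.* w)
        clause [] = z≤n
        clause {suc j} (ℓ ∷ C) = begin
          c ℕ.* (h ℕ.^ M (flip υ ℓ) ℕ.* h) ℕ.+ sumBy (λ ℓ → c ℕ.* (h ℕ.^ M (flip υ ℓ) ℕ.* h)) C
            ≤⟨ ℕ.+-mono-≤ (ℕ.*-monoʳ-≤ c (flip-weight υ ℓ)) (clause C) ⟩
          c ℕ.* (w ℕ.+ 𝟙 (differing τs υ (proj₂ ℓ)) ℕ.* (h ℕ.* h ℕ.* w)) ℕ.+ c ℕ.* (j ℕ.* w ℕ.+ varCount Δ C ℕ.* (h ℕ.* h) ℕ.* w)
            ≡⟨ cong (λ b → c ℕ.* (w ℕ.+ 𝟙 b ℕ.* (h ℕ.* h ℕ.* w)) ℕ.+ c ℕ.* (j ℕ.* w ℕ.+ varCount Δ C ℕ.* (h ℕ.* h) ℕ.* w))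
                 (sym (lookup∘tabulate (differing τs υ) (proj₂ ℓ))) ⟩
          c ℕ.* (w ℕ.+ b ℕ.* (h ℕ.* h ℕ.* w)) ℕ.+ c ℕ.* (j ℕ.* w ℕ.+ varCount Δ C ℕ.* (h ℕ.* h) ℕ.* w)
            ≡⟨ solve 6 (λ c w b h j v → c :* (w :+ b :* (h :* h :* w)) :+ c :* (j :* w :+ v :* (h :* h) :* w) :=
                       c :* ((con 1 :+ j) :* w :+ (b :+ v) :* (h :* h) :* w)) refl c w b h j (varCount Δ C) ⟩
          c ℕ.* (suc j ℕ.* w ℕ.+ (b ℕ.+ varCount Δ C) ℕ.* (h ℕ.* h) ℕ.* w) ∎
          where b = 𝟙 (lookup Δ (proj₂ ℓ))
        formula : ∀ {m} (Φ : Formula k n m) →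
          sumBy (λ C → 𝟙 (falsified υ C) ℕ.* sumBy (λ ℓ → c ℕ.* (h ℕ.^ M (flip υ ℓ) ℕ.* h)) C) Φ ℕ.≤
          c ℕ.* (unsat Φ υ ℕ.* k ℕ.* w ℕ.+ unsatVarCount Φ υ Δ ℕ.* (h ℕ.* h) ℕ.* w)
        formula [] = z≤n
        formula (C ∷ Φ) = begin
          f ℕ.* sumBy (λ ℓ → c ℕ.* (h ℕ.^ M (flip υ ℓ) ℕ.* h)) C ℕ.+ _
            ≤⟨ ℕ.+-mono-≤ (ℕ.*-monoʳ-≤ f (clause C)) (formula Φ) ⟩
          f ℕ.* (c ℕ.* (k ℕ.* w ℕ.+ varCount Δ C ℕ.* (h ℕ.* h) ℕ.* w)) ℕ.+
          c ℕ.* (unsat Φ υ ℕ.* k ℕ.* w ℕ.+ unsatVarCount Φ υ Δ ℕ.* (h ℕ.* h) ℕ.* w)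
            ≡⟨ solve 8 (λ f c k w v h u H → f :* (c :* (k :* w :+ v :* (h :* h) :* w)) :+ c :* (u :* k :* w :+ H :* (h :* h) :* w)
                  := c :* ((f :+ u) :* k :* w :+ (f :* v :+ H) :* (h :* h) :* w)) refl
                  f c k w (varCount Δ C) h (unsat Φ υ) (unsatVarCount Φ υ Δ) ⟩
          c ℕ.* (unsat (C ∷ Φ) υ ℕ.* k ℕ.* w ℕ.+ unsatVarCount (C ∷ Φ) υ Δ ℕ.* (h ℕ.* h) ℕ.* w) ∎
          where f = 𝟙 (falsified υ C)

      -- The potential is h ^ `M υ`. A flip where all τs agree with υ divides it by h; any other
      -- flip multiplies it by at most h, and by `conc` has probability at most 1 / h². The mean
      -- factor per step is at most 1 / h + h / h² = 2 / h, while every misty assignment near σ has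
      -- potential at least h ^ e.
      drift : ∀ j υ → dist σ υ ℕ.+ j ℕ.≤ s → enter j υ * fromℕ (h ℕ.^ e ℕ.* h ℕ.^ j) ≤ fromℕ (2 ℕ.^ j ℕ.* h ℕ.^ M υ)
      drift zero υ d≤s with mist υ in eq
      ... | false = ℚ.≤-trans (ℚ.≤-reflexive (ℚ.*-zeroˡ (fromℕ (h ℕ.^ e ℕ.* 1)))) (0≤fromℕ (1 ℕ.* h ℕ.^ M υ))
      ... | true  = begin
        1ℚ * fromℕ (h ℕ.^ e ℕ.* 1)    ≡⟨ trans (ℚ.*-identityˡ (fromℕ (h ℕ.^ e ℕ.* 1))) (cong fromℕ (ℕ.*-identityʳ (h ℕ.^ e))) ⟩
        fromℕ (h ℕ.^ e)               ≤⟨ fromℕ-mono (ℕ.^-monoʳ-≤ h (covered-mist υ (subst (ℕ._≤ s) (ℕ.+-identityʳ _) d≤s) eq)) ⟩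
        fromℕ (h ℕ.^ M υ)             ≡⟨ cong fromℕ (sym (ℕ.*-identityˡ (h ℕ.^ M υ))) ⟩
        fromℕ (1 ℕ.* h ℕ.^ M υ)       ∎
        where open ℚ.≤-Reasoning
      drift (suc j) υ d≤s with mist υ in eq
      ... | true  = ℚ.≤-trans (ℚ.≤-reflexive (ℚ.*-zeroˡ (fromℕ (h ℕ.^ e ℕ.* h ℕ.^ suc j)))) (0≤fromℕ (2 ℕ.^ suc j ℕ.* h ℕ.^ M υ))
      ... | false = stepMean-bound {f = enter j} (λ ℓ → 2 ℕ.^ j ℕ.* (h ℕ.^ M (flip υ ℓ) ℕ.* h)) (2 ℕ.^ suc j ℕ.* h ℕ.^ M υ) υ
        (λ ℓ → begin
          enter j (flip υ ℓ) * fromℕ (h ℕ.^ e ℕ.* (h ℕ.* h ℕ.^ j))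
            ≡⟨ cong (λ a → enter j (flip υ ℓ) * fromℕ a) (solve 3 (λ a b c → a :* (b :* c) := a :* c :* b) refl (h ℕ.^ e) h (h ℕ.^ j)) ⟩
          enter j (flip υ ℓ) * fromℕ (h ℕ.^ e ℕ.* h ℕ.^ j ℕ.* h)
            ≡⟨ trans (cong (enter j (flip υ ℓ) *_) (fromℕ-* (h ℕ.^ e ℕ.* h ℕ.^ j) h)) (sym (ℚ.*-assoc (enter j (flip υ ℓ)) (fromℕ (h ℕ.^ e ℕ.* h ℕ.^ j)) (fromℕ h))) ⟩
          enter j (flip υ ℓ) * fromℕ (h ℕ.^ e ℕ.* h ℕ.^ j) * fromℕ h
            ≤⟨ ℚ.*-monoʳ-≤-nonNeg (fromℕ h) {{fromℕ-nonNeg h}} (drift j (flip υ ℓ) (closer ℓ)) ⟩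
          fromℕ (2 ℕ.^ j ℕ.* h ℕ.^ M (flip υ ℓ)) * fromℕ h
            ≡⟨ sym (fromℕ-* (2 ℕ.^ j ℕ.* h ℕ.^ M (flip υ ℓ)) h) ⟩
          fromℕ (2 ℕ.^ j ℕ.* h ℕ.^ M (flip υ ℓ) ℕ.* h)
            ≡⟨ cong fromℕ (ℕ.*-assoc (2 ℕ.^ j) _ h) ⟩
          fromℕ (2 ℕ.^ j ℕ.* (h ℕ.^ M (flip υ ℓ) ℕ.* h)) ∎)
        (flips-weight υ (2 ℕ.^ j) (ℕ.m+n≤o⇒m≤o _ d≤s) (ℕ.<⇒≤ (≤ᵇ-complement eq)))
        where
        open ℚ.≤-Reasoning
        open ℕSolver.+-*-Solver
        closer : ∀ ℓ → dist σ (flip υ ℓ) ℕ.+ j ℕ.≤ s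
        closer ℓ = ℕ.≤-trans (ℕ.+-monoˡ-≤ j (dist-flip σ υ ℓ)) (ℕ.≤-trans (ℕ.≤-reflexive (sym (ℕ.+-suc _ j))) d≤s)

-- Stars of misty assignments around a fixed centre.

module Stars where

  open FiniteSums
  open Assignments
  open UnionBound
  open VariableCounts
  open RationalMeans
  open Walks
  open import Data.List.Relation.Unary.All using (All; []; _∷_)
  open import Data.Rational.Base using (_*_; _≤_)

  module Star (k n z : ℕ) .{{_ : NonZero k}} (escape : ∀ M → M ℕ.+ z ℕ.≤ n → 5 ℕ.* M ℕ.^ k ℕ.≤ 4 ℕ.* n ℕ.^ k)
              (B s : ℕ) {m : ℕ} (Φ : Formula k n m) where

    open Spreading k n z escape
    open Walk Φ B

    -- The invariant of the construction: the weighted sum over r further members is smaller than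
    -- what r actual ones would force. A missing member is charged k ^ s for its distance and 2 ^ B
    -- for its falsified clauses; those present are charged their exact numbers of falsified
    -- clauses.
    Few : ℕ → Assignment n → List (Assignment n) → Set
    Few r σ τs = 2 ℕ.^ unsatAll Φ τs ℕ.* ((k ℕ.^ s) ℕ.^ r ℕ.* (2 ℕ.^ B) ℕ.^ r ℕ.* extensions r σ τs Φ) ℕ.<
                 2 ℕ.^ m ℕ.* (k ℕ.^ n) ℕ.^ r

    few-zero : ∀ {σ τs} → ¬ Few 0 σ τs
    few-zero {σ} {τs} few = ℕ.<⇒≱ few (subst₂ ℕ._≤_ (sym (ℕ.*-identityʳ (2 ℕ.^ m)))
      (cong (2 ℕ.^ unsatAll Φ τs ℕ.*_) (sym (ℕ.*-identityˡ _))) (prodBy-clauseWeight τs Φ))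

    -- The new member is one term of the sum in `extensions (suc r)`. Its weight is at least k ^ n /
    -- k ^ s and it falsifies at most B clauses, so the charge for one missing member covers it.
    few-extend : ∀ {r σ τs} τ → Few (suc r) σ τs → dist σ τ ℕ.≤ s → mist τ ≡ true →
                 count (covered τs τ) ℕ.+ z ℕ.≤ n → Few r σ (τ ∷ τs)
    few-extend {r} {σ} {τs} τ few near τ∈mist fresh = ℕ.*-cancelʳ-< (k ℕ.^ n) _ _ (begin-strict
      2 ℕ.^ (U ℕ.+ UA) ℕ.* (K ℕ.^ r ℕ.* β ℕ.^ r ℕ.* E) ℕ.* k ℕ.^ n
        ≡⟨ cong (λ p → p ℕ.* (K ℕ.^ r ℕ.* β ℕ.^ r ℕ.* E) ℕ.* k ℕ.^ n) (ℕ.^-distribˡ-+-* 2 U UA) ⟩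
      2 ℕ.^ U ℕ.* 2 ℕ.^ UA ℕ.* (K ℕ.^ r ℕ.* β ℕ.^ r ℕ.* E) ℕ.* k ℕ.^ n
        ≤⟨ ℕ.*-mono-≤ (ℕ.*-monoˡ-≤ (K ℕ.^ r ℕ.* β ℕ.^ r ℕ.* E) (ℕ.*-monoˡ-≤ (2 ℕ.^ UA) 2^U≤β)) kⁿ≤ ⟩
      β ℕ.* 2 ℕ.^ UA ℕ.* (K ℕ.^ r ℕ.* β ℕ.^ r ℕ.* E) ℕ.* (K ℕ.* w)
        ≡⟨ solve 7 (λ b u kr br e k w → b :* u :* (kr :* br :* e) :* (k :* w) := u :* (k :* kr :* (b :* br) :* (w :* e)))
             refl β (2 ℕ.^ UA) (K ℕ.^ r) (β ℕ.^ r) E K w ⟩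
      2 ℕ.^ UA ℕ.* (K ℕ.^ suc r ℕ.* β ℕ.^ suc r ℕ.* (w ℕ.* E))
        ≤⟨ ℕ.*-monoʳ-≤ (2 ℕ.^ UA) (ℕ.*-monoʳ-≤ (K ℕ.^ suc r ℕ.* β ℕ.^ suc r) (extensions-suc r σ τs τ Φ fresh)) ⟩
      2 ℕ.^ UA ℕ.* (K ℕ.^ suc r ℕ.* β ℕ.^ suc r ℕ.* extensions (suc r) σ τs Φ)
        <⟨ few ⟩
      2 ℕ.^ m ℕ.* (k ℕ.^ n ℕ.* (k ℕ.^ n) ℕ.^ r)
        ≡⟨ solve 3 (λ a b c → a :* (b :* c) := a :* c :* b) refl (2 ℕ.^ m) (k ℕ.^ n) ((k ℕ.^ n) ℕ.^ r) ⟩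
      2 ℕ.^ m ℕ.* (k ℕ.^ n) ℕ.^ r ℕ.* k ℕ.^ n ∎)
      where
      open ℕ.≤-Reasoning
      open ℕSolver.+-*-Solver
      U  = unsat Φ τ
      UA = unsatAll Φ τs
      K  = k ℕ.^ s
      β  = 2 ℕ.^ B
      E  = extensions r σ (τ ∷ τs) Φ
      w  = weight k σ τ
      2^U≤β : 2 ℕ.^ U ℕ.≤ β
      2^U≤β = ℕ.^-monoʳ-≤ 2 (ℕ.≤ᵇ⇒≤ U B (subst T (sym τ∈mist) _))
      kⁿ≤ : k ℕ.^ n ℕ.≤ K ℕ.* w
      kⁿ≤ = ℕ.≤-trans (ℕ.≤-reflexive (sym (weight-dist k σ τ))) (ℕ.*-monoˡ-≤ w (ℕ.^-monoʳ-≤ k near))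

    -- A single misty assignment near σ is already a star for r = 1; with no earlier members it is
    -- fresh as soon as z ≤ n.
    not-near : z ℕ.≤ n → ∀ {σ} → Few 1 σ [] → ∀ τ → dist σ τ ℕ.≤ s → mist τ ≡ false
    not-near z≤n′ {σ} few τ near with mist τ in eq
    ... | false = refl
    ... | true  = contradiction (few-extend {0} {σ} {[]} τ few near eq fresh) (few-zero {σ} {τ ∷ []})
      where
      fresh : count (covered [] τ) ℕ.+ z ℕ.≤ n
      fresh = ℕ.≤-trans (ℕ.≤-reflexive (cong (ℕ._+ z) (trans (sum-const n 0) (ℕ.*-zeroʳ n)))) z≤n′

    module _ (h W : ℕ) .{{_ : NonZero h}}
      (conc : ∀ σ Δ → count (lookup Δ) ℕ.* W ℕ.≤ n → B ℕ.≤ unsat Φ σ →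
              unsatVarCount Φ σ Δ ℕ.* (h ℕ.* h) ℕ.≤ unsat Φ σ ℕ.* k)
      (R : ℕ) (small : ∀ L → L ℕ.< R → L ℕ.* (s ℕ.+ s) ℕ.* W ℕ.≤ n) where

      -- Divided out, the probability is at most (2 / h) ^ s · h ^ z: s steps of drift, against a
      -- potential that has to drop by at most z powers of h.
      Unlikely : Assignment n → Set
      Unlikely σ = enter s σ * fromℕ (h ℕ.^ (n ℕ.∸ z) ℕ.* h ℕ.^ s) ≤ fromℕ (2 ℕ.^ s ℕ.* h ℕ.^ n)

      -- If the walk were likely to enter the mist, it could be made to enter it at a point far from all of τs.
      unlikely-from : ∀ r σ τ₀ τs → All (λ τ → dist τ σ ℕ.≤ s) (τ₀ ∷ τs) → r ℕ.+ length (τ₀ ∷ τs) ≡ R →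
                      Few r σ (τ₀ ∷ τs) → Unlikely σ
      unlikely-from zero    σ τ₀ τs near eq few = contradiction few (few-zero {σ} {τ₀ ∷ τs})
      unlikely-from (suc r) σ τ₀ τs near eq few
        with enter s σ * fromℕ (h ℕ.^ (n ℕ.∸ z) ℕ.* h ℕ.^ s) ℚ.≤? fromℕ (2 ℕ.^ s ℕ.* h ℕ.^ n)
      ... | yes unlikely = unlikely
      -- Under `likely`, a fresh misty assignment near σ is impossible, since the recursion would
      -- refute `likely`. So all misty assignments near σ are almost covered, as `drift` requires.
      -- Deciding a rational inequality replaces the search for the next member.
      ... | no  likely   = ℚ.≤-trans (drift s σ (ℕ.≤-reflexive (cong (ℕ._+ s) (dist-refl σ))))
          (fromℕ-mono (ℕ.*-monoʳ-≤ (2 ℕ.^ s) (ℕ.^-monoʳ-≤ h count≤n)))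
        where
        len<R : length (τ₀ ∷ τs) ℕ.< R
        len<R = ℕ.≤-trans (s≤s (ℕ.m≤n+m _ r)) (ℕ.≤-reflexive eq)
        covered-mist : ∀ τ → dist σ τ ℕ.≤ s → mist τ ≡ true → n ℕ.∸ z ℕ.≤ count (covered (τ₀ ∷ τs) τ)
        covered-mist τ d τ∈mist with count (covered (τ₀ ∷ τs) τ) ℕ.+ z ℕ.≤? n
        ... | no  ¬fresh = ℕ.m≤n+o⇒m∸n≤o n z (ℕ.≤-trans (ℕ.<⇒≤ (ℕ.≰⇒> ¬fresh)) (ℕ.≤-reflexive (ℕ.+-comm _ z)))
        ... | yes fresh  = contradiction
          (unlikely-from r σ τ (τ₀ ∷ τs) (subst (ℕ._≤ s) (dist-sym σ τ) d ∷ near) (trans (ℕ.+-suc r _) eq)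
            (few-extend {r} {σ} {τ₀ ∷ τs} τ few d τ∈mist fresh)) likely
        open Drift h W conc s σ τ₀ τs near (small _ len<R) (n ℕ.∸ z) covered-mist using (drift)
        count≤n : count (covered (τ₀ ∷ τs) σ) ℕ.≤ n
        count≤n = ℕ.≤-trans (sum-mono (λ x → 𝟙≤1 (covered (τ₀ ∷ τs) σ x)))
          (ℕ.≤-reflexive (trans (sum-const n 1) (ℕ.*-identityʳ n)))

      -- `drift` needs at least one known misty assignment. If none lies within s of σ, the walk
      -- cannot enter the mist in s steps; any that does starts the list.
      unlikely : z ℕ.≤ n → ∀ r → suc r ≡ R → ∀ σ → Few (suc r) σ [] → Unlikely σ
      unlikely z≤n′ r eq σ few
        with enter s σ * fromℕ (h ℕ.^ (n ℕ.∸ z) ℕ.* h ℕ.^ s) ℚ.≤? fromℕ (2 ℕ.^ s ℕ.* h ℕ.^ n)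
      ... | yes unlikely = unlikely
      ... | no  likely   = ℚ.≤-trans
        (ℚ.*-monoʳ-≤-nonNeg (fromℕ c) {{fromℕ-nonNeg c}} (enter-far s σ far))
        (ℚ.≤-trans (ℚ.≤-reflexive (ℚ.*-zeroˡ (fromℕ c))) (0≤fromℕ (2 ℕ.^ s ℕ.* h ℕ.^ n)))
        where
        c = h ℕ.^ (n ℕ.∸ z) ℕ.* h ℕ.^ s
        far : ∀ τ → dist σ τ ℕ.≤ s → mist τ ≡ false
        far τ d with mist τ in τ∈mist
        ... | false = refl
        ... | true  = contradiction
          (unlikely-from r σ τ [] (subst (ℕ._≤ s) (dist-sym σ τ) d ∷ []) (trans (ℕ.+-comm r 1) eq)
            (few-extend {r} {σ} {[]} τ few d τ∈mist (ℕ.≤-trans (ℕ.≤-reflexive (cong (ℕ._+ z) (trans (sum-const n 0) (ℕ.*-zeroʳ n)))) z≤n′)))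
          likely

-- Markov's inequality for the exceptional formulas.

module BadEvents where

  open FiniteSums
  open Assignments
  open UnionBound
  open VariableCounts

  module StarCount (k n z : ℕ) .{{_ : NonZero k}} .{{_ : NonZero n}}
      (escape : ∀ M → M ℕ.+ z ℕ.≤ n → 5 ℕ.* M ℕ.^ k ℕ.≤ 4 ℕ.* n ℕ.^ k) (m : ℕ) where

    open Spreading k n z escape
    open ℕ.≤-Reasoning
    open ℕSolver.+-*-Solver

    private
      N = ((2 ℕ.* n) ℕ.^ k) ℕ.^ m

    stars : ℕ → Formula k n m → ℕ
    stars R Φ = total (assignment↔ n) λ σ → extensions R σ [] Φ

    total-stars : ∀ R j Q → 10 ℕ.* 2 ℕ.^ k ℕ.≤ j ℕ.* R → j ℕ.* Q ℕ.≤ m →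
      2 ℕ.^ Q ℕ.* total (formula↔ k n m) (stars R) ℕ.≤ 2 ℕ.^ n ℕ.* ((suc k ℕ.^ n) ℕ.^ R ℕ.* (2 ℕ.^ m ℕ.* N))
    total-stars R j Q jR jQ = begin
      2 ℕ.^ Q ℕ.* total F (stars R)
        ≡⟨ cong (2 ℕ.^ Q ℕ.*_) (total-swap F (assignment↔ n) (λ Φ σ → extensions R σ [] Φ)) ⟩
      2 ℕ.^ Q ℕ.* total (assignment↔ n) (λ σ → total F (extensions R σ []))
        ≡⟨ sym (total-*ˡ (assignment↔ n) (2 ℕ.^ Q) (λ σ → total F (extensions R σ []))) ⟩
      total (assignment↔ n) (λ σ → 2 ℕ.^ Q ℕ.* total F (extensions R σ []))
        ≤⟨ total-bound (assignment↔ n) (λ σ → total-extensions m (2 ℕ.^ Q) (2 ℕ.^ m ℕ.* N) R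
             (λ {τs} spread len → total-spread-weight spread j Q m (subst (λ L → 10 ℕ.* 2 ℕ.^ k ℕ.≤ j ℕ.* L) (sym len) jR) jQ)
             R σ [] (ℕ.+-identityʳ R)) ⟩
      2 ℕ.^ n ℕ.* ((suc k ℕ.^ n) ℕ.^ R ℕ.* (2 ℕ.^ m ℕ.* N)) ∎
      where F = formula↔ k n m

    module _ (K : ℕ) (R Θ c : ℕ) where

      -- The threshold is Θ / c. With Θ = c = 1 its negation gives `Few` at every centre, as the sum
      -- over σ dominates each term. With R = 1, Θ = 2 ^ n and c large it bounds an average over σ,
      -- and so the share of starts near the mist.
      manyStars : Formula k n m → Bool
      manyStars Φ = Θ ℕ.* (2 ℕ.^ m ℕ.* (k ℕ.^ n) ℕ.^ R) ℕ.≤ᵇ c ℕ.* K ℕ.^ R ℕ.* stars R Φ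

      count-manyStars : ∀ g j Q → K ℕ.* suc k ℕ.^ n ℕ.≤ k ℕ.^ n ℕ.* 2 ℕ.^ g → 10 ℕ.* 2 ℕ.^ k ℕ.≤ j ℕ.* R → j ℕ.* Q ℕ.≤ m →
        2 ℕ.^ Q ℕ.* Θ ℕ.* total (formula↔ k n m) (λ Φ → 𝟙 (manyStars Φ)) ℕ.≤ c ℕ.* 2 ℕ.^ n ℕ.* (2 ℕ.^ g) ℕ.^ R ℕ.* N
      count-manyStars g j Q Kk≤ jR jQ = ℕ.*-cancelʳ-≤ _ _ (2 ℕ.^ m ℕ.* (k ℕ.^ n) ℕ.^ R)
        {{ℕ.m*n≢0 (2 ℕ.^ m) _ {{ℕ.m^n≢0 2 m}} {{ℕ.m^n≢0 (k ℕ.^ n) R {{ℕ.m^n≢0 k n}}}}}} (begin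
        2 ℕ.^ Q ℕ.* Θ ℕ.* #bad ℕ.* D
          ≡⟨ solve 4 (λ q t b d → q :* t :* b :* d := q :* (b :* (t :* d))) refl (2 ℕ.^ Q) Θ #bad D ⟩
        2 ℕ.^ Q ℕ.* (#bad ℕ.* (Θ ℕ.* D))
          ≤⟨ ℕ.*-monoʳ-≤ (2 ℕ.^ Q) (ℕ.≤-trans (markov F (λ Φ → c ℕ.* K ℕ.^ R ℕ.* stars R Φ) (Θ ℕ.* D))
               (ℕ.≤-reflexive (total-*ˡ F (c ℕ.* K ℕ.^ R) (stars R)))) ⟩
        2 ℕ.^ Q ℕ.* (c ℕ.* K ℕ.^ R ℕ.* total F (stars R))
          ≡⟨ solve 3 (λ q a t → q :* (a :* t) := a :* (q :* t)) refl (2 ℕ.^ Q) (c ℕ.* K ℕ.^ R) (total F (stars R)) ⟩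
        c ℕ.* K ℕ.^ R ℕ.* (2 ℕ.^ Q ℕ.* total F (stars R))
          ≤⟨ ℕ.*-monoʳ-≤ (c ℕ.* K ℕ.^ R) (total-stars R j Q jR jQ) ⟩
        c ℕ.* K ℕ.^ R ℕ.* (2 ℕ.^ n ℕ.* ((suc k ℕ.^ n) ℕ.^ R ℕ.* (2 ℕ.^ m ℕ.* N)))
          ≡⟨ solve 6 (λ c a b d e f → c :* a :* (b :* (d :* (e :* f))) := c :* b :* (a :* d) :* (e :* f)) refl c (K ℕ.^ R) (2 ℕ.^ n) ((suc k ℕ.^ n) ℕ.^ R) (2 ℕ.^ m) N ⟩
        c ℕ.* 2 ℕ.^ n ℕ.* (K ℕ.^ R ℕ.* (suc k ℕ.^ n) ℕ.^ R) ℕ.* (2 ℕ.^ m ℕ.* N)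
          ≡⟨ cong (λ p → c ℕ.* 2 ℕ.^ n ℕ.* p ℕ.* (2 ℕ.^ m ℕ.* N)) (sym (^-distribʳ-* K (suc k ℕ.^ n) R)) ⟩
        c ℕ.* 2 ℕ.^ n ℕ.* (K ℕ.* suc k ℕ.^ n) ℕ.^ R ℕ.* (2 ℕ.^ m ℕ.* N)
          ≤⟨ ℕ.*-monoˡ-≤ (2 ℕ.^ m ℕ.* N) (ℕ.*-monoʳ-≤ (c ℕ.* 2 ℕ.^ n) (ℕ.^-monoˡ-≤ R Kk≤)) ⟩
        c ℕ.* 2 ℕ.^ n ℕ.* (k ℕ.^ n ℕ.* 2 ℕ.^ g) ℕ.^ R ℕ.* (2 ℕ.^ m ℕ.* N)
          ≡⟨ cong (λ p → c ℕ.* 2 ℕ.^ n ℕ.* p ℕ.* (2 ℕ.^ m ℕ.* N)) (^-distribʳ-* (k ℕ.^ n) (2 ℕ.^ g) R) ⟩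
        c ℕ.* 2 ℕ.^ n ℕ.* ((k ℕ.^ n) ℕ.^ R ℕ.* (2 ℕ.^ g) ℕ.^ R) ℕ.* (2 ℕ.^ m ℕ.* N)
          ≡⟨ solve 6 (λ c b p q e f → c :* b :* (p :* q) :* (e :* f) := c :* b :* q :* f :* (e :* p)) refl c (2 ℕ.^ n) ((k ℕ.^ n) ℕ.^ R) ((2 ℕ.^ g) ℕ.^ R) (2 ℕ.^ m) N ⟩
        c ℕ.* 2 ℕ.^ n ℕ.* (2 ℕ.^ g) ℕ.^ R ℕ.* N ℕ.* D ∎)
        where
        F = formula↔ k n m
        D = 2 ℕ.^ m ℕ.* (k ℕ.^ n) ℕ.^ R
        #bad = total F (λ Φ → 𝟙 (manyStars Φ))

  module _ (k n W m B : ℕ) where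

    open Concentration k n W
    open ℕ.≤-Reasoning
    open ℕSolver.+-*-Solver

    concentrated : Formula k n m → Bool
    concentrated Φ = (2 ℕ.^ k) ℕ.^ m ℕ.* (2 ℕ.^ k) ℕ.^ B ℕ.≤ᵇ tilted Φ

    -- The factors 2 ^ n count σ and Δ; (2 ^ k) ^ B is the excess of the threshold over the bound
    -- for the mean of one term.
    count-concentrated : (2 ℕ.^ k) ℕ.^ B ℕ.* total (formula↔ k n m) (λ Φ → 𝟙 (concentrated Φ)) ℕ.≤
                         2 ℕ.^ n ℕ.* 2 ℕ.^ n ℕ.* ((2 ℕ.* n) ℕ.^ k) ℕ.^ m
    count-concentrated = ℕ.*-cancelʳ-≤ _ _ D {{ℕ.m^n≢0 (2 ℕ.^ k) m {{ℕ.m^n≢0 2 k}}}} (begin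
      (2 ℕ.^ k) ℕ.^ B ℕ.* #bad ℕ.* D          ≡⟨ solve 3 (λ a b d → a :* b :* d := b :* (d :* a)) refl ((2 ℕ.^ k) ℕ.^ B) #bad D ⟩
      #bad ℕ.* (D ℕ.* (2 ℕ.^ k) ℕ.^ B)        ≤⟨ markov F tilted (D ℕ.* (2 ℕ.^ k) ℕ.^ B) ⟩
      total F tilted                          ≤⟨ total-tilted m ⟩
      2 ℕ.^ n ℕ.* (2 ℕ.^ n ℕ.* (2 ℕ.^ k ℕ.* (2 ℕ.* n) ℕ.^ k) ℕ.^ m)
        ≡⟨ cong (λ p → 2 ℕ.^ n ℕ.* (2 ℕ.^ n ℕ.* p)) (^-distribʳ-* (2 ℕ.^ k) ((2 ℕ.* n) ℕ.^ k) m) ⟩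
      2 ℕ.^ n ℕ.* (2 ℕ.^ n ℕ.* (D ℕ.* N))
        ≡⟨ solve 3 (λ a d n → a :* (a :* (d :* n)) := a :* a :* n :* d) refl (2 ℕ.^ n) D N ⟩
      2 ℕ.^ n ℕ.* 2 ℕ.^ n ℕ.* N ℕ.* D ∎)
      where
      F = formula↔ k n m
      D = (2 ℕ.^ k) ℕ.^ m
      N = ((2 ℕ.* n) ℕ.^ k) ℕ.^ m
      #bad = total F (λ Φ → 𝟙 (concentrated Φ))

-- The success probability on a formula without exceptional behaviour.

module GoodFormulas where

  open FiniteSums
  open Assignments
  open UnionBound
  open VariableCounts
  open RationalMeans
  open Walks
  open Stars
  open BadEvents
  open import Data.Maybe.Base using (is-just)
  open import Data.Rational.Base using (ℚ; 0ℚ; 1ℚ; _/_; _+_; _*_; _≤_)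

  record Good (k n z B s W R : ℕ) .{{_ : NonZero k}} .{{_ : NonZero n}}
              (escape : ∀ M → M ℕ.+ z ℕ.≤ n → 5 ℕ.* M ℕ.^ k ℕ.≤ 4 ℕ.* n ℕ.^ k) {m : ℕ} (Φ : Formula k n m) : Set where
    open StarCount k n z escape m
    K = k ℕ.^ s ℕ.* 2 ℕ.^ B
    field
      few-stars    : manyStars K R 1 1 Φ ≡ false
      few-near     : manyStars K 1 (2 ℕ.^ n) (2 ℕ.* 16 ℕ.^ z) Φ ≡ false
      unconcentrated : concentrated k n W m B Φ ≡ false

  module GoodFormula (k n z B h R : ℕ) .{{_ : NonZero k}} .{{_ : NonZero n}} .{{_ : NonZero z}}
      (escape : ∀ M → M ℕ.+ z ℕ.≤ n → 5 ℕ.* M ℕ.^ k ℕ.≤ 4 ℕ.* n ℕ.^ k)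
      (z≤n′ : z ℕ.≤ n) (h≡ : h ≡ 4 ℕ.* 1024)
      (small : ∀ L → L ℕ.< suc R → L ℕ.* (z ℕ.+ z ℕ.+ (z ℕ.+ z)) ℕ.* 4 ℕ.^ (h ℕ.* h) ℕ.≤ n)
      {m : ℕ} (Φ : Formula k n m) (good : Good k n z B (z ℕ.+ z) (4 ℕ.^ (h ℕ.* h)) (suc R) escape Φ) where

    open Good good
    open Spreading k n z escape
    open StarCount k n z escape m
    open Walk Φ B
    open Star k n z escape B (z ℕ.+ z) Φ
    open ℕSolver.+-*-Solver

    private
      s = z ℕ.+ z
      c = 2 ℕ.* 16 ℕ.^ z
      instance
        2ⁿ≢0 : NonZero (2 ℕ.^ n)
        2ⁿ≢0 = ℕ.m^n≢0 2 n
        1024ᶻ≢0 : NonZero (1024 ℕ.^ z)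
        1024ᶻ≢0 = ℕ.m^n≢0 1024 z
        h≢0 : NonZero h
        h≢0 = subst NonZero (sym h≡) _
        c≢0 : NonZero c
        c≢0 = ℕ.m*n≢0 2 (16 ℕ.^ z) {{_}} {{ℕ.m^n≢0 16 z}}

    -- 1024 = 4 · 16 · 16: one factor 16 ^ z for the number of steps, one for the desired bound, and
    -- 4 ^ z for the constants.
    p : ℚ
    p = ℤ.+ 1 / (1024 ℕ.^ z)

    0≤p : 0ℚ ≤ p
    0≤p = ℚ.nonNegative⁻¹ p {{1/n-nonNeg (1024 ℕ.^ z)}}

    few-star : ∀ σ → Few (suc R) σ []
    few-star σ = begin-strict
      1 ℕ.* ((k ℕ.^ s) ℕ.^ suc R ℕ.* (2 ℕ.^ B) ℕ.^ suc R ℕ.* extensions (suc R) σ [] Φ)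
        ≡⟨ cong (λ q → 1 ℕ.* (q ℕ.* extensions (suc R) σ [] Φ)) (sym (^-distribʳ-* (k ℕ.^ s) (2 ℕ.^ B) (suc R))) ⟩
      1 ℕ.* (K ℕ.^ suc R ℕ.* extensions (suc R) σ [] Φ)
        ≤⟨ ℕ.*-monoʳ-≤ 1 (ℕ.*-monoʳ-≤ (K ℕ.^ suc R) (term≤total (assignment↔ n) (λ σ → extensions (suc R) σ [] Φ) σ)) ⟩
      1 ℕ.* (K ℕ.^ suc R ℕ.* stars (suc R) Φ)
        ≡⟨ sym (ℕ.*-assoc 1 (K ℕ.^ suc R) _) ⟩
      1 ℕ.* K ℕ.^ suc R ℕ.* stars (suc R) Φ
        <⟨ ≤ᵇ-complement few-stars ⟩
      1 ℕ.* (2 ℕ.^ m ℕ.* (k ℕ.^ n) ℕ.^ suc R)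
        ≡⟨ ℕ.*-identityˡ _ ⟩
      2 ℕ.^ m ℕ.* (k ℕ.^ n) ℕ.^ suc R ∎
      where open ℕ.≤-Reasoning

    conc : ∀ σ Δ → count (lookup Δ) ℕ.* 4 ℕ.^ (h ℕ.* h) ℕ.≤ n → B ℕ.≤ unsat Φ σ →
           unsatVarCount Φ σ Δ ℕ.* (h ℕ.* h) ℕ.≤ unsat Φ σ ℕ.* k
    conc = few-variables (h ℕ.* h) B Φ (≤ᵇ-complement unconcentrated)

    enter≤p : ∀ σ → enter s σ ≤ p
    enter≤p σ = ℚ.*-cancelʳ-≤-pos (fromℕ g) {{fromℕ-pos g}} (ℚ.*-cancelʳ-≤-pos (fromℕ X) {{fromℕ-pos X}} (begin
      enter s σ * fromℕ g * fromℕ X      ≡⟨ ℚ.*-assoc (enter s σ) (fromℕ g) (fromℕ X) ⟩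
      enter s σ * (fromℕ g * fromℕ X)    ≡⟨ cong (enter s σ *_) (sym (fromℕ-* g X)) ⟩
      enter s σ * fromℕ (g ℕ.* X)        ≡⟨ cong (λ y → enter s σ * fromℕ y) (sym lhs) ⟩
      enter s σ * fromℕ (a ℕ.* h ℕ.^ s)  ≤⟨ unlikely h (4 ℕ.^ (h ℕ.* h)) conc (suc R) small z≤n′ R refl σ (few-star σ) ⟩
      fromℕ (2 ℕ.^ s ℕ.* h ℕ.^ n)        ≡⟨ cong fromℕ rhs ⟩
      fromℕ X                            ≡⟨ sym (ℚ.*-identityˡ (fromℕ X)) ⟩
      1ℚ * fromℕ X                       ≡⟨ cong (_* fromℕ X) (sym (1/n*n g)) ⟩
      p * fromℕ g * fromℕ X              ∎))
      where
      open ℚ.≤-Reasoning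
      a = h ℕ.^ (n ℕ.∸ z)
      b = h ℕ.^ z
      f = 2 ℕ.^ z
      g = 1024 ℕ.^ z
      X = f ℕ.* f ℕ.* (a ℕ.* b)
      instance
        X≢0 : NonZero X
        X≢0 = ℕ.m*n≢0 (f ℕ.* f) (a ℕ.* b) {{ℕ.m*n≢0 f f {{ℕ.m^n≢0 2 z}} {{ℕ.m^n≢0 2 z}}}}
                {{ℕ.m*n≢0 a b {{ℕ.m^n≢0 h (n ℕ.∸ z)}} {{ℕ.m^n≢0 h z}}}}
      b≡ : b ≡ f ℕ.* f ℕ.* g
      b≡ = trans (cong (ℕ._^ z) h≡) (trans (^-distribʳ-* 4 1024 z) (cong (ℕ._* g) (^-distribʳ-* 2 2 z)))
      lhs : a ℕ.* h ℕ.^ s ≡ g ℕ.* X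
      lhs = trans (cong (a ℕ.*_) (ℕ.^-distribˡ-+-* h z z)) (trans (cong (λ b′ → a ℕ.* (b′ ℕ.* b)) b≡)
        (solve 4 (λ a f g b → a :* (f :* f :* g :* b) := g :* (f :* f :* (a :* b))) refl a f g b))
      rhs : 2 ℕ.^ s ℕ.* h ℕ.^ n ≡ X
      rhs = cong₂ ℕ._*_ (ℕ.^-distribˡ-+-* 2 z z)
        (trans (cong (h ℕ.^_) (sym (ℕ.m∸n+n≡m z≤n′))) (ℕ.^-distribˡ-+-* h (n ℕ.∸ z) z))

    -- The first-moment condition in place of an actual misty assignment near σ: its negation is
    -- `Few 1 σ []`, and Markov's inequality over σ applies to it directly.
    nearMist : Assignment n → Bool
    nearMist σ = 2 ℕ.^ m ℕ.* k ℕ.^ n ℕ.≤ᵇ K ℕ.* extensions 1 σ [] Φ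

    count-nearMist : total (assignment↔ n) (λ σ → 𝟙 (nearMist σ)) ℕ.* c ℕ.≤ 2 ℕ.^ n
    count-nearMist = ℕ.*-cancelʳ-≤ _ _ D {{ℕ.m*n≢0 (2 ℕ.^ m) _ {{ℕ.m^n≢0 2 m}} {{ℕ.m^n≢0 k n}}}} (begin
      #near ℕ.* c ℕ.* D                      ≡⟨ solve 3 (λ a b d → a :* b :* d := b :* (a :* d)) refl #near c D ⟩
      c ℕ.* (#near ℕ.* D)                    ≤⟨ ℕ.*-monoʳ-≤ c (ℕ.≤-trans (markov (assignment↔ n) (λ σ → K ℕ.* extensions 1 σ [] Φ) D)
                                                 (ℕ.≤-reflexive (total-*ˡ (assignment↔ n) K (λ σ → extensions 1 σ [] Φ)))) ⟩
      c ℕ.* (K ℕ.* stars 1 Φ)                ≡⟨ solve 3 (λ c k t → c :* (k :* t) := c :* (k :* con 1) :* t) refl c K (stars 1 Φ) ⟩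
      c ℕ.* K ℕ.^ 1 ℕ.* stars 1 Φ            ≤⟨ ℕ.<⇒≤ (≤ᵇ-complement few-near) ⟩
      2 ℕ.^ n ℕ.* (2 ℕ.^ m ℕ.* (k ℕ.^ n) ℕ.^ 1)  ≡⟨ cong (λ q → 2 ℕ.^ n ℕ.* (2 ℕ.^ m ℕ.* q)) (ℕ.*-identityʳ (k ℕ.^ n)) ⟩
      2 ℕ.^ n ℕ.* D                          ∎)
      where
      open ℕ.≤-Reasoning
      D = 2 ℕ.^ m ℕ.* k ℕ.^ n
      #near = total (assignment↔ n) (λ σ → 𝟙 (nearMist σ))

    -- From a start that is not `nearMist` an entrance within s steps is impossible, and each later
    -- entrance time has probability at most p.
    success-bound : ∀ r σ → success r σ ≤ fromℕ (𝟙 (nearMist σ)) + fromℕ r * p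
    success-bound r σ with nearMist σ in eq
    ... | true  = begin
      success r σ           ≤⟨ Pr≤1 (walk r Φ σ) is-just ⟩
      1ℚ                    ≡⟨ sym (ℚ.+-identityʳ 1ℚ) ⟩
      1ℚ + 0ℚ               ≡⟨ cong (1ℚ +_) (sym (ℚ.*-zeroʳ (fromℕ r))) ⟩
      1ℚ + fromℕ r * 0ℚ     ≤⟨ ℚ.+-monoʳ-≤ 1ℚ (ℚ.*-monoˡ-≤-nonNeg (fromℕ r) {{fromℕ-nonNeg r}} 0≤p) ⟩
      1ℚ + fromℕ r * p      ∎
      where open ℚ.≤-Reasoning
    ... | false = begin
      success r σ           ≤⟨ success≤enterBefore r σ ⟩
      enterBefore r σ       ≤⟨ enterBefore-≤ r σ bound ⟩
      fromℕ r * p           ≡⟨ sym (ℚ.+-identityˡ (fromℕ r * p)) ⟩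
      0ℚ + fromℕ r * p      ∎
      where
      open ℚ.≤-Reasoning
      few-one : Few 1 σ []
      few-one = subst₂ ℕ._<_
        (solve 3 (λ a b e → a :* b :* e := con 1 :* (a :* con 1 :* (b :* con 1) :* e)) refl (k ℕ.^ s) (2 ℕ.^ B) (extensions 1 σ [] Φ))
        (cong (2 ℕ.^ m ℕ.*_) (sym (ℕ.*-identityʳ (k ℕ.^ n))))
        (≤ᵇ-complement eq)
      bound : ∀ j → enter j σ ≤ p
      bound j with ℕ.≤-total j s
      ... | inj₁ j≤s = ℚ.≤-trans (enter-far j σ λ τ d → not-near z≤n′ {σ} few-one τ (ℕ.≤-trans d j≤s)) 0≤p
      ... | inj₂ s≤j = subst (λ j → enter j σ ≤ p) (ℕ.m∸n+n≡m s≤j) (enter-later 0≤p s enter≤p (j ℕ.∸ s) σ)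

    -- The factor 2 in c splits the bound in halves, one for starts near the mist and one for
    -- entrances from elsewhere.
    success-small : ∀ ω → ω ℕ.≤ 16 ℕ.^ z → successProbability Φ ω * fromℕ (16 ℕ.^ z) ≤ 1ℚ
    success-small ω ω≤ = ℚ.*-cancelʳ-≤-pos (fromℕ 2) (begin
      q * fromℕ (16 ℕ.^ z) * fromℕ 2     ≡⟨ trans (ℚ.*-assoc q _ (fromℕ 2)) (cong (q *_) (trans (sym (fromℕ-* (16 ℕ.^ z) 2)) (cong fromℕ (ℕ.*-comm (16 ℕ.^ z) 2)))) ⟩
      q * fromℕ c                        ≤⟨ ℚ.*-monoʳ-≤-nonNeg (fromℕ c) {{fromℕ-nonNeg c}} q≤ ⟩
      (X + Y) * fromℕ c                  ≡⟨ ℚ.*-distribʳ-+ (fromℕ c) X Y ⟩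
      X * fromℕ c + Y * fromℕ c          ≤⟨ ℚ.+-mono-≤ Xc≤1 Yc≤1 ⟩
      1ℚ * fromℕ 2                       ∎)
      where
      open ℚ.≤-Reasoning
      q = successProbability Φ ω
      #near = total (assignment↔ n) (λ σ → 𝟙 (nearMist σ))
      X = (ℤ.+ 1 / (2 ℕ.^ n)) * fromℕ #near
      -- Walksat examines ω + 1 assignments.
      Y = fromℕ (suc ω) * p
      q≤ : q ≤ X + Y
      q≤ = begin
        q
          ≤⟨ mean-mono (2 ℕ.^ n) (λ i → success-bound (suc ω) (Inverse.to (assignment↔ n) i)) ⟩
        mean (2 ℕ.^ n) (λ i → fromℕ (𝟙 (nearMist (Inverse.to (assignment↔ n) i))) + Y)
          ≡⟨ mean-+ (2 ℕ.^ n) (λ i → fromℕ (𝟙 (nearMist (Inverse.to (assignment↔ n) i)))) (λ _ → Y) ⟩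
        mean (2 ℕ.^ n) (λ i → fromℕ (𝟙 (nearMist (Inverse.to (assignment↔ n) i)))) + mean (2 ℕ.^ n) (λ _ → Y)
          ≡⟨ cong₂ _+_ (mean-fromℕ (2 ℕ.^ n) (λ i → 𝟙 (nearMist (Inverse.to (assignment↔ n) i)))) (mean-const (2 ℕ.^ n) Y) ⟩
        X + Y ∎
      Xc≤1 : X * fromℕ c ≤ 1ℚ
      Xc≤1 = begin
        (ℤ.+ 1 / (2 ℕ.^ n)) * fromℕ #near * fromℕ c
          ≡⟨ trans (ℚ.*-assoc (ℤ.+ 1 / (2 ℕ.^ n)) (fromℕ #near) (fromℕ c)) (cong ((ℤ.+ 1 / (2 ℕ.^ n)) *_) (sym (fromℕ-* #near c))) ⟩
        (ℤ.+ 1 / (2 ℕ.^ n)) * fromℕ (#near ℕ.* c)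
          ≤⟨ ℚ.*-monoˡ-≤-nonNeg (ℤ.+ 1 / (2 ℕ.^ n)) {{1/n-nonNeg (2 ℕ.^ n)}} (fromℕ-mono count-nearMist) ⟩
        (ℤ.+ 1 / (2 ℕ.^ n)) * fromℕ (2 ℕ.^ n)
          ≡⟨ 1/n*n (2 ℕ.^ n) ⟩
        1ℚ ∎
      ωc≤ : suc ω ℕ.* c ℕ.≤ 1024 ℕ.^ z
      ωc≤ = ≤-chain
        where
        module ≤R = ℕ.≤-Reasoning
        v = 16 ℕ.^ z
        1≤v : 1 ℕ.≤ v
        1≤v = ℕ.m^n>0 16 z
        ≤-chain : suc ω ℕ.* c ℕ.≤ 1024 ℕ.^ z
        ≤-chain = ≤R.begin
          suc ω ℕ.* (2 ℕ.* v)          ≤R.≤⟨ ℕ.*-monoˡ-≤ (2 ℕ.* v) (ℕ.+-mono-≤ 1≤v ω≤) ⟩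
          (v ℕ.+ v) ℕ.* (2 ℕ.* v)      ≤R.≡⟨ solve 1 (λ v → (v :+ v) :* (con 2 :* v) := con 4 :* (v :* v)) refl v ⟩
          4 ℕ.* (v ℕ.* v)              ≤R.≡⟨ cong (4 ℕ.*_) (sym (^-distribʳ-* 16 16 z)) ⟩
          4 ℕ.* 256 ℕ.^ z              ≤R.≤⟨ ℕ.*-monoˡ-≤ (256 ℕ.^ z) (ℕ.^-monoʳ-≤ 4 (ℕ.>-nonZero⁻¹ z)) ⟩
          4 ℕ.^ z ℕ.* 256 ℕ.^ z        ≤R.≡⟨ sym (^-distribʳ-* 4 256 z) ⟩
          1024 ℕ.^ z                   ≤R.∎
      Yc≤1 : Y * fromℕ c ≤ 1ℚ
      Yc≤1 = begin
        fromℕ (suc ω) * p * fromℕ c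
          ≡⟨ trans (cong (_* fromℕ c) (ℚ.*-comm (fromℕ (suc ω)) p)) (trans (ℚ.*-assoc p (fromℕ (suc ω)) (fromℕ c)) (cong (p *_) (sym (fromℕ-* (suc ω) c)))) ⟩
        p * fromℕ (suc ω ℕ.* c)
          ≤⟨ ℚ.*-monoˡ-≤-nonNeg p {{1/n-nonNeg (1024 ℕ.^ z)}} (fromℕ-mono ωc≤) ⟩
        p * fromℕ (1024 ℕ.^ z)
          ≡⟨ 1/n*n (1024 ℕ.^ z) ⟩
        1ℚ ∎

-- Constants, and the probability of the exceptional formulas.

module Probabilities where

  open FiniteSums
  open Assignments
  open UnionBound
  open VariableCounts
  open RationalMeans
  open BadEvents
  open GoodFormulas
  open Estimates
  open import Data.Rational.Base using (ℚ; 0ℚ; 1ℚ; _/_; _+_; _*_; _-_; -_; _≤_; _<_)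
  open import Data.Rational.Solver using (module +-*-Solver)

  Pr-nonNeg : ∀ {A} (μ : Rand A) P → 0ℚ ≤ Pr μ P
  Pr-nonNeg (return a) P with P a
  ... | true  = 0≤fromℕ 1
  ... | false = ℚ.≤-refl
  Pr-nonNeg (draw N f) P = ℚ.≤-trans (ℚ.≤-reflexive (sym (mean-const N 0ℚ))) (mean-mono N λ i → Pr-nonNeg (f i) P)

  -- The numerator of a positive rational is at least 1. This makes the final bound on n explicit.
  1≤denominator* : ∀ ε → 0ℚ < ε → 1ℚ ≤ fromℕ (ℚ.denominatorℕ ε) * ε
  1≤denominator* ε@(ℚ.mkℚ (ℤ.+ suc a) d c) 0<ε = ℚ.toℚᵘ-cancel-≤ (ℚᵘ.≤-respʳ-≃ (ℚᵘ.≃-sym (ℚᵘ.≃-trans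
    (ℚ.toℚᵘ-homo-* (fromℕ (suc d)) ε) (ℚᵘ.*-congʳ {ℚᵘ.mkℚᵘ (ℤ.+ suc a) d} (ℚ.toℚᵘ-fromℚᵘ (ℚᵘ.mkℚᵘ (ℤ.+ suc d) 0)))))
    (ℚᵘ.*≤* (ℤ.+≤+ (ℕ.≤-trans
      (ℕ.≤-reflexive (cong suc (trans (ℕ.+-identityʳ (d ℕ.+ 0)) (ℕ.+-identityʳ d))))
      (ℕ.≤-trans (s≤s (ℕ.≤-trans (ℕ.m≤m*n d (suc a)) (ℕ.m≤n+m (d ℕ.* suc a) a)))
        (ℕ.≤-reflexive (cong suc (sym (ℕ.*-identityʳ (a ℕ.+ d ℕ.* suc a))))))))))
  1≤denominator* (ℚ.mkℚ (ℤ.+ zero) d c) (ℚ.*<* (ℤ.+<+ ()))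
  1≤denominator* (ℚ.mkℚ ℤ.-[1+ a ] d c) (ℚ.*<* ())

  -- Outside the mist a step multiplies an exponential moment by 2 / h, so that s = 2 z
  -- steps yield (4 / h) ^ z, small enough against 16 ^ (2 z).  The block is abstract
  -- because V must never be evaluated.
  abstract
    h : ℕ
    h = 4096

    h≡ : h ≡ 4 ℕ.* 1024
    h≡ = refl

  -- `few-variables` with K = h² makes the share of literals on Δ at most 1 / h², which outweighs
  -- the growth of the potential by h on such flips; the price is the weight 4 ^ K per variable.
  V : ℕ
  V = 4 ℕ.^ (h ℕ.* h)

  instance
    V≢0 : NonZero V
    V≢0 = ℕ.m^n≢0 4 (h ℕ.* h)

  module Fixed (k n z ℓ : ℕ) .{{_ : NonZero k}} .{{_ : NonZero n}} .{{_ : NonZero z}}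
      (1<k : 1 ℕ.< k) (2kz≤n : 2 ℕ.* k ℕ.* z ℕ.≤ n) (n≤4kz : n ℕ.≤ 4 ℕ.* k ℕ.* z)
      (1≤ℓ : 1 ℕ.≤ ℓ) (k<2^ℓ+1 : k ℕ.< 2 ℕ.^ suc ℓ) where

    open Parameters k n z ℓ V 1<k 2kz≤n n≤4kz 1≤ℓ k<2^ℓ+1

    module _ {m : ℕ} (m≥ : C ℕ.* 2 ℕ.^ k ℕ.* ℓ ℕ.* z ℕ.≤ m) where

      open StarCount k n z escape m
      open ℕSolver.+-*-Solver

      private
        F = formula↔ k n m
        N = ((2 ℕ.* n) ℕ.^ k) ℕ.^ m
        -- The choice that makes k B ≥ z + 2 n, given n ≤ 4 k z: the union bound over pairs σ, Δ
        -- costs 2 n and z remains.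
        B = 9 ℕ.* z
        K = k ℕ.^ (z ℕ.+ z) ℕ.* 2 ℕ.^ B
        c = 2 ℕ.* 16 ℕ.^ z
        bad₁ bad₂ bad₃ : Formula k n m → Bool
        bad₁ = manyStars K R 1 1
        bad₂ = manyStars K 1 (2 ℕ.^ n) c
        bad₃ = concentrated k n V m B

      #_ : (Formula k n m → Bool) → ℕ
      # P = total F (λ Φ → 𝟙 (P Φ))

      cancel-factor : ∀ D x .{{_ : NonZero D}} → 2 ℕ.^ z ℕ.* D ℕ.* x ℕ.≤ D ℕ.* N → 2 ℕ.^ z ℕ.* x ℕ.≤ N
      cancel-factor D x le = ℕ.*-cancelˡ-≤ D (subst (ℕ._≤ D ℕ.* N)
        (solve 3 (λ a d x → a :* d :* x := d :* (a :* x)) refl (2 ℕ.^ z) D x) le)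

      #bad₁ : 2 ℕ.^ z ℕ.* # bad₁ ℕ.≤ N
      #bad₁ = cancel-factor D (# bad₁) {{ℕ.m*n≢0 (2 ℕ.^ n) _ {{ℕ.m^n≢0 2 n}} {{ℕ.m^n≢0 (2 ℕ.^ g) R {{ℕ.m^n≢0 2 g}}}}}} (begin
        2 ℕ.^ z ℕ.* D ℕ.* # bad₁                ≡⟨ cong (ℕ._* # bad₁) (sym (trans (ℕ.*-identityʳ (2 ℕ.^ Q m≥)) 2^Q)) ⟩
        2 ℕ.^ Q m≥ ℕ.* 1 ℕ.* # bad₁             ≤⟨ count-manyStars K R 1 1 g (j m≥) (Q m≥) entropy (10·2ᵏ≤jR m≥) (jQ≤m m≥) ⟩
        1 ℕ.* 2 ℕ.^ n ℕ.* (2 ℕ.^ g) ℕ.^ R ℕ.* N ≡⟨ cong (λ p → p ℕ.* (2 ℕ.^ g) ℕ.^ R ℕ.* N) (ℕ.*-identityˡ (2 ℕ.^ n)) ⟩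
        D ℕ.* N                                 ∎)
        where
        open ℕ.≤-Reasoning
        D = 2 ℕ.^ n ℕ.* (2 ℕ.^ g) ℕ.^ R
        2^Q : 2 ℕ.^ Q m≥ ≡ 2 ℕ.^ z ℕ.* D
        2^Q = trans (ℕ.^-distribˡ-+-* 2 (z ℕ.+ n) (g ℕ.* R)) (trans (cong₂ ℕ._*_ (ℕ.^-distribˡ-+-* 2 z n) (sym (ℕ.^-*-assoc 2 g R))) (ℕ.*-assoc (2 ℕ.^ z) _ _))

      c≤2^5z : c ℕ.≤ 2 ℕ.^ (5 ℕ.* z)
      c≤2^5z = begin
        2 ℕ.* 16 ℕ.^ z               ≤⟨ ℕ.*-monoˡ-≤ (16 ℕ.^ z) (ℕ.^-monoʳ-≤ 2 (ℕ.>-nonZero⁻¹ z)) ⟩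
        2 ℕ.^ z ℕ.* 16 ℕ.^ z         ≡⟨ cong (2 ℕ.^ z ℕ.*_) (ℕ.^-*-assoc 2 4 z) ⟩
        2 ℕ.^ z ℕ.* 2 ℕ.^ (4 ℕ.* z)  ≡⟨ sym (ℕ.^-distribˡ-+-* 2 z (4 ℕ.* z)) ⟩
        2 ℕ.^ (5 ℕ.* z)              ∎
        where open ℕ.≤-Reasoning

      #bad₂ : 2 ℕ.^ z ℕ.* # bad₂ ℕ.≤ N
      #bad₂ = cancel-factor D (# bad₂) {{ℕ.m*n≢0 (2 ℕ.^ (5 ℕ.* z) ℕ.* 2 ℕ.^ n) (2 ℕ.^ g)
          {{ℕ.m*n≢0 (2 ℕ.^ (5 ℕ.* z)) (2 ℕ.^ n) {{ℕ.m^n≢0 2 (5 ℕ.* z)}} {{ℕ.m^n≢0 2 n}}}} {{ℕ.m^n≢0 2 g}}}} (begin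
        2 ℕ.^ z ℕ.* D ℕ.* # bad₂                            ≡⟨ cong (ℕ._* # bad₂) (sym 2^Q₁) ⟩
        2 ℕ.^ Q₁ m≥ ℕ.* 2 ℕ.^ n ℕ.* # bad₂                  ≤⟨ count-manyStars K 1 (2 ℕ.^ n) c g (10 ℕ.* 2 ℕ.^ k) (Q₁ m≥) entropy
                                                                (ℕ.≤-reflexive (sym (ℕ.*-identityʳ (10 ℕ.* 2 ℕ.^ k)))) (jQ₁≤m m≥) ⟩
        c ℕ.* 2 ℕ.^ n ℕ.* (2 ℕ.^ g) ℕ.^ 1 ℕ.* N             ≤⟨ ℕ.*-monoˡ-≤ N (ℕ.*-mono-≤ (ℕ.*-monoˡ-≤ (2 ℕ.^ n) c≤2^5z) (ℕ.≤-reflexive (ℕ.*-identityʳ (2 ℕ.^ g)))) ⟩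
        D ℕ.* N                                             ∎)
        where
        open ℕ.≤-Reasoning
        D = 2 ℕ.^ (5 ℕ.* z) ℕ.* 2 ℕ.^ n ℕ.* 2 ℕ.^ g
        2^Q₁ : 2 ℕ.^ Q₁ m≥ ℕ.* 2 ℕ.^ n ≡ 2 ℕ.^ z ℕ.* D
        2^Q₁ = trans (cong (ℕ._* 2 ℕ.^ n) (trans (ℕ.^-distribˡ-+-* 2 (6 ℕ.* z) g) (cong (ℕ._* 2 ℕ.^ g) (ℕ.^-distribˡ-+-* 2 z (5 ℕ.* z)))))
          (solve 4 (λ a b c d → a :* b :* c :* d := a :* (b :* d :* c)) refl (2 ℕ.^ z) (2 ℕ.^ (5 ℕ.* z)) (2 ℕ.^ g) (2 ℕ.^ n))

      #bad₃ : 2 ℕ.^ z ℕ.* # bad₃ ℕ.≤ N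
      #bad₃ = cancel-factor D (# bad₃) {{ℕ.m*n≢0 (2 ℕ.^ n) (2 ℕ.^ n) {{ℕ.m^n≢0 2 n}} {{ℕ.m^n≢0 2 n}}}} (begin
        2 ℕ.^ z ℕ.* D ℕ.* # bad₃               ≡⟨ cong (ℕ._* # bad₃) (trans (cong (2 ℕ.^ z ℕ.*_) (sym (ℕ.^-distribˡ-+-* 2 n n))) (sym (ℕ.^-distribˡ-+-* 2 z (n ℕ.+ n)))) ⟩
        2 ℕ.^ (z ℕ.+ (n ℕ.+ n)) ℕ.* # bad₃     ≤⟨ ℕ.*-monoˡ-≤ (# bad₃) (ℕ.^-monoʳ-≤ 2 exponent) ⟩
        2 ℕ.^ (k ℕ.* B) ℕ.* # bad₃             ≡⟨ cong (ℕ._* # bad₃) (sym (ℕ.^-*-assoc 2 k B)) ⟩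
        (2 ℕ.^ k) ℕ.^ B ℕ.* # bad₃             ≤⟨ count-concentrated k n V m B ⟩
        D ℕ.* N                                ∎)
        where
        open ℕ.≤-Reasoning
        D = 2 ℕ.^ n ℕ.* 2 ℕ.^ n
        exponent : z ℕ.+ (n ℕ.+ n) ℕ.≤ k ℕ.* (9 ℕ.* z)
        exponent = begin
          z ℕ.+ (n ℕ.+ n)                                        ≤⟨ ℕ.+-mono-≤ (ℕ.m≤n*m z k) (ℕ.+-mono-≤ n≤4kz n≤4kz) ⟩
          k ℕ.* z ℕ.+ (4 ℕ.* k ℕ.* z ℕ.+ 4 ℕ.* k ℕ.* z)          ≡⟨ solve 2 (λ k z → k :* z :+ (con 4 :* k :* z :+ con 4 :* k :* z) := k :* (con 9 :* z)) refl k z ⟩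
          k ℕ.* (9 ℕ.* z)                                        ∎

      good-success : ∀ ω → ω ℕ.≤ 16 ℕ.^ z → ∀ Φ → bad₁ Φ ≡ false → bad₂ Φ ≡ false → bad₃ Φ ≡ false →
                     successProbability Φ ω * fromℕ (16 ℕ.^ z) ≤ 1ℚ
      good-success ω ω≤ Φ ¬bad₁ ¬bad₂ ¬bad₃ = GoodFormula.success-small k n z B h R′ escape z≤n′ h≡ small Φ
        (record { few-stars = ¬bad₁ ; few-near = ¬bad₂ ; unconcentrated = ¬bad₃ }) ω ω≤

      module _ (S : Formula k n m → Bool) (good⇒S : ∀ Φ → bad₁ Φ ≡ false → bad₂ Φ ≡ false → bad₃ Φ ≡ false → S Φ ≡ true) where

        N≤ : N ℕ.≤ # S ℕ.+ (# bad₁ ℕ.+ (# bad₂ ℕ.+ # bad₃))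
        N≤ = begin
          N                                                                     ≡⟨ sym (ℕ.*-identityʳ N) ⟩
          N ℕ.* 1                                                               ≡⟨ sym (total-const F 1) ⟩
          total F (λ _ → 1)                                                     ≤⟨ total-mono F pointwise ⟩
          total F (λ Φ → 𝟙 (S Φ) ℕ.+ (𝟙 (bad₁ Φ) ℕ.+ (𝟙 (bad₂ Φ) ℕ.+ 𝟙 (bad₃ Φ))))
            ≡⟨ trans (total-+ F (𝟙 ∘ S) (λ Φ → 𝟙 (bad₁ Φ) ℕ.+ (𝟙 (bad₂ Φ) ℕ.+ 𝟙 (bad₃ Φ)))) (cong (# S ℕ.+_)
                 (trans (total-+ F (𝟙 ∘ bad₁) (λ Φ → 𝟙 (bad₂ Φ) ℕ.+ 𝟙 (bad₃ Φ))) (cong (# bad₁ ℕ.+_) (total-+ F (𝟙 ∘ bad₂) (𝟙 ∘ bad₃))))) ⟩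
          # S ℕ.+ (# bad₁ ℕ.+ (# bad₂ ℕ.+ # bad₃))                              ∎
          where
          open ℕ.≤-Reasoning
          pointwise : ∀ Φ → 1 ℕ.≤ 𝟙 (S Φ) ℕ.+ (𝟙 (bad₁ Φ) ℕ.+ (𝟙 (bad₂ Φ) ℕ.+ 𝟙 (bad₃ Φ)))
          pointwise Φ with bad₁ Φ | bad₂ Φ | bad₃ Φ | good⇒S Φ
          ... | true  | b     | d     | _ = ℕ.≤-trans (s≤s z≤n) (ℕ.m≤n+m (1 ℕ.+ (𝟙 b ℕ.+ 𝟙 d)) (𝟙 (S Φ)))
          ... | false | true  | d     | _ = ℕ.≤-trans (s≤s z≤n) (ℕ.m≤n+m (1 ℕ.+ 𝟙 d) (𝟙 (S Φ)))
          ... | false | false | true  | _ = ℕ.m≤n+m 1 (𝟙 (S Φ))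
          ... | false | false | false | f = ℕ.≤-trans (ℕ.≤-reflexive (cong 𝟙 (sym (f refl refl refl)))) (ℕ.m≤m+n _ 0)

        -- Each of the three exceptional events has probability at most 2 ^ (- z).
        Pr-S : ∀ ε → fromℕ 3 ≤ fromℕ (2 ℕ.^ z) * ε → 1ℚ - ε ≤ Pr (randomFormula k n m) S
        Pr-S ε 3≤ = begin
          1ℚ - ε                                          ≡⟨ cong (_- ε) (sym (1/n*n N)) ⟩
          u * fromℕ N - ε                                 ≤⟨ ℚ.+-monoˡ-≤ (- ε) (ℚ.*-monoˡ-≤-nonNeg u {{1/n-nonNeg N}} (fromℕ-mono N≤)) ⟩
          u * fromℕ (# S ℕ.+ #bad) - ε                    ≡⟨ cong (λ p → u * p - ε) (fromℕ-+ (# S) #bad) ⟩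
          u * (fromℕ (# S) + fromℕ #bad) - ε              ≡⟨ solve′ 4 (λ u s b e → u :*′ (s :+′ b) :-′ e :=′ u :*′ s :+′ (u :*′ b :-′ e)) refl u (fromℕ (# S)) (fromℕ #bad) ε ⟩
          u * fromℕ (# S) + (u * fromℕ #bad - ε)          ≤⟨ ℚ.+-mono-≤ uS≤ (ℚ.≤-trans (ℚ.+-monoˡ-≤ (- ε) ub≤ε) (ℚ.≤-reflexive (ℚ.+-inverseʳ ε))) ⟩
          Pr (randomFormula k n m) S + 0ℚ                 ≡⟨ ℚ.+-identityʳ _ ⟩
          Pr (randomFormula k n m) S                      ∎
          where
          open ℚ.≤-Reasoning
          open +-*-Solver using () renaming (solve to solve′; _:*_ to _:*′_; _:+_ to _:+′_; _:-_ to _:-′_; _:=_ to _:=′_)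
          instance
            N≢0 : NonZero N
            N≢0 = ℕ.m^n≢0 _ m {{ℕ.m^n≢0 (2 ℕ.* n) k {{ℕ.m*n≢0 2 n}}}}
          u = ℤ.+ 1 / N
          #bad = # bad₁ ℕ.+ (# bad₂ ℕ.+ # bad₃)
          uS≤ : u * fromℕ (# S) ≤ Pr (randomFormula k n m) S
          uS≤ = ℚ.≤-trans (ℚ.≤-reflexive (sym (mean-fromℕ N (λ i → 𝟙 (S (Inverse.to F i))))))
            (mean-mono N (λ i → ℚ.≤-reflexive (indicator (S (Inverse.to F i)))))
            where
            indicator : ∀ b → fromℕ (𝟙 b) ≡ (if b then 1ℚ else 0ℚ)
            indicator true  = refl
            indicator false = refl
          2^z#bad≤ : #bad ℕ.* 2 ℕ.^ z ℕ.≤ N ℕ.* 3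
          2^z#bad≤ = subst₂ ℕ._≤_
            (solve 4 (λ p a b c → p :* a :+ (p :* b :+ p :* c) := (a :+ (b :+ c)) :* p) refl (2 ℕ.^ z) (# bad₁) (# bad₂) (# bad₃))
            (solve 1 (λ n → n :+ (n :+ n) := n :* con 3) refl N)
            (ℕ.+-mono-≤ #bad₁ (ℕ.+-mono-≤ #bad₂ #bad₃))
          ub≤ε : u * fromℕ #bad ≤ ε
          ub≤ε = ℚ.*-cancelʳ-≤-pos (fromℕ (2 ℕ.^ z)) {{fromℕ-pos (2 ℕ.^ z) {{ℕ.m^n≢0 2 z}}}} (begin
            u * fromℕ #bad * fromℕ (2 ℕ.^ z)     ≡⟨ trans (ℚ.*-assoc u (fromℕ #bad) (fromℕ (2 ℕ.^ z))) (cong (u *_) (sym (fromℕ-* #bad (2 ℕ.^ z)))) ⟩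
            u * fromℕ (#bad ℕ.* 2 ℕ.^ z)         ≤⟨ ℚ.*-monoˡ-≤-nonNeg u {{1/n-nonNeg N}} (fromℕ-mono 2^z#bad≤) ⟩
            u * fromℕ (N ℕ.* 3)                  ≡⟨ 1/n*[n*d] N 3 ⟩
            fromℕ 3                              ≤⟨ 3≤ ⟩
            fromℕ (2 ℕ.^ z) * ε                  ≡⟨ ℚ.*-comm (fromℕ (2 ℕ.^ z)) ε ⟩
            ε * fromℕ (2 ℕ.^ z)                  ∎)

-- The absolute constant and the limit n → ∞.

module Conclusion where

  open Assignments
  open RationalMeans
  open Exponential
  open Estimates
  open Logarithm
  open Probabilities
  open import Data.Maybe.Base using (is-just)
  open import Data.Rational.Base using (ℚ; 0ℚ; 1ℚ; _/_; _+_; _*_; _-_; -_; _≤_; nonNegative)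
  open import Data.Nat.DivMod using (m≡m%n+[m/n]*n; m/n*n≤m; m%n<n; m*n/n≡m; /-monoˡ-≤)
  open import Relation.Nullary.Decidable.Core using (⌊_⌋; toWitness)

  -- The constant `C` of `Parameters`, which depends on V alone and so can be fixed before k and n.
  density : ℕ
  density = 11 ℕ.* (8 ℕ.* V ℕ.+ 22)

  constant : ℝ
  constant = fromℚ (fromℕ (16 ℕ.* density))

  0<constant : fromℚ 0ℚ <ᵣ constant
  0<constant = 1ℚ , ℚ.positive⁻¹ 1ℚ , 0 , λ _ _ → ℚ.≤-trans (ℚ.≤-reflexive (ℚ.+-identityˡ 1ℚ))
    (fromℕ-mono (ℕ.>-nonZero⁻¹ (16 ℕ.* density) {{ℕ.m*n≢0 16 density {{_}} {{ℕ.m*n≢0 11 (8 ℕ.* V ℕ.+ 22) {{_}} {{ℕ.>-nonZero (ℕ.≤-trans (s≤s z≤n) (ℕ.m≤n+m 22 (8 ℕ.* V)))}}}}}}))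

  module _ (k : ℕ) .{{_ : NonZero k}} (3≤k : 3 ℕ.≤ k) (m ω : ℕ → ℕ)
      (dense : ∀ n .{{_ : NonZero n}} → fromℚ (ℤ.+ m n / n) ≥ᵣ threshold constant k)
      (ω≡ : ∀ n .{{_ : NonZero n}} → ω n ≡⌈ exp (n/k² n k) ⌉) where

    failsWhp : WithHighProbability (λ n → randomFormula k n (m n))
                 (λ n Φ → fromℚ (successProbability Φ (ω n)) ≤ᵣ exp (- (n/k² n k)))
    failsWhp ε 0<ε = 2k ℕ.* z₀ , λ n {{_}} 2kz₀≤n → Large.conclusion n 2kz₀≤n
      where
      2k = 2 ℕ.* k
      -- As 2 ^ z₀ > z₀ ≥ 3 / ε, three events of probability 2 ^ (- z₀) fit into ε.
      z₀ = 3 ℕ.* ℚ.denominatorℕ ε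
      instance
        2k≢0 : NonZero 2k
        2k≢0 = ℕ.m*n≢0 2 k

      3≤ : fromℕ 3 ≤ fromℕ (2 ℕ.^ z₀) * ε
      3≤ = begin
        fromℕ 3 * 1ℚ                            ≤⟨ ℚ.*-monoˡ-≤-nonNeg (fromℕ 3) (1≤denominator* ε 0<ε) ⟩
        fromℕ 3 * (fromℕ (ℚ.denominatorℕ ε) * ε) ≡⟨ trans (sym (ℚ.*-assoc (fromℕ 3) (fromℕ (ℚ.denominatorℕ ε)) ε)) (cong (_* ε) (sym (fromℕ-* 3 (ℚ.denominatorℕ ε)))) ⟩
        fromℕ z₀ * ε                            ≤⟨ ℚ.*-monoʳ-≤-nonNeg ε {{nonNegative (ℚ.<⇒≤ 0<ε)}} (fromℕ-mono (ℕ.<⇒≤ (n<2^n z₀))) ⟩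
        fromℕ (2 ℕ.^ z₀) * ε                    ∎
        where open ℚ.≤-Reasoning

      module Large (n : ℕ) .{{_ : NonZero n}} (2kz₀≤n : 2k ℕ.* z₀ ℕ.≤ n) where

        -- So s = 2 z is about n / k; as z ≥ 1, rounding down loses at most a factor 2, whence n ≤ 4
        -- k z.
        z = n ℕ./ 2k
        z₀≤z : z₀ ℕ.≤ z
        z₀≤z = ℕ.≤-trans (ℕ.≤-reflexive (sym (m*n/n≡m z₀ 2k))) (/-monoˡ-≤ 2k (ℕ.≤-trans (ℕ.≤-reflexive (ℕ.*-comm z₀ 2k)) 2kz₀≤n))
        1≤z : 1 ℕ.≤ z
        1≤z = ℕ.≤-trans (s≤s z≤n) z₀≤z
        instance
          z≢0 : NonZero z
          z≢0 = ℕ.>-nonZero 1≤z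
        2kz≤n : 2k ℕ.* z ℕ.≤ n
        2kz≤n = ℕ.≤-trans (ℕ.≤-reflexive (ℕ.*-comm 2k z)) (m/n*n≤m n 2k)
        n≤4kz : n ℕ.≤ 4 ℕ.* k ℕ.* z
        n≤4kz = begin
          n                               ≡⟨ m≡m%n+[m/n]*n n 2k ⟩
          n ℕ.% 2k ℕ.+ z ℕ.* 2k           ≤⟨ ℕ.+-monoˡ-≤ (z ℕ.* 2k) (ℕ.≤-trans (ℕ.<⇒≤ (m%n<n n 2k)) (ℕ.m≤n*m 2k z)) ⟩
          z ℕ.* 2k ℕ.+ z ℕ.* 2k           ≡⟨ solve 2 (λ k z → z :* (con 2 :* k) :+ z :* (con 2 :* k) := con 4 :* k :* z) refl k z ⟩
          4 ℕ.* k ℕ.* z                   ∎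
          where
          open ℕ.≤-Reasoning
          open ℕSolver.+-*-Solver

        ℓ = proj₁ (dyadic k)
        2^ℓ≤k = proj₁ (proj₂ (dyadic k))
        k<2^ℓ+1 = proj₂ (proj₂ (dyadic k))
        1≤ℓ : 1 ℕ.≤ ℓ
        1≤ℓ = ℕ.≮⇒≥ λ ℓ<1 → ℕ.<⇒≱ k<2^ℓ+1 (ℕ.≤-trans (ℕ.^-monoʳ-≤ 2 ℓ<1) (ℕ.≤-trans (ℕ.n≤1+n 2) 3≤k))
        instance
          ℓ≢0 : NonZero ℓ
          ℓ≢0 = ℕ.>-nonZero 1≤ℓ

        m≥ : density ℕ.* 2 ℕ.^ k ℕ.* ℓ ℕ.* z ℕ.≤ m n
        m≥ = ℕ.*-cancelʳ-≤ _ _ k (begin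
          p ℕ.* ℓ ℕ.* z ℕ.* k                 ≤⟨ ℕ.m≤m*n (p ℕ.* ℓ ℕ.* z ℕ.* k) (2 ℕ.* ℓ) {{ℕ.m*n≢0 2 ℓ}} ⟩
          p ℕ.* ℓ ℕ.* z ℕ.* k ℕ.* (2 ℕ.* ℓ)   ≡⟨ solve 4 (λ p l z k → p :* l :* z :* k :* (con 2 :* l) := p :* (l :* l) :* (con 2 :* k :* z)) refl p ℓ z k ⟩
          p ℕ.* (ℓ ℕ.* ℓ) ℕ.* (2k ℕ.* z)      ≤⟨ ℕ.*-monoʳ-≤ (p ℕ.* (ℓ ℕ.* ℓ)) 2kz≤n ⟩
          p ℕ.* (ℓ ℕ.* ℓ) ℕ.* n               ≤⟨ threshold-≥ density k ℓ (m n) n 2^ℓ≤k (dense n) ⟩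
          m n ℕ.* k                           ∎)
          where
          open ℕ.≤-Reasoning
          open ℕSolver.+-*-Solver
          p = density ℕ.* 2 ℕ.^ k

        -- From n ≤ 4 k z ≤ 2 z k² follows exp (n / k²) ≤ 4 ^ (2 z) = 16 ^ z, the origin of the base
        -- 16.
        w = 2 ℕ.* z
        4^w≡16^z : 4 ℕ.^ w ≡ 16 ℕ.^ z
        4^w≡16^z = sym (ℕ.^-*-assoc 4 2 z)

        n/k²≤w : n/k² n k ≤ fromℕ w
        n/k²≤w = n/k²-≤ n k w (begin
          n                            ≤⟨ n≤4kz ⟩
          4 ℕ.* k ℕ.* z                ≡⟨ solve 2 (λ k z → con 4 :* k :* z := con 2 :* z :* (k :* con 2)) refl k z ⟩
          w ℕ.* (k ℕ.* 2)              ≤⟨ ℕ.*-monoʳ-≤ w (ℕ.*-monoʳ-≤ k (ℕ.≤-trans (ℕ.≤-trans (ℕ.n≤1+n 2) 3≤k) (ℕ.≤-reflexive (sym (ℕ.*-identityʳ k))))) ⟩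
          w ℕ.* k ℕ.^ 2                ∎)
          where
          open ℕ.≤-Reasoning
          open ℕSolver.+-*-Solver

        ω≤ : ω n ℕ.≤ 16 ℕ.^ z
        ω≤ = subst (ω n ℕ.≤_) 4^w≡16^z (proj₂ (ω≡ n) (4 ℕ.^ w) (exp-≤ w (n/k²-nonNeg n k) n/k²≤w))

        -- An inequality between reals cannot be decided; this rational one can, and it implies the
        -- event, as `PrAtLeast` asks.
        rare? : (Φ : Formula k n (m n)) → _
        rare? Φ = successProbability Φ (ω n) * fromℕ (16 ℕ.^ z) ℚ.≤? 1ℚ

        rare : Formula k n (m n) → Bool
        rare Φ = ⌊ rare? Φ ⌋

        open Fixed k n z ℓ (ℕ.≤-trans (ℕ.n≤1+n 2) 3≤k) 2kz≤n n≤4kz 1≤ℓ k<2^ℓ+1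

        conclusion : PrAtLeast (randomFormula k n (m n)) (λ Φ → fromℚ (successProbability Φ (ω n)) ≤ᵣ exp (- (n/k² n k))) (1ℚ - ε)
        conclusion = rare ,
          (λ Φ r → ≤exp- w (n/k²-nonNeg n k) n/k²≤w (Pr-nonNeg (walksat Φ (ω n)) is-just)
            (subst (λ e → successProbability Φ (ω n) * fromℕ e ≤ 1ℚ) (sym 4^w≡16^z) (toWitness {a? = rare? Φ} r))) ,
          Pr-S m≥ rare
            (λ Φ ¬b₁ ¬b₂ ¬b₃ → is-true (rare? Φ) (good-success m≥ (ω n) ω≤ Φ ¬b₁ ¬b₂ ¬b₃))
            ε (ℚ.≤-trans 3≤ (ℚ.*-monoʳ-≤-nonNeg ε {{nonNegative (ℚ.<⇒≤ 0<ε)}} (fromℕ-mono (ℕ.^-monoʳ-≤ 2 z₀≤z))))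
          where
          open import Relation.Nullary.Decidable.Core using (Dec; isYes)
          is-true : ∀ {P : Set} (d : Dec P) → P → isYes d ≡ true
          is-true (yes _) _ = refl
          is-true (no ¬p) p = contradiction p ¬p

open Conclusion using (constant; 0<constant; failsWhp)
open import Data.Integer.Base using (+_)
open import Data.Nat.Base using (_≤_)
open import Data.Rational.Base using (0ℚ; _/_; -_)

theorem1 : ∃ λ (c : ℝ) → (fromℚ 0ℚ <ᵣ c) ×
    (∀ (k : ℕ) .{{_ : NonZero k}} → 3 ≤ k →
    ∀ (m : ℕ → ℕ) →
    (∀ n .{{_ : NonZero n}} → fromℚ (+ m n / n) ≥ᵣ threshold c k) →
    ∀ (ω : ℕ → ℕ) →
    (∀ n .{{_ : NonZero n}} → ω n ≡⌈ exp (n/k² n k) ⌉) →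
    WithHighProbability (λ n → randomFormula k n (m n))
    (λ n Φ → fromℚ (successProbability Φ (ω n)) ≤ᵣ exp (- (n/k² n k))))
theorem1 = constant , 0<constant , λ k 3≤k m dense ω ω≡ → failsWhp k 3≤k m ω dense ω≡
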